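{- There exists a universal constant $c>0$ such that the following holds. Fix an integer $r\ge 2$ and an $r$-colouring of the edges of $K_n$ (with colours in $[r]$). Then, for every tree $T$ on $n$ vertices with maximum degree $\Delta$, there exist a colour $i\in [r]$ and a copy of $T$ in $K_n$ in which the number of edges in colour $i$ is at least $$\frac{n-1}{r}+\frac{c}{r^2}(n-1-\Delta).$$
   Context: $[r]=\{1,\dots,r\}$. An $r$-colouring of the edges of a graph is an arbitrary map from its edge set to $[r]$. A copy of $T$ in $K_n$ is a subgraph of $K_n$ isomorphic to $T$. The constant $c$ does not depend on $r$, $n$, $T$, $\Delta$ or the colouring. -}

module Defs where

open import Data.Fin.Base as Fin using (Fin; zero; suc; inject₁; fromℕ)
import Data.Fin.Properties as Fin
open import Data.Fin.Subset using (Subset; _∈_)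
open import Data.Integer.Base as ℤ using (1ℤ)
open import Data.List.Base
  using (List; length; map; filter; mapMaybe; foldr; allFin; cartesianProduct)
open import Data.Maybe.Base using (Maybe; just; nothing)
open import Data.Nat.Base as ℕ using (ℕ; NonZero; _⊔_)
open import Data.Nat.Properties using (m^n≢0)
open import Data.Product.Base using (∃; _×_; _,_; proj₁)
open import Data.Rational.Base as ℚ using (ℚ; _/_)
open import Function.Bundles using (_↔_; _⇔_; Inverse)
open import Function.Definitions using (Injective)
open import Level using (0ℓ)
open import Relation.Binary.Construct.Closure.ReflexiveTransitive using (Star)
open import Relation.Binary.Core using (Rel)
open import Relation.Binary.Definitions using (Symmetric; Irreflexive; Decidable)
open import Relation.Binary.PropositionalEquality using (_≡_; _≢_; ≢-sym)
open import Relation.Nullary using (¬_; yes; no; ¬?)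

private
  variable
    m n r : ℕ

-- Finite simple graphs on the vertex set Fin n.
record Graph (n : ℕ) : Set₁ where
  infix 4 _~_ _~?_
  field
    _~_      : Rel (Fin n) 0ℓ
    _~?_     : Decidable _~_
    ~-sym    : Symmetric _~_
    ~-irrefl : Irreflexive _≡_ _~_

K : (n : ℕ) → Graph n
K n = record
  { _~_      = _≢_
  ; _~?_     = λ u v → ¬? (u Fin.≟ v)
  ; ~-sym    = ≢-sym
  ; ~-irrefl = λ u≡v u≢v → u≢v u≡v
  }

-- The unordered edge {u , v} is represented once, by its ordering u < v.
-- The proofs are irrelevant, so an edge is determined by its endpoints.
record Edge (G : Graph n) : Set where
  constructor edge
  open Graph G
  field
    u v        : Fin n
    .ordered   : u Fin.< v
    .adjacent  : u ~ v

edge? : (G : Graph n) → Fin n × Fin n → Maybe (Edge G)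
edge? G (u , v) with u Fin.<? v | Graph._~?_ G u v
... | yes u<v | yes u~v = just (edge u v u<v u~v)
... | yes _   | no _    = nothing
... | no _    | _       = nothing

edges : (G : Graph n) → List (Edge G)
edges {n} G = mapMaybe (edge? G) (cartesianProduct (allFin n) (allFin n))

degree : Graph n → Fin n → ℕ
degree {n} G u = length (filter (Graph._~?_ G u) (allFin n))

maxDegree : Graph n → ℕ
maxDegree {n} G = foldr _⊔_ 0 (map (degree G) (allFin n))

-- A cycle v₀ v₁ … vₖ₊₂ v₀ on k + 3 distinct vertices.
record Cycle (G : Graph n) : Set where
  open Graph G
  field
    k        : ℕ
    vertex   : Fin (3 ℕ.+ k) → Fin n
    distinct : Injective _≡_ _≡_ vertex
    step     : ∀ i → vertex (inject₁ i) ~ vertex (suc i)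
    close    : vertex (fromℕ (2 ℕ.+ k)) ~ vertex zero

record IsTree (G : Graph n) : Set where
  open Graph G
  field
    nonEmpty  : NonZero n
    connected : ∀ u v → Star _~_ u v
    acyclic   : ¬ Cycle G

record Subgraph (G : Graph n) : Set₁ where
  private module G = Graph G
  field
    vertices : Subset n
    -- The edges of the subgraph, as a graph on all of Fin n.
    graph    : Graph n
  open Graph graph public
  field
    ~⇒∈ : ∀ {u v} → u ~ v → u ∈ vertices
    ~⇒~ : ∀ {u v} → u ~ v → u G.~ v

infix 4 _≅_

record _≅_ {G : Graph n} (T : Graph m) (H : Subgraph G) : Set where
  private
    module T = Graph T
    module H = Subgraph H
  field
    bijection : Fin m ↔ ∃ (_∈ H.vertices)

  to : Fin m → Fin n
  to u = proj₁ (Inverse.to bijection u)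

  field
    ~⇔~ : ∀ u v → u T.~ v ⇔ to u H.~ to v

Colouring : Graph n → ℕ → Set
Colouring G r = Edge G → Fin r

include : {G : Graph n} (H : Subgraph G) → Edge (Subgraph.graph H) → Edge G
include H (edge u v u<v u~v) = edge u v u<v (Subgraph.~⇒~ H u~v)

colourCount : {G : Graph n} → Colouring G r → Fin r → Subgraph G → ℕ
colourCount χ i H =
  length (filter (λ e → χ (include H e) Fin.≟ i) (edges (Subgraph.graph H)))

-- (n - 1)/r + (c/r²)(n - 1 - Δ), with untruncated subtraction.
-- A rational c loses nothing against a real one: for trees n - 1 - Δ ≥ 0, so
-- the bound is monotone in c, and below any real c > 0 lies a rational c > 0.
bound : (c : ℚ) (r : ℕ) .{{_ : NonZero r}} (n Δ : ℕ) → ℚ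
bound c r n Δ =
  (ℤ.+ n ℤ.- 1ℤ) / r
    ℚ.+ c ℚ.* (1ℤ / (r ℕ.^ 2)) ℚ.* ((ℤ.+ n ℤ.- 1ℤ ℤ.- ℤ.+ Δ) / 1)
  where instance _ = m^n≢0 r 2

{-# OPTIONS --safe #-}
module Submission where

-- Fix a colour of density p ≥ 1/r and embed T by a uniformly random bijection π:
-- the expected number of edges of that colour is p (n − 1).  To gain on the
-- average, call x, x′, u, w a gadget if u ~ x and w ~ x′ but u ≁ x′, w ≁ x and
-- x ≁ x′.  Swapping π(x) with π(x′) changes the count by some amount; swapping
-- π(u) with π(w) first alters this amount by twice the alternating sum of the
-- colour over the 4-cycle π(u) π(x) π(w) π(x′).  So a gadget allows an expected
-- gain of at least half of the mean absolute alternating sum over a random 4-cycle,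
-- and gadgets whose vertices x, x′ are pairwise distinct and non-adjacent can be
-- optimised independently.
--
-- A tree has at least (n − 1 − Δ)/7 such gadgets: pair up the leaves with distinct
-- neighbours, or pair up the inner vertices within a colour class of the bipartition.
--
-- If p is bounded away from 1 and n ≥ 20 r, a random 4-cycle is unbalanced with
-- probability of order 1/r²: either many edges of the colour join vertices of
-- bounded-away codegree, or there are about n/r vertices of nearly full degree.
-- If n < 20 r, integrality turns any improvement over the average into one of the
-- required size, and a graph without unbalanced 4-cycles is empty, complete, a star
-- or the complement of a star, whose edge number does not have density exactly 1/r.

open import Defs
open import Data.Bool.Base using (Bool; true; false; not; if_then_else_)
open import Data.Bool.Properties as Bool using (not-¬)
open import Data.Empty using (⊥)
open import Data.Fin.Base as Fin using (Fin; zero; suc; inject₁; fromℕ; opposite)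
open import Data.Fin.Permutation.Components using (transpose)
open import Data.Fin.Properties as Fin using (_≟_; all?; any?; opposite-involutive)
open import Data.Fin.Subset using (⊤)
open import Data.Fin.Subset.Properties using (∈⊤)
open import Data.List.Base using (List; []; _∷_; _++_; map; length; filter; mapMaybe; foldr; allFin; cartesianProduct; cartesianProductWith)
open import Data.List.Membership.Propositional using (_∈_; _∉_; find)
open import Data.List.Membership.Propositional.Properties
  using (∈-allFin; ∈-∃++; ∈-++⁺ˡ; ∈-++⁺ʳ; ∈-++⁻; ∈-map⁺; ∈-map⁻; ∈-filter⁺; ∈-filter⁻; ∈-cartesianProductWith⁺)
open import Data.List.Membership.Propositional.Properties.WithK using (unique∧set⇒bag)
open import Data.List.Properties using (map-∘; length-++; length-map; length-tabulate)
open import Data.List.Relation.Binary.BagAndSetEquality using (∼bag⇒↭)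
open import Data.List.Relation.Binary.Permutation.Propositional using (_↭_; prep; ↭-refl; ↭-sym; ↭-trans; ↭⇒↭ₛ)
open import Data.List.Relation.Binary.Permutation.Propositional.Properties using (map⁺; ↭-length; shift; ++⁺ˡ; ∈-resp-↭)
import Data.List.Relation.Binary.Permutation.Setoid.Properties as Permutationₛ
open import Data.List.Relation.Unary.All as All using (All; []; _∷_)
open import Data.List.Relation.Unary.All.Properties using (¬Any⇒All¬)
open import Data.List.Relation.Unary.AllPairs as AllPairs using (AllPairs; []; _∷_)
open import Data.List.Relation.Unary.Any as Any using (here; there)
open import Data.List.Relation.Unary.Unique.Propositional using (Unique)
open import Data.List.Relation.Unary.Unique.Propositional.Properties as Unique using (allFin⁺; filter⁺)
open import Data.Maybe.Base using (Maybe; just; nothing; maybe′)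
open import Data.Nat.Base hiding (_/_)
open import Data.Nat.Divisibility using (_∣_; divides; ∣m+n∣m⇒∣n; ∣m∣n⇒∣m+n; ∣-refl; ∣⇒≤; m∣m*n)
open import Data.Nat.ListAction using (sum)
open import Data.Nat.ListAction.Properties using (sum-↭)
open import Data.Nat.Properties hiding (_≟_)
open import Data.Nat.Tactic.RingSolver using (solve-∀)
open import Data.Product using (Σ-syntax; ∃-syntax; ∃₂; _×_; _,_; proj₁; proj₂)
open import Data.Sum using (_⊎_; inj₁; inj₂)
open import Data.Vec.Base using (Vec; []; _∷_; lookup; tabulate)
open import Data.Vec.Properties as Vec using (lookup∘tabulate; tabulate∘lookup; tabulate-cong)
open import Data.Vec.Properties.WithK using ([]=-irrelevant)
open import Function.Base using (_∘_; id)
open import Function.Bundles using (mk⇔; mk↔ₛ′)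
open import Relation.Binary.Construct.Closure.ReflexiveTransitive using (Star; ε; _◅_)
open import Relation.Binary.Definitions using (Symmetric; Tri; tri<; tri≈; tri>)
open import Relation.Binary.PropositionalEquality hiding (J; [_])
open import Relation.Nullary using (Dec; yes; no; does; ¬_; ¬?; contradiction)
open import Relation.Nullary.Decidable using (_×-dec_; _⊎-dec_; _→-dec_; dec-true; dec-false; decidable-stable)
open import Relation.Unary using (Decidable)

-- The leading term (n - 1)/r leaves no slack: the average over pairs is therefore an exact
-- identity, and all n - 1 edges of T must be accounted for. The gain may lose constant factors, so
-- the n (n - 1)(n - 2)(n - 3) ordered 4-cycles are simply bounded by n⁴. Expectations appear as
-- sums over all bijections with denominators cleared, and edges are counted as ordered pairs, hence
-- the recurring factors 2.
--
-- The swap of π(u) with π(w) serves only to bound the mean gain from below; it is never performed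
-- on the final embedding. Separation of gadgets therefore constrains x and x′ alone, and gadgets
-- may share u and w.
--
-- The order 1/r² is due to vertices of nearly full degree: about n/r of them form about (n/r)²
-- pairs, each completed to an unbalanced 4-cycle in order n² ways. The other case gives order 1/r.
-- A colour of density at least 3/5 needs no gadgets, because for r ≥ 2 its average already exceeds
-- (n - 1)/r by a constant factor.

private
  variable
    A B : Set
    n : ℕ
    xs ys : List A

-- Finite sums over lists

∑ : List A → (A → ℕ) → ℕ
∑ xs f = sum (map f xs)

∑-cong-∈ : ∀ (xs : List A) {f g : A → ℕ} → (∀ {x} → x ∈ xs → f x ≡ g x) → ∑ xs f ≡ ∑ xs g
∑-cong-∈ []       eq = refl
∑-cong-∈ (x ∷ xs) eq = cong₂ _+_ (eq (here refl)) (∑-cong-∈ xs (eq ∘ there))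

∑-cong : ∀ (xs : List A) {f g : A → ℕ} → (∀ x → f x ≡ g x) → ∑ xs f ≡ ∑ xs g
∑-cong xs eq = ∑-cong-∈ xs (λ {x} _ → eq x)

∑-mono-∈ : ∀ (xs : List A) {f g : A → ℕ} → (∀ {x} → x ∈ xs → f x ≤ g x) → ∑ xs f ≤ ∑ xs g
∑-mono-∈ []       le = z≤n
∑-mono-∈ (x ∷ xs) le = +-mono-≤ (le (here refl)) (∑-mono-∈ xs (le ∘ there))

∑-mono : ∀ (xs : List A) {f g : A → ℕ} → (∀ x → f x ≤ g x) → ∑ xs f ≤ ∑ xs g
∑-mono xs le = ∑-mono-∈ xs (λ {x} _ → le x)

∑-+ : ∀ (xs : List A) (f g : A → ℕ) → ∑ xs (λ x → f x + g x) ≡ ∑ xs f + ∑ xs g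
∑-+ []       f g = refl
∑-+ (x ∷ xs) f g = trans (cong (f x + g x +_) (∑-+ xs f g)) (lem (f x) (g x) (∑ xs f) (∑ xs g))
  where
  lem : ∀ a b c d → (a + b) + (c + d) ≡ (a + c) + (b + d)
  lem = solve-∀

∑-*ˡ : ∀ (xs : List A) k (f : A → ℕ) → ∑ xs (λ x → k * f x) ≡ k * ∑ xs f
∑-*ˡ []       k f = sym (*-zeroʳ k)
∑-*ˡ (x ∷ xs) k f = trans (cong (k * f x +_) (∑-*ˡ xs k f)) (sym (*-distribˡ-+ k (f x) _))

∑-*ʳ : ∀ (xs : List A) k (f : A → ℕ) → ∑ xs (λ x → f x * k) ≡ ∑ xs f * k
∑-*ʳ xs k f = trans (∑-cong xs (λ x → *-comm (f x) k)) (trans (∑-*ˡ xs k f) (*-comm k _))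

∑-const : ∀ (xs : List A) k → ∑ xs (λ _ → k) ≡ length xs * k
∑-const []       k = refl
∑-const (x ∷ xs) k = cong (k +_) (∑-const xs k)

∑-zero : ∀ (xs : List A) → ∑ xs (λ _ → 0) ≡ 0
∑-zero []       = refl
∑-zero (x ∷ xs) = ∑-zero xs

∑-swap : ∀ (xs : List A) (ys : List B) (f : A → B → ℕ) →
         ∑ xs (λ x → ∑ ys (f x)) ≡ ∑ ys (λ y → ∑ xs (λ x → f x y))
∑-swap []       ys f = sym (∑-zero ys)
∑-swap (x ∷ xs) ys f = trans (cong (∑ ys (f x) +_) (∑-swap xs ys f)) (sym (∑-+ ys (f x) _))

∑-↭ : ∀ (f : A → ℕ) → xs ↭ ys → ∑ xs f ≡ ∑ ys f
∑-↭ f = sum-↭ ∘ map⁺ f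

∑-map : ∀ (xs : List A) (h : A → B) (f : B → ℕ) → ∑ (map h xs) f ≡ ∑ xs (f ∘ h)
∑-map xs h f = cong sum (sym (map-∘ xs))

∑-++ : ∀ (xs ys : List A) (f : A → ℕ) → ∑ (xs ++ ys) f ≡ ∑ xs f + ∑ ys f
∑-++ []       ys f = refl
∑-++ (x ∷ xs) ys f = trans (cong (f x +_) (∑-++ xs ys f)) (sym (+-assoc (f x) _ _))

-- The first-moment principle with the division cleared: some member reaches the average.
∑-pigeonhole : ∀ x (xs : List A) (f : A → ℕ) →
               ∃[ y ] y ∈ x ∷ xs × ∑ (x ∷ xs) f ≤ length (x ∷ xs) * f y
∑-pigeonhole x []       f = x , here refl , ≤-refl
∑-pigeonhole x (z ∷ xs) f with ∑-pigeonhole z xs f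
... | y , y∈ , le with ≤-total (f x) (f y)
... | inj₁ fx≤fy = y , there y∈ , +-mono-≤ fx≤fy le
... | inj₂ fy≤fx = x , here refl , +-monoʳ-≤ (f x) (≤-trans le (*-monoʳ-≤ (length (z ∷ xs)) fy≤fx))

∑-≥ : ∀ {xs : List A} {x} (f : A → ℕ) → x ∈ xs → f x ≤ ∑ xs f
∑-≥ f (here refl) = m≤m+n _ _
∑-≥ f (there x∈) = ≤-trans (∑-≥ f x∈) (m≤n+m _ _)

∑≡0⇒ : ∀ {xs : List A} {x} (f : A → ℕ) → ∑ xs f ≡ 0 → x ∈ xs → f x ≡ 0
∑≡0⇒ f eq x∈ = n≤0⇒n≡0 (subst (_ ≤_) eq (∑-≥ f x∈))

∑>0⇒∃ : ∀ (xs : List A) (f : A → ℕ) → 0 < ∑ xs f → ∃[ x ] 0 < f x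
∑>0⇒∃ (x ∷ xs) f pos with f x in eq
... | zero  = ∑>0⇒∃ xs f pos
... | suc _ = x , subst (0 <_) (sym eq) z<s

𝟙 : {P : Set} → Dec P → ℕ
𝟙 P? = if does P? then 1 else 0

𝟙-yes : {P : Set} (P? : Dec P) → P → 𝟙 P? ≡ 1
𝟙-yes (yes _) _ = refl
𝟙-yes (no ¬p) p = contradiction p ¬p

𝟙-no : {P : Set} (P? : Dec P) → ¬ P → 𝟙 P? ≡ 0
𝟙-no (yes p) ¬p = contradiction p ¬p
𝟙-no (no _)  _  = refl

length-filter-∑ : {P : A → Set} (P? : Decidable P) (xs : List A) → length (filter P? xs) ≡ ∑ xs (𝟙 ∘ P?)
length-filter-∑ P? []       = refl
length-filter-∑ P? (x ∷ xs) with does (P? x)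
... | true  = cong suc (length-filter-∑ P? xs)
... | false = length-filter-∑ P? xs

∑ᶠ : (Fin n → ℕ) → ℕ
∑ᶠ {n} = ∑ (allFin n)

∑ᶠ-const : ∀ k → ∑ᶠ {n} (λ _ → k) ≡ n * k
∑ᶠ-const {n} k = trans (∑-const (allFin n) k) (cong (_* k) (length-tabulate {n = n} id))

∑-𝟙-∉ : ∀ {xs : List (Fin n)} x (f : Fin n → ℕ) → x ∉ xs → ∑ xs (λ y → 𝟙 (x ≟ y) * f y) ≡ 0
∑-𝟙-∉ {xs = xs} x f x∉ = trans (∑-cong-∈ xs (λ {y} y∈ → cong (_* f y) (𝟙-no (x ≟ y) λ { refl → x∉ y∈ }))) (∑-zero xs)

∑-𝟙 : ∀ {xs : List (Fin n)} {x} (f : Fin n → ℕ) → Unique xs → x ∈ xs → ∑ xs (λ y → 𝟙 (x ≟ y) * f y) ≡ f x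
∑-𝟙 {xs = z ∷ xs} {x} f (z∉ ∷ u) (here refl) =
  trans (cong₂ _+_ (trans (cong (_* f x) (𝟙-yes (x ≟ x) refl)) (+-identityʳ _))
                   (∑-𝟙-∉ {xs = xs} x f (λ x∈ → All.lookup z∉ x∈ refl)))
        (+-identityʳ _)
∑-𝟙 {xs = z ∷ xs} {x} f (z∉ ∷ u) (there x∈) =
  cong₂ _+_ (cong (_* f z) (𝟙-no (x ≟ z) (λ { refl → All.lookup z∉ x∈ refl }))) (∑-𝟙 f u x∈)

∑ᶠ-𝟙 : ∀ (x : Fin n) (f : Fin n → ℕ) → ∑ᶠ (λ y → 𝟙 (x ≟ y) * f y) ≡ f x
∑ᶠ-𝟙 {n} x f = ∑-𝟙 f (allFin⁺ n) (∈-allFin x)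

∑ᶠ-𝟙-1 : ∀ (x : Fin n) → ∑ᶠ (λ y → 𝟙 (x ≟ y)) ≡ 1
∑ᶠ-𝟙-1 {n} x = trans (∑-cong (allFin n) (λ y → sym (*-identityʳ _))) (∑ᶠ-𝟙 x (λ _ → 1))

∑ᶠ-1 : ∀ n → ∑ᶠ {n} (λ _ → 1) ≡ n
∑ᶠ-1 n = trans (∑ᶠ-const {n} 1) (*-identityʳ n)

Unique-⊆-length : Unique xs → (∀ {x} → x ∈ xs → x ∈ ys) → length xs ≤ length ys
Unique-⊆-length {xs = []} _ _ = z≤n
Unique-⊆-length {xs = x ∷ xs} (x∉ ∷ u) sub with ∈-∃++ (sub (here refl))
... | as , bs , refl = begin
  suc (length xs)               ≤⟨ s≤s (Unique-⊆-length u sub′) ⟩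
  suc (length (as ++ bs))       ≡⟨ cong suc (length-++ as) ⟩
  suc (length as + length bs)   ≡⟨ +-suc (length as) (length bs) ⟨
  length as + suc (length bs)   ≡⟨ length-++ as ⟨
  length (as ++ x ∷ bs)         ∎
  where
  open ≤-Reasoning
  sub′ : ∀ {y} → y ∈ xs → y ∈ as ++ bs
  sub′ y∈ with ∈-++⁻ as (sub (there y∈))
  ... | inj₁ y∈as             = ∈-++⁺ˡ y∈as
  ... | inj₂ (here refl)      = contradiction refl (All.lookup x∉ y∈)
  ... | inj₂ (there y∈bs)     = ∈-++⁺ʳ as y∈bs

Unique-full⇒∈ : {xs : List (Fin n)} → Unique xs → n ≤ length xs → ∀ y → y ∈ xs
Unique-full⇒∈ {n} {xs} u n≤ y with y ∈? xs
  where open import Data.List.Membership.DecPropositional (_≟_ {n}) using (_∈?_)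
... | yes y∈ = y∈
... | no y∉  = contradiction
  (≤-trans (Unique-⊆-length {xs = y ∷ xs} (All.tabulate (λ z∈ → λ { refl → y∉ z∈ }) ∷ u) (λ _ → ∈-allFin _))
           (≤-reflexive (length-tabulate {n = n} id)))
  (<⇒≱ (s≤s n≤))

Unique-full⇒↭ : {xs : List (Fin n)} → Unique xs → (∀ y → y ∈ xs) → xs ↭ allFin n
Unique-full⇒↭ {n} u full = ∼bag⇒↭ (unique∧set⇒bag u (allFin⁺ n) (mk⇔ (λ _ → ∈-allFin _) (λ _ → full _)))

∑ᶠ-reindex : (h : Fin n → Fin n) → (∀ {x y} → h x ≡ h y → x ≡ y) →
             (f : Fin n → ℕ) → ∑ᶠ (f ∘ h) ≡ ∑ᶠ f
∑ᶠ-reindex {n} h inj f = trans (sym (∑-map (allFin n) h f)) (∑-↭ f (Unique-full⇒↭ u (Unique-full⇒∈ u (≤-reflexive len))))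
  where
  u = Unique.map⁺ inj (allFin⁺ n)
  open import Data.List.Properties using (length-map)
  len : n ≡ length (map h (allFin n))
  len = sym (trans (length-map h (allFin n)) (length-tabulate {n = n} id))

∑-involution : (h : A → A) → (∀ x → h (h x) ≡ x) → Unique xs → (∀ {x} → x ∈ xs → h x ∈ xs) →
               (f : A → ℕ) → ∑ xs (f ∘ h) ≡ ∑ xs f
∑-involution {xs = xs} h hh u closed f = trans (sym (∑-map xs h f)) (∑-↭ f
  (∼bag⇒↭ (unique∧set⇒bag (Unique.map⁺ (λ {x} {y} eq → trans (sym (hh x)) (trans (cong h eq) (hh y))) u) u
    (mk⇔ (λ m → let x , x∈ , eq = ∈-map⁻ h m in subst (_∈ xs) (sym eq) (closed x∈))
         (λ m → subst (_∈ map h xs) (hh _) (∈-map⁺ h (closed m)))))))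

-- Averaging over permutations

transpose-ˡ : (i j : Fin n) → transpose i j i ≡ j
transpose-ˡ i j rewrite dec-true (i ≟ i) refl = refl

transpose-ʳ : (i j : Fin n) → transpose i j j ≡ i
transpose-ʳ i j with j ≟ i
... | yes refl = refl
... | no _ rewrite dec-true (j ≟ j) refl = refl

transpose-fix : {i j k : Fin n} → k ≢ i → k ≢ j → transpose i j k ≡ k
transpose-fix {i = i} {j} {k} k≢i k≢j
  rewrite dec-false (k ≟ i) k≢i | dec-false (k ≟ j) k≢j = refl

data TransposeView (i j k : Fin n) : Set where
  left  : k ≡ i → TransposeView i j k
  right : k ≡ j → TransposeView i j k
  fixed : k ≢ i → k ≢ j → TransposeView i j k

transposeView : (i j k : Fin n) → TransposeView i j k
transposeView i j k with k ≟ i | k ≟ j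
... | yes k≡i | _       = left k≡i
... | no _    | yes k≡j = right k≡j
... | no k≢i  | no k≢j  = fixed k≢i k≢j

transpose-involutive : (i j k : Fin n) → transpose i j (transpose i j k) ≡ k
transpose-involutive i j k with transposeView i j k
... | left refl     = trans (cong (transpose i j) (transpose-ˡ i j)) (transpose-ʳ i j)
... | right refl    = trans (cong (transpose i j) (transpose-ʳ i j)) (transpose-ˡ i j)
... | fixed k≢i k≢j = trans (cong (transpose i j) (transpose-fix k≢i k≢j)) (transpose-fix k≢i k≢j)

transpose-injective : (i j : Fin n) {k l : Fin n} → transpose i j k ≡ transpose i j l → k ≡ l
transpose-injective i j {k} {l} eq =
  trans (sym (transpose-involutive i j k)) (trans (cong (transpose i j) eq) (transpose-involutive i j l))

allVecs : ∀ m n → List (Vec (Fin n) m)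
allVecs zero    n = [] ∷ []
allVecs (suc m) n = cartesianProductWith _∷_ (allFin n) (allVecs m n)

allVecs-complete : ∀ {m n} (v : Vec (Fin n) m) → v ∈ allVecs m n
allVecs-complete []      = here refl
allVecs-complete (x ∷ v) = ∈-cartesianProductWith⁺ _∷_ (∈-allFin x) (allVecs-complete v)

allVecs-unique : ∀ m n → Unique (allVecs m n)
allVecs-unique zero    n = [] ∷ []
allVecs-unique (suc m) n = Unique.cartesianProductWith⁺ _∷_ Vec.∷-injective (allFin⁺ n) (allVecs-unique m n)

IsInjection : Vec (Fin n) n → Set
IsInjection π = ∀ i j → lookup π i ≡ lookup π j → i ≡ j

isInjection? : Decidable (IsInjection {n})
isInjection? π = all? λ i → all? λ j → (lookup π i ≟ lookup π j) →-dec (i ≟ j)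

perms : ∀ n → List (Vec (Fin n) n)
perms n = filter isInjection? (allVecs n n)

perms-unique : ∀ n → Unique (perms n)
perms-unique n = filter⁺ isInjection? (allVecs-unique n n)

∈-perms⁺ : {π : Vec (Fin n) n} → IsInjection π → π ∈ perms n
∈-perms⁺ inj = ∈-filter⁺ isInjection? (allVecs-complete _) inj

∈-perms⁻ : {π : Vec (Fin n) n} → π ∈ perms n → IsInjection π
∈-perms⁻ {n} π∈ = proj₂ (∈-filter⁻ isInjection? {xs = allVecs n n} π∈)

infixl 7 _◂_
_◂_ : Vec (Fin n) n → (Fin n → Fin n) → Vec (Fin n) n
π ◂ σ = tabulate (lookup π ∘ σ)

lookup-◂ : (π : Vec (Fin n) n) (σ : Fin n → Fin n) (i : Fin n) → lookup (π ◂ σ) i ≡ lookup π (σ i)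
lookup-◂ π σ = lookup∘tabulate (lookup π ∘ σ)

◂-involutive : (π : Vec (Fin n) n) (σ : Fin n → Fin n) → (∀ i → σ (σ i) ≡ i) → π ◂ σ ◂ σ ≡ π
◂-involutive π σ σσ = trans (tabulate-cong (λ i → trans (lookup-◂ π σ (σ i)) (cong (lookup π) (σσ i)))) (tabulate∘lookup π)

◂-∈-perms : {π : Vec (Fin n) n} {σ : Fin n → Fin n} → (∀ {i j} → σ i ≡ σ j → i ≡ j) → π ∈ perms n → π ◂ σ ∈ perms n
◂-∈-perms {π = π} {σ} inj π∈ = ∈-perms⁺ λ i j eq →
  inj (∈-perms⁻ π∈ _ _ (trans (sym (lookup-◂ π σ i)) (trans eq (lookup-◂ π σ j))))

∑ᵖ : (Vec (Fin n) n → ℕ) → ℕ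
∑ᵖ {n} = ∑ (perms n)

∑ᵖ-transpose : (i j : Fin n) (F : Vec (Fin n) n → ℕ) → ∑ᵖ (λ π → F (π ◂ transpose i j)) ≡ ∑ᵖ F
∑ᵖ-transpose {n} i j F = ∑-involution (_◂ transpose i j) (λ π → ◂-involutive π _ (transpose-involutive i j))
  (perms-unique n) (◂-∈-perms (transpose-injective i j)) F

-- These two properties are all that averaging uses, and both survive composition with a
-- transposition, so invariance need not be proved for a general permutation.
record Symmetry (σ : Fin n → Fin n) : Set where
  field
    injective : ∀ {i j} → σ i ≡ σ j → i ≡ j
    invariant : (F : Vec (Fin n) n → ℕ) → ∑ᵖ (λ π → F (π ◂ σ)) ≡ ∑ᵖ F

Symmetry-id : Symmetry {n} id
Symmetry-id = record { injective = id ; invariant = λ F → ∑-cong (perms _) (λ π → cong F (tabulate∘lookup π)) }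

Symmetry-transpose : {σ : Fin n → Fin n} (i j : Fin n) → Symmetry σ → Symmetry (transpose i j ∘ σ)
Symmetry-transpose {n} {σ} i j S = record
  { injective = injective ∘ transpose-injective i j
  ; invariant = λ F → trans
      (∑-cong (perms n) (λ π → cong F (tabulate-cong (λ k → sym (lookup-◂ π (transpose i j) (σ k))))))
      (trans (∑ᵖ-transpose i j (λ π → F (π ◂ σ))) (invariant F))
  }
  where open Symmetry S

map-transpose-∉ : {i j : Fin n} (xs : List (Fin n)) → i ∉ xs → j ∉ xs → map (transpose i j) xs ≡ xs
map-transpose-∉ []       _  _  = refl
map-transpose-∉ (x ∷ xs) i∉ j∉ = cong₂ _∷_
  (transpose-fix (λ { refl → i∉ (here refl) }) (λ { refl → j∉ (here refl) }))
  (map-transpose-∉ xs (i∉ ∘ there) (j∉ ∘ there))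

-- The points are matched one at a time. Once σ sends ps to qs, the transposition of σ p and q
-- corrects the head and fixes qs: σ p is not in qs by injectivity, q is not by uniqueness.
symmetry-between : (ps qs : List (Fin n)) → length ps ≡ length qs → Unique ps → Unique qs →
                   ∃[ σ ] Symmetry σ × map σ ps ≡ qs
symmetry-between []       []       _  _  _ = id , Symmetry-id , refl
symmetry-between (p ∷ ps) (q ∷ qs) eq (p∉ ∷ ups) (q∉ ∷ uqs)
  with symmetry-between ps qs (suc-injective eq) ups uqs
... | σ , S , refl = transpose (σ p) q ∘ σ , Symmetry-transpose (σ p) q S , cong₂ _∷_ (transpose-ˡ (σ p) q)
  (trans (map-∘ ps) (map-transpose-∉ (map σ ps) σp∉ (λ q∈ → All.lookup q∉ q∈ refl)))
  where
  σp∉ : σ p ∉ map σ ps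
  σp∉ m with y , y∈ , eq′ ← ∈-map⁻ σ m = All.lookup p∉ y∈ (Symmetry.injective S eq′)

∑ᵖ-pair : (G : Fin n → Fin n → ℕ) {a b a′ b′ : Fin n} → a ≢ b → a′ ≢ b′ →
          ∑ᵖ (λ π → G (lookup π a) (lookup π b)) ≡ ∑ᵖ (λ π → G (lookup π a′) (lookup π b′))
∑ᵖ-pair {n} G {a} {b} {a′} {b′} a≢b a′≢b′
  with symmetry-between (a ∷ b ∷ []) (a′ ∷ b′ ∷ []) refl ((a≢b ∷ []) ∷ [] ∷ []) ((a′≢b′ ∷ []) ∷ [] ∷ [])
... | σ , S , refl = trans (sym (Symmetry.invariant S _))
  (∑-cong (perms n) (λ π → cong₂ G (lookup-◂ π σ a) (lookup-◂ π σ b)))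

∑ᵖ-quadruple : (G : Fin n → Fin n → Fin n → Fin n → ℕ) {a b c d a′ b′ c′ d′ : Fin n} →
  Unique (a ∷ b ∷ c ∷ d ∷ []) → Unique (a′ ∷ b′ ∷ c′ ∷ d′ ∷ []) →
  ∑ᵖ (λ π → G (lookup π a) (lookup π b) (lookup π c) (lookup π d)) ≡
  ∑ᵖ (λ π → G (lookup π a′) (lookup π b′) (lookup π c′) (lookup π d′))
∑ᵖ-quadruple {n} G {a} {b} {c} {d} u u′
  with symmetry-between _ _ refl u u′
... | σ , S , refl = trans (sym (Symmetry.invariant S _))
  (∑-cong (perms n) (λ π → trans
    (cong₂ (λ x y → G x y _ _) (lookup-◂ π σ a) (lookup-◂ π σ b))
    (cong₂ (G _ _) (lookup-◂ π σ c) (lookup-◂ π σ d))))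

∑²-reindex : {π : Vec (Fin n) n} → π ∈ perms n → (G : Fin n → Fin n → ℕ) →
             ∑ᶠ (λ a → ∑ᶠ (λ b → G (lookup π a) (lookup π b))) ≡ ∑ᶠ (λ x → ∑ᶠ (G x))
∑²-reindex {n} {π} π∈ G = trans
  (∑-cong (allFin n) (λ a → ∑ᶠ-reindex (lookup π) inj (G (lookup π a))))
  (∑ᶠ-reindex (lookup π) inj (λ x → ∑ᶠ (G x)))
  where
  inj : ∀ {x y} → lookup π x ≡ lookup π y → x ≡ y
  inj = ∈-perms⁻ π∈ _ _

-- Double counting over permutations and ordered pairs of positions.
∑ᵖ-pair-average : (G : Fin n → Fin n → ℕ) → (∀ x → G x x ≡ 0) → {a b : Fin n} → a ≢ b →
  let Φ = ∑ᵖ (λ π → G (lookup π a) (lookup π b)) in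
  length (perms n) * ∑ᶠ (λ x → ∑ᶠ (G x)) + n * Φ ≡ n * (n * Φ)
∑ᵖ-pair-average {n} G G-diag {a} {b} a≢b = begin
  length (perms n) * ∑ᶠ (λ x → ∑ᶠ (G x)) + n * Φ
    ≡⟨ cong (_+ n * Φ) (∑-const (perms n) _) ⟨
  ∑ᵖ {n} (λ _ → ∑ᶠ (λ x → ∑ᶠ (G x))) + n * Φ
    ≡⟨ cong (_+ n * Φ) (∑-cong-∈ (perms n) (λ π∈ → sym (∑²-reindex π∈ G))) ⟩
  ∑ᵖ (λ π → ∑ᶠ (λ a → ∑ᶠ (λ b → G (lookup π a) (lookup π b)))) + n * Φ
    ≡⟨ cong (_+ n * Φ) (trans (∑-swap (perms n) (allFin n) _) (∑-cong (allFin n) (λ a → ∑-swap (perms n) (allFin n) _))) ⟩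
  ∑ᶠ (λ a → ∑ᶠ (φ a)) + n * Φ
    ≡⟨ cong (∑ᶠ (λ a → ∑ᶠ (φ a)) +_) (∑ᶠ-const {n} Φ) ⟨
  ∑ᶠ (λ a → ∑ᶠ (φ a)) + ∑ᶠ {n} (λ _ → Φ)
    ≡⟨ ∑-+ (allFin n) _ _ ⟨
  ∑ᶠ (λ a → ∑ᶠ (φ a) + Φ)
    ≡⟨ ∑-cong (allFin n) row ⟩
  ∑ᶠ {n} (λ _ → n * Φ)
    ≡⟨ ∑ᶠ-const {n} (n * Φ) ⟩
  n * (n * Φ) ∎
  where
  open ≡-Reasoning
  φ : Fin n → Fin n → ℕ
  φ a b = ∑ᵖ (λ π → G (lookup π a) (lookup π b))
  Φ = φ a b
  term : ∀ c d → φ c d + 𝟙 (c ≟ d) * Φ ≡ Φ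
  term c d with c ≟ d
  ... | yes refl = trans (cong (_+ (Φ + 0)) (trans (∑-cong (perms n) (λ π → G-diag (lookup π c))) (∑-zero (perms n))))
                         (+-identityʳ Φ)
  ... | no c≢d = trans (+-identityʳ _) (∑ᵖ-pair G c≢d a≢b)
  row : ∀ c → ∑ᶠ (φ c) + Φ ≡ n * Φ
  row c = trans (cong (∑ᶠ (φ c) +_) (sym (∑ᶠ-𝟙 c (λ _ → Φ))))
    (trans (sym (∑-+ (allFin n) (φ c) _)) (trans (∑-cong (allFin n) (term c)) (∑ᶠ-const {n} Φ)))

∑⁴ : (Fin n → Fin n → Fin n → Fin n → ℕ) → ℕ
∑⁴ G = ∑ᶠ λ a → ∑ᶠ λ b → ∑ᶠ λ c → ∑ᶠ λ d → G a b c d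

-- Every quadruple of distinct positions contributes the same `Ψ` and the degenerate ones contribute
-- 0. Bounding the number of quadruples by n⁴ is affordable, since this average only enters the
-- gain.
∑ᵖ-quadruple-average : (G : Fin n → Fin n → Fin n → Fin n → ℕ) →
  (∀ a b c d → ¬ Unique (a ∷ b ∷ c ∷ d ∷ []) → G a b c d ≡ 0) →
  {a b c d : Fin n} → Unique (a ∷ b ∷ c ∷ d ∷ []) →
  let Ψ = ∑ᵖ (λ π → G (lookup π a) (lookup π b) (lookup π c) (lookup π d)) in
  length (perms n) * ∑⁴ G ≤ n * (n * (n * (n * Ψ)))
∑ᵖ-quadruple-average {n} G G-zero {a} {b} {c} {d} u = begin
  length (perms n) * ∑⁴ G
    ≡⟨ ∑-const (perms n) _ ⟨
  ∑ᵖ {n} (λ _ → ∑⁴ G)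
    ≡⟨ ∑-cong-∈ (perms n) (λ {π} π∈ → sym (trans
         (∑-cong (allFin n) (λ a → ∑-cong (allFin n) (λ b → ∑²-reindex π∈ (G (lookup π a) (lookup π b)))))
         (∑²-reindex π∈ (λ x y → ∑ᶠ λ c → ∑ᶠ λ d → G x y c d)))) ⟩
  ∑ᵖ (λ π → ∑⁴ λ a b c d → G (lookup π a) (lookup π b) (lookup π c) (lookup π d))
    ≡⟨ trans (∑-swap (perms n) (allFin n) _) (∑-cong (allFin n) λ a →
       trans (∑-swap (perms n) (allFin n) _) (∑-cong (allFin n) λ b →
       trans (∑-swap (perms n) (allFin n) _) (∑-cong (allFin n) λ c →
       ∑-swap (perms n) (allFin n) _))) ⟩
  ∑⁴ ψ
    ≤⟨ ∑-mono (allFin n) (λ a → ∑-mono (allFin n) (λ b → ∑-mono (allFin n) (λ c → ∑-mono (allFin n) (term a b c)))) ⟩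
  ∑⁴ {n} (λ _ _ _ _ → Ψ)
    ≡⟨ trans (∑-cong (allFin n) (λ a → trans (∑-cong (allFin n) (λ b → trans (∑-cong (allFin n) (λ c →
         ∑ᶠ-const {n} Ψ)) (∑ᶠ-const {n} _))) (∑ᶠ-const {n} _))) (∑ᶠ-const {n} _) ⟩
  n * (n * (n * (n * Ψ))) ∎
  where
  open ≤-Reasoning
  open import Data.List.Relation.Unary.Unique.DecPropositional (_≟_ {n}) using (unique?)
  ψ : Fin n → Fin n → Fin n → Fin n → ℕ
  ψ a b c d = ∑ᵖ (λ π → G (lookup π a) (lookup π b) (lookup π c) (lookup π d))
  Ψ = ψ a b c d
  term : ∀ a′ b′ c′ d′ → ψ a′ b′ c′ d′ ≤ Ψ
  term a′ b′ c′ d′ with unique? (a′ ∷ b′ ∷ c′ ∷ d′ ∷ [])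
  ... | yes u′ = ≤-reflexive (∑ᵖ-quadruple G u′ u)
  ... | no ¬u′ = subst (_≤ Ψ) (sym (trans (∑-cong (perms n) (λ π → G-zero _ _ _ _ (¬u′ ∘ Unique.map⁻ {f = lookup π})))
                                          (∑-zero (perms n)))) z≤n

-- Switching gadgets

-- Equal integer differences have equal positive parts.
m+n≡o+p⇒m∸o≡p∸n : ∀ m n o p → m + n ≡ o + p → m ∸ o ≡ p ∸ n
m+n≡o+p⇒m∸o≡p∸n m n o p eq = begin
  m ∸ o             ≡⟨ [m+n]∸[m+o]≡n∸o n m o ⟨
  (n + m) ∸ (n + o) ≡⟨ cong₂ _∸_ (trans (+-comm n m) eq) (+-comm n o) ⟩
  (o + p) ∸ (o + n) ≡⟨ [m+n]∸[m+o]≡n∸o o p n ⟩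
  p ∸ n             ∎
  where open ≡-Reasoning

∣m-n∣≤m∸n+n∸m : ∀ m n → ∣ m - n ∣ ≤ (m ∸ n) + (n ∸ m)
∣m-n∣≤m∸n+n∸m m n with ∣m-n∣≡[m∸n]∨[n∸m] m n
... | inj₁ eq = ≤-trans (≤-reflexive eq) (m≤m+n _ _)
... | inj₂ eq = ≤-trans (≤-reflexive eq) (m≤n+m _ _)

∣m+n-o+p∣≤∣m-o∣+∣n-p∣ : ∀ m n o p → ∣ m + n - o + p ∣ ≤ ∣ m - o ∣ + ∣ n - p ∣
∣m+n-o+p∣≤∣m-o∣+∣n-p∣ m n o p = begin
  ∣ m + n - o + p ∣                       ≤⟨ ∣-∣-triangle (m + n) (o + n) (o + p) ⟩
  ∣ m + n - o + n ∣ + ∣ o + n - o + p ∣   ≡⟨ cong₂ _+_ (trans (cong₂ ∣_-_∣ (+-comm m n) (+-comm o n)) (∣m+n-m+o∣≡∣n-o∣ n m o)) (∣m+n-m+o∣≡∣n-o∣ o n p) ⟩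
  ∣ m - o ∣ + ∣ n - p ∣                   ∎
  where open ≤-Reasoning

∑-pigeonhole-∈ : {A : Set} {xs : List A} {x : A} → x ∈ xs → (f : A → ℕ) → ∃[ y ] y ∈ xs × ∑ xs f ≤ length xs * f y
∑-pigeonhole-∈ {xs = x ∷ xs} _ f = ∑-pigeonhole x xs f

identity-∈-perms : ∀ n → tabulate id ∈ perms n
identity-∈-perms n = ∈-perms⁺ λ i j eq → trans (sym (lookup∘tabulate id i)) (trans eq (lookup∘tabulate id j))

-- The average over pairs refers to a fixed pair of distinct positions, which exists only for n ≥ 2;
-- for smaller n there is nothing to average.
vanishes-or-pair : ∀ {n} (f : Fin n → Fin n → ℕ) → (∀ x → f x x ≡ 0) →
                   ∑ᶠ (λ x → ∑ᶠ (f x)) ≡ 0 ⊎ ∃₂ λ (a b : Fin n) → a ≢ b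
vanishes-or-pair {zero}        f f-diag = inj₁ refl
vanishes-or-pair {suc zero}    f f-diag = inj₁ (cong (λ k → k + 0 + 0) (f-diag zero))
vanishes-or-pair {suc (suc _)} f f-diag = inj₂ (zero , suc zero , λ ())

-- For symmetric f this is the absolute alternating sum around the 4-cycle a b c d.
discrepancy : ∀ {n} → (Fin n → Fin n → ℕ) → Fin n → Fin n → Fin n → Fin n → ℕ
discrepancy f a b c d = ∣ f a d + f c b - f a b + f c d ∣

abstract
  distinct? : ∀ {n} (a b c d : Fin n) → Dec (Unique (a ∷ b ∷ c ∷ d ∷ []))
  distinct? {n} a b c d = unique? (a ∷ b ∷ c ∷ d ∷ [])
    where open import Data.List.Relation.Unary.Unique.DecPropositional (_≟_ {n}) using (unique?)

-- Cut off at degenerate quadruples, as `∑ᵖ-quadruple-average` requires.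
discrepancy⁺ : ∀ {n} → (Fin n → Fin n → ℕ) → Fin n → Fin n → Fin n → Fin n → ℕ
discrepancy⁺ f a b c d = 𝟙 (distinct? a b c d) * discrepancy f a b c d

size : ∀ {n} → (Fin n → Fin n → ℕ) → ℕ
size f = ∑ᶠ λ x → ∑ᶠ (f x)

variation : ∀ {n} → (Fin n → Fin n → ℕ) → ℕ
variation f = ∑⁴ (discrepancy⁺ f)

module Gadgets {n : ℕ} (T : Graph n) where

  open Graph T

  -- Of the four pairs between {u, w} and {x, x′} exactly two are edges; the swaps of x with x′ and
  -- of u with w interact only there. The non-edge `x≁x′` keeps u off x′ and w off x.
  record Gadget : Set where
    field
      x x′ u w : Fin n
      u~x   : u ~ x
      w~x′  : w ~ x′
      u≁x′  : ¬ u ~ x′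
      w≁x   : ¬ w ~ x
      x≁x′  : ¬ x ~ x′

    u≢x : u ≢ x
    u≢x eq = ~-irrefl eq u~x
    u≢x′ : u ≢ x′
    u≢x′ eq = x≁x′ (~-sym (subst (_~ x) eq u~x))
    w≢x : w ≢ x
    w≢x eq = x≁x′ (subst (_~ x′) eq w~x′)
    w≢x′ : w ≢ x′
    w≢x′ eq = ~-irrefl eq w~x′
    u≢w : u ≢ w
    u≢w eq = u≁x′ (subst (_~ x′) (sym eq) w~x′)
    x≢x′ : x ≢ x′
    x≢x′ eq = u≁x′ (subst (u ~_) eq u~x)

    distinct : Unique (u ∷ x ∷ w ∷ x′ ∷ [])
    distinct = (u≢x ∷ u≢w ∷ u≢x′ ∷ []) ∷ ((≢-sym w≢x) ∷ x≢x′ ∷ []) ∷ (w≢x′ ∷ []) ∷ [] ∷ []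

    τ σ : Fin n → Fin n
    τ = transpose x x′
    σ = transpose u w

  Far : Fin n → Fin n → Set
  Far p q = p ≢ q × ¬ p ~ q

  Separated : Gadget → Gadget → Set
  Separated g h = Far g.x h.x × Far g.x h.x′ × Far g.x′ h.x × Far g.x′ h.x′
    where
    module g = Gadget g
    module h = Gadget h

module Switching {n : ℕ} (T : Graph n)
  (f : Fin n → Fin n → ℕ) (f-sym : ∀ x y → f x y ≡ f y x) (f-diag : ∀ x → f x x ≡ 0) where

  open Graph T
  open Gadgets T

  t : Fin n → Fin n → ℕ
  t a b = 𝟙 (a ~? b)

  t-sym : ∀ a b → t a b ≡ t b a
  t-sym a b with a ~? b
  ... | yes ab = sym (𝟙-yes (b ~? a) (~-sym ab))
  ... | no ¬ab = sym (𝟙-no (b ~? a) (¬ab ∘ ~-sym))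

  -- Twice the number of tree edges that p maps into f, each edge being met in both orders.
  W : (Fin n → Fin n) → ℕ
  W p = ∑ᶠ λ a → ∑ᶠ λ b → t a b * f (p a) (p b)

  W-cong : ∀ {p q} → (∀ a → p a ≡ q a) → W p ≡ W q
  W-cong eq = ∑-cong (allFin n) λ a → ∑-cong (allFin n) λ b → cong (t a b *_) (cong₂ f (eq a) (eq b))

  W-cong₂ : ∀ p q p′ q′ → (∀ {a b} → a ~ b → f (p a) (p b) + f (q a) (q b) ≡ f (p′ a) (p′ b) + f (q′ a) (q′ b)) →
            W p + W q ≡ W p′ + W q′
  W-cong₂ p q p′ q′ eq = begin
    W p + W q
      ≡⟨ join p q ⟩
    ∑ᶠ (λ a → ∑ᶠ λ b → t a b * (f (p a) (p b) + f (q a) (q b)))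
      ≡⟨ ∑-cong (allFin n) (λ a → ∑-cong (allFin n) λ b → term a b) ⟩
    ∑ᶠ (λ a → ∑ᶠ λ b → t a b * (f (p′ a) (p′ b) + f (q′ a) (q′ b)))
      ≡⟨ join p′ q′ ⟨
    W p′ + W q′ ∎
    where
    open ≡-Reasoning
    join : ∀ p q → W p + W q ≡ ∑ᶠ (λ a → ∑ᶠ λ b → t a b * (f (p a) (p b) + f (q a) (q b)))
    join p q = trans (sym (∑-+ (allFin n) _ _)) (∑-cong (allFin n) λ a →
      trans (sym (∑-+ (allFin n) _ _)) (∑-cong (allFin n) λ b → sym (*-distribˡ-+ (t a b) _ _)))
    term : ∀ a b → t a b * (f (p a) (p b) + f (q a) (q b)) ≡ t a b * (f (p′ a) (p′ b) + f (q′ a) (q′ b))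
    term a b with a ~? b
    ... | yes ab = cong (1 *_) (eq ab)
    ... | no _   = refl

  module _ (g h : Gadget) (sep : Separated g h) where
    private
      module g = Gadget g
      module h = Gadget h

    -- No edge meets both {g.x, g.x′} and {h.x, h.x′}, so each edge is affected by at most one of
    -- the two swaps and their effects add up.
    Separated-W : ∀ p → W (p ∘ g.τ ∘ h.τ) + W p ≡ W (p ∘ g.τ) + W (p ∘ h.τ)
    Separated-W p = W-cong₂ (p ∘ g.τ ∘ h.τ) p (p ∘ g.τ) (p ∘ h.τ) eq
      where
      eq : ∀ {a b} → a ~ b → f (p (g.τ (h.τ a))) (p (g.τ (h.τ b))) + f (p a) (p b) ≡
                              f (p (g.τ a)) (p (g.τ b)) + f (p (h.τ a)) (p (h.τ b))
      off : ∀ {a b} → g.τ (h.τ a) ≡ h.τ a → g.τ (h.τ b) ≡ h.τ b → g.τ a ≡ a → g.τ b ≡ b →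
            f (p (g.τ (h.τ a))) (p (g.τ (h.τ b))) + f (p a) (p b) ≡
            f (p (g.τ a)) (p (g.τ b)) + f (p (h.τ a)) (p (h.τ b))
      off {a} {b} e₁ e₂ e₃ e₄ rewrite e₁ | e₂ | e₃ | e₄ = +-comm (f (p (h.τ a)) (p (h.τ b))) _
      off-h : ∀ {a} → a ≢ g.x → a ≢ g.x′ → g.τ (h.τ a) ≡ h.τ a
      off-h {a} a≢x a≢x′ with transposeView h.x h.x′ a
      ... | left refl rewrite transpose-ˡ h.x h.x′ = transpose-fix (≢-sym (proj₁ (proj₁ (proj₂ sep)))) (≢-sym (proj₁ (proj₂ (proj₂ (proj₂ sep)))))
      ... | right refl rewrite transpose-ʳ h.x h.x′ = transpose-fix (≢-sym (proj₁ (proj₁ sep))) (≢-sym (proj₁ (proj₁ (proj₂ (proj₂ sep)))))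
      ... | fixed c d rewrite transpose-fix c d = transpose-fix a≢x a≢x′
      hfix : ∀ {a b} → a ~ b → h.τ a ≡ a → h.τ b ≡ b → f (p (g.τ (h.τ a))) (p (g.τ (h.τ b))) + f (p a) (p b) ≡
                              f (p (g.τ a)) (p (g.τ b)) + f (p (h.τ a)) (p (h.τ b))
      hfix _ e₁ e₂ rewrite e₁ | e₂ = refl
      x-nbr : ∀ {b} → g.x ~ b → h.τ b ≡ b
      x-nbr xb = transpose-fix (λ eq → proj₂ (proj₁ sep) (subst (g.x ~_) eq xb)) (λ eq → proj₂ (proj₁ (proj₂ sep)) (subst (g.x ~_) eq xb))
      x′-nbr : ∀ {b} → g.x′ ~ b → h.τ b ≡ b
      x′-nbr xb = transpose-fix (λ eq → proj₂ (proj₁ (proj₂ (proj₂ sep))) (subst (g.x′ ~_) eq xb)) (λ eq → proj₂ (proj₂ (proj₂ (proj₂ sep))) (subst (g.x′ ~_) eq xb))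
      x-fix : h.τ g.x ≡ g.x
      x-fix = transpose-fix (proj₁ (proj₁ sep)) (proj₁ (proj₁ (proj₂ sep)))
      x′-fix : h.τ g.x′ ≡ g.x′
      x′-fix = transpose-fix (proj₁ (proj₁ (proj₂ (proj₂ sep)))) (proj₁ (proj₂ (proj₂ (proj₂ sep))))
      eq {a} {b} a~b with transposeView g.x g.x′ a | transposeView g.x g.x′ b
      ... | left refl | _     = hfix a~b x-fix (x-nbr a~b)
      ... | right refl | _     = hfix a~b x′-fix (x′-nbr a~b)
      ... | fixed _ _ | left refl = hfix a~b (x-nbr (~-sym a~b)) x-fix
      ... | fixed _ _ | right refl = hfix a~b (x′-nbr (~-sym a~b)) x′-fix
      ... | fixed c d | fixed c′ d′ = off (off-h c d) (off-h c′ d′) (transpose-fix c d) (transpose-fix c′ d′)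

  weight : Vec (Fin n) n → ℕ
  weight π = W (lookup π)

  -- Truncation is intended: the gain is the positive part of the change, since an unfavourable swap
  -- may be declined.
  gain : Vec (Fin n) n → Gadget → ℕ
  gain π g = weight (π ◂ Gadget.τ g) ∸ weight π

  gain-Separated : ∀ π g h → Separated g h → gain (π ◂ Gadget.τ g) h ≡ gain π h
  gain-Separated π g h sep = m+n≡o+p⇒m∸o≡p∸n _ (weight π) _ _ (begin
    weight (π ◂ g.τ ◂ h.τ) + weight π
      ≡⟨ cong (_+ weight π) (W-cong (λ a → trans (lookup-◂ (π ◂ g.τ) h.τ a) (lookup-◂ π g.τ (h.τ a)))) ⟩
    W (lookup π ∘ g.τ ∘ h.τ) + weight π
      ≡⟨ Separated-W g h sep (lookup π) ⟩
    W (lookup π ∘ g.τ) + W (lookup π ∘ h.τ)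
      ≡⟨ cong₂ _+_ (W-cong (lookup-◂ π g.τ)) (W-cong (lookup-◂ π h.τ)) ⟨
    weight (π ◂ g.τ) + weight (π ◂ h.τ) ∎)
    where
    open ≡-Reasoning
    module g = Gadget g
    module h = Gadget h

  -- Swaps are performed exactly when they increase the weight; by separation a performed swap
  -- leaves the later gains unchanged.
  collect-gains : ∀ gs → AllPairs Separated gs → ∀ {π} → π ∈ perms n →
                  ∃[ π′ ] π′ ∈ perms n × weight π + ∑ gs (gain π) ≤ weight π′
  collect-gains []       _            {π} π∈ = π , π∈ , ≤-reflexive (+-identityʳ _)
  collect-gains (g ∷ gs) (sep ∷ seps) {π} π∈ with weight (π ◂ Gadget.τ g) ≤? weight π
  ... | yes le with π′ , π′∈ , le′ ← collect-gains gs seps π∈ =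
    π′ , π′∈ , ≤-trans (≤-reflexive (cong (λ k → weight π + (k + ∑ gs (gain π))) (m≤n⇒m∸n≡0 le))) le′
  ... | no ¬le with π′ , π′∈ , le′ ← collect-gains gs seps (◂-∈-perms (transpose-injective (Gadget.x g) (Gadget.x′ g)) π∈) =
    π′ , π′∈ , (begin
      weight π + (gain π g + ∑ gs (gain π))
        ≡⟨ +-assoc (weight π) _ _ ⟨
      weight π + gain π g + ∑ gs (gain π)
        ≡⟨ cong₂ _+_ (m+[n∸m]≡n (<⇒≤ (≰⇒> ¬le))) (∑-cong-∈ gs (λ {h} h∈ → sym (gain-Separated π g h (All.lookup sep h∈)))) ⟩
      weight (π ◂ Gadget.τ g) + ∑ gs (gain (π ◂ Gadget.τ g))
        ≤⟨ le′ ⟩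
      weight π′ ∎)
    where open ≤-Reasoning

  module _ (g : Gadget) where
    open Gadget g

    private
      -- Together with its transpose, the indicator of the ordered pairs at which the two swaps
      -- interact.
      J : Fin n → Fin n → ℕ
      J a b = 𝟙 (u ≟ a) * 𝟙 (x ≟ b) + 𝟙 (w ≟ a) * 𝟙 (x′ ≟ b)

      ∑J : ∀ k → ∑ᶠ (λ a → ∑ᶠ λ b → J a b * k) ≡ 2 * k
      ∑J k = trans (∑-cong (allFin n) row) (trans (∑-+ (allFin n) _ _)
        (cong₂ _+_ (∑ᶠ-𝟙 u (λ _ → k)) (trans (∑ᶠ-𝟙 w (λ _ → k)) (sym (+-identityʳ k)))))
        where
        row : ∀ a → ∑ᶠ (λ b → J a b * k) ≡ 𝟙 (u ≟ a) * k + 𝟙 (w ≟ a) * k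
        row a = trans (∑-cong (allFin n) (λ b → lem (𝟙 (u ≟ a)) (𝟙 (x ≟ b)) (𝟙 (w ≟ a)) (𝟙 (x′ ≟ b)) k))
          (trans (∑-+ (allFin n) _ _) (cong₂ _+_ (∑ᶠ-𝟙 x (λ _ → 𝟙 (u ≟ a) * k)) (∑ᶠ-𝟙 x′ (λ _ → 𝟙 (w ≟ a) * k))))
          where
          lem : ∀ i j l m k → (i * j + l * m) * k ≡ j * (i * k) + m * (l * k)
          lem = solve-∀

      module _ (p : Fin n → Fin n) where
        P Q : ℕ
        P = f (p u) (p x) + f (p w) (p x′)
        Q = f (p u) (p x′) + f (p w) (p x)

        -- The mixed second difference of the term at (a, b) under τ and σ: it is Q - P on the two
        -- gadget edges and 0 elsewhere. The terms with P and Q stand on opposite sides to avoid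
        -- subtraction.
        Id : Fin n → Fin n → Set
        Id a b =
          t a b * (f (p (τ a)) (p (τ b)) + f (p (σ a)) (p (σ b))) + (J a b + J b a) * P ≡
          t a b * (f (p a) (p b) + f (p (σ (τ a))) (p (σ (τ b)))) + (J a b + J b a) * Q

        Id-sym : ∀ {a b} → Id a b → Id b a
        Id-sym {a} {b} eq
          rewrite t-sym b a | f-sym (p (τ b)) (p (τ a)) | f-sym (p (σ b)) (p (σ a)) | f-sym (p b) (p a)
                | f-sym (p (σ (τ b))) (p (σ (τ a))) | +-comm (J b a) (J a b) = eq

        J-x : ∀ {a b} → b ≢ x → b ≢ x′ → J a b ≡ 0
        J-x {a} {b} b≢x b≢x′ rewrite 𝟙-no (x ≟ b) (≢-sym b≢x) | 𝟙-no (x′ ≟ b) (≢-sym b≢x′)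
          | *-zeroʳ (𝟙 (u ≟ a)) | *-zeroʳ (𝟙 (w ≟ a)) = refl

        J-u : ∀ {a b} → a ≢ u → a ≢ w → J a b ≡ 0
        J-u {a} {b} a≢u a≢w rewrite 𝟙-no (u ≟ a) (≢-sym a≢u) | 𝟙-no (w ≟ a) (≢-sym a≢w) = refl

        identity-x : ∀ {a b} → a ≢ x → a ≢ x′ → b ≢ x → b ≢ x′ → Id a b
        identity-x {a} {b} a≢x a≢x′ b≢x b≢x′
          rewrite J-x {a} b≢x b≢x′ | J-x {b} a≢x a≢x′ | transpose-fix a≢x a≢x′ | transpose-fix b≢x b≢x′ = refl

        σ-x : σ x ≡ x
        σ-x = transpose-fix (≢-sym u≢x) (≢-sym w≢x)
        σ-x′ : σ x′ ≡ x′
        σ-x′ = transpose-fix (≢-sym u≢x′) (≢-sym w≢x′)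
        τ-u : τ u ≡ u
        τ-u = transpose-fix u≢x u≢x′
        τ-w : τ w ≡ w
        τ-w = transpose-fix w≢x w≢x′

        σ∘τ : ∀ {a} → a ≢ u → a ≢ w → σ (τ a) ≡ τ a
        σ∘τ {a} a≢u a≢w with transposeView x x′ a
        ... | left refl rewrite transpose-ˡ x x′ = σ-x′
        ... | right refl rewrite transpose-ʳ x x′ = σ-x
        ... | fixed c d rewrite transpose-fix c d = transpose-fix a≢u a≢w

        identity-u : ∀ {a b} → a ≢ u → a ≢ w → b ≢ u → b ≢ w → Id a b
        identity-u {a} {b} a≢u a≢w b≢u b≢w
          rewrite J-u {a} {b} a≢u a≢w | J-u {b} {a} b≢u b≢w | σ∘τ a≢u a≢w | σ∘τ b≢u b≢w
                | transpose-fix a≢u a≢w | transpose-fix b≢u b≢w = cong (λ k → t a b * k + 0) (+-comm (f (p (τ a)) (p (τ b))) _)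

        Id-ux : Id u x
        Id-ux rewrite 𝟙-yes (u ~? x) u~x | τ-u | transpose-ˡ x x′ | σ-x′ | σ-x | transpose-ˡ u w
          | 𝟙-yes (u ≟ u) refl | 𝟙-yes (x ≟ x) refl | 𝟙-no (w ≟ u) (≢-sym u≢w) | 𝟙-no (u ≟ x) u≢x | 𝟙-no (w ≟ x) w≢x =
          lem (f (p u) (p x)) (f (p w) (p x′)) (f (p u) (p x′)) (f (p w) (p x))
          where
          lem : ∀ i j k l → 1 * (k + l) + 1 * (i + j) ≡ 1 * (i + j) + 1 * (k + l)
          lem = solve-∀

        Id-wx′ : Id w x′
        Id-wx′ rewrite 𝟙-yes (w ~? x′) w~x′ | τ-w | transpose-ʳ x x′ | σ-x′ | σ-x | transpose-ʳ u w
          | 𝟙-yes (w ≟ w) refl | 𝟙-yes (x′ ≟ x′) refl | 𝟙-no (u ≟ w) u≢w | 𝟙-no (u ≟ x′) u≢x′ | 𝟙-no (w ≟ x′) w≢x′ =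
          lem (f (p u) (p x)) (f (p w) (p x′)) (f (p u) (p x′)) (f (p w) (p x))
          where
          lem : ∀ i j k l → 1 * (l + k) + 1 * (i + j) ≡ 1 * (j + i) + 1 * (k + l)
          lem = solve-∀

        Id-ux′ : Id u x′
        Id-ux′ rewrite 𝟙-no (u ~? x′) u≁x′
          | 𝟙-yes (u ≟ u) refl | 𝟙-no (x ≟ x′) x≢x′ | 𝟙-no (w ≟ u) (≢-sym u≢w) | 𝟙-no (u ≟ x′) u≢x′ | 𝟙-no (w ≟ x′) w≢x′ = refl

        Id-wx : Id w x
        Id-wx rewrite 𝟙-no (w ~? x) w≁x
          | 𝟙-yes (w ≟ w) refl | 𝟙-no (x′ ≟ x) (≢-sym x≢x′) | 𝟙-no (u ≟ w) u≢w | 𝟙-no (u ≟ x) u≢x | 𝟙-no (w ≟ x) w≢x = refl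

        -- If neither end lies in {x, x′}, then τ has no effect; if neither lies in {u, w}, then σ
        -- has none. This leaves the four pairs between the two sets, because no vertex is in both.
        identity : ∀ a b → Id a b
        identity a b with transposeView x x′ a | transposeView u w b | transposeView u w a | transposeView x x′ b
        ... | left refl | left refl | _ | _ = Id-sym {u} {x} Id-ux
        ... | left refl | right refl | _ | _ = Id-sym {w} {x} Id-wx
        ... | right refl | left refl | _ | _ = Id-sym {u} {x′} Id-ux′
        ... | right refl | right refl | _ | _ = Id-sym {w} {x′} Id-wx′
        ... | _ | _ | left refl | left refl = Id-ux
        ... | _ | _ | left refl | right refl = Id-ux′
        ... | _ | _ | right refl | left refl = Id-wx
        ... | _ | _ | right refl | right refl = Id-wx′
        ... | fixed c d | _ | _ | fixed c′ d′ = identity-x {a} {b} c d c′ d′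
        ... | _ | fixed c d | fixed c′ d′ | _ = identity-u {a} {b} c′ d′ c d
        ... | left e | fixed _ _ | left e′ | _ = contradiction (trans (sym e′) e) u≢x
        ... | left e | fixed _ _ | right e′ | _ = contradiction (trans (sym e′) e) w≢x
        ... | right e | fixed _ _ | left e′ | _ = contradiction (trans (sym e′) e) u≢x′
        ... | right e | fixed _ _ | right e′ | _ = contradiction (trans (sym e′) e) w≢x′
        ... | fixed _ _ | left e′ | fixed _ _ | left e = contradiction (trans (sym e′) e) u≢x
        ... | fixed _ _ | left e′ | fixed _ _ | right e = contradiction (trans (sym e′) e) u≢x′
        ... | fixed _ _ | right e′ | fixed _ _ | left e = contradiction (trans (sym e′) e) w≢x
        ... | fixed _ _ | right e′ | fixed _ _ | right e = contradiction (trans (sym e′) e) w≢x′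

        -- The factor 4 is two gadget edges times two orders.
        identity-W : (W (p ∘ τ) + W (p ∘ σ)) + 4 * P ≡ (W p + W (p ∘ σ ∘ τ)) + 4 * Q
        identity-W = trans (split (p ∘ τ) (p ∘ σ) P) (trans (∑-cong (allFin n) λ a → ∑-cong (allFin n) λ b → identity a b)
          (sym (split p (p ∘ σ ∘ τ) Q)))
          where
          split : ∀ q q′ k → (W q + W q′) + 4 * k ≡
            ∑ᶠ λ a → ∑ᶠ λ b → t a b * (f (q a) (q b) + f (q′ a) (q′ b)) + (J a b + J b a) * k
          split q q′ k = sym (trans
            (∑-cong (allFin n) λ a → trans (∑-cong (allFin n) λ b → lem (t a b) (f (q a) (q b)) (f (q′ a) (q′ b)) (J a b) (J b a) k)
               (trans (∑-+ (allFin n) _ _) (cong₂ _+_ (∑-+ (allFin n) _ _) (∑-+ (allFin n) _ _))))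
            (trans (∑-+ (allFin n) _ _) (cong₂ _+_ (∑-+ (allFin n) _ _)
               (trans (∑-+ (allFin n) _ _) (trans (cong₂ _+_ (∑J k) (trans (∑-swap (allFin n) (allFin n) _) (∑J k))) (lem₂ k))))))
            where
            lem : ∀ t a b j j′ k → t * (a + b) + (j + j′) * k ≡ (t * a + t * b) + (j * k + j′ * k)
            lem = solve-∀
            lem₂ : ∀ k → 2 * k + 2 * k ≡ 4 * k
            lem₂ = solve-∀

    -- The four embeddings π, πτ, πσ, πστ have the same average gain; their
    -- gains telescope to the discrepancy of the 4-cycle π(u) π(x) π(w) π(x′).
    ∑-gain : ∑ᵖ (λ π → discrepancy f (lookup π u) (lookup π x) (lookup π w) (lookup π x′)) ≤ ∑ᵖ (λ π → gain π g)
    ∑-gain = *-cancelˡ-≤ 4 (begin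
      4 * ∑ᵖ (λ π → D π)
        ≡⟨ ∑-*ˡ (perms n) 4 _ ⟨
      ∑ᵖ (λ π → 4 * D π)
        ≤⟨ ∑-mono (perms n) orbit ⟩
      ∑ᵖ (λ π → (γ π + γ (π ◂ τ)) + (γ (π ◂ σ) + γ (π ◂ σ ◂ τ)))
        ≡⟨ trans (∑-+ (perms n) _ _) (cong₂ _+_ (∑-+ (perms n) _ _) (∑-+ (perms n) _ _)) ⟩
      (∑ᵖ γ + ∑ᵖ (λ π → γ (π ◂ τ))) + (∑ᵖ (λ π → γ (π ◂ σ)) + ∑ᵖ (λ π → γ (π ◂ σ ◂ τ)))
        ≡⟨ cong₂ _+_ (cong (∑ᵖ γ +_) (∑ᵖ-transpose x x′ γ)) (cong₂ _+_ (∑ᵖ-transpose u w γ)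
             (trans (∑ᵖ-transpose u w (λ π → γ (π ◂ τ))) (∑ᵖ-transpose x x′ γ))) ⟩
      (∑ᵖ γ + ∑ᵖ γ) + (∑ᵖ γ + ∑ᵖ γ)
        ≡⟨ lem (∑ᵖ γ) ⟩
      4 * ∑ᵖ γ ∎)
      where
      open ≤-Reasoning
      lem : ∀ k → (k + k) + (k + k) ≡ 4 * k
      lem = solve-∀
      γ : Vec (Fin n) n → ℕ
      γ π = gain π g
      D : Vec (Fin n) n → ℕ
      D π = discrepancy f (lookup π u) (lookup π x) (lookup π w) (lookup π x′)
      ττ : ∀ π → weight (π ◂ τ ◂ τ) ≡ weight π
      ττ π = cong weight (◂-involutive π τ (transpose-involutive x x′))
      orbit : ∀ π → 4 * D π ≤ (γ π + γ (π ◂ τ)) + (γ (π ◂ σ) + γ (π ◂ σ ◂ τ))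
      orbit π rewrite ττ π | ττ (π ◂ σ) = begin
        4 * ∣ Q p - P p ∣                           ≡⟨ *-distribˡ-∣-∣ 4 (Q p) (P p) ⟩
        ∣ 4 * Q p - 4 * P p ∣                       ≡⟨ difference ⟨
        ∣ (w₁ + w₂) - (w₀ + w₃) ∣                   ≤⟨ ∣m+n-o+p∣≤∣m-o∣+∣n-p∣ w₁ w₂ w₀ w₃ ⟩
        ∣ w₁ - w₀ ∣ + ∣ w₂ - w₃ ∣                   ≡⟨ cong (∣ w₁ - w₀ ∣ +_) (∣-∣-comm w₂ w₃) ⟩
        ∣ w₁ - w₀ ∣ + ∣ w₃ - w₂ ∣                   ≤⟨ +-mono-≤ (∣m-n∣≤m∸n+n∸m w₁ w₀) (∣m-n∣≤m∸n+n∸m w₃ w₂) ⟩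
        ((w₁ ∸ w₀) + (w₀ ∸ w₁)) + ((w₃ ∸ w₂) + (w₂ ∸ w₃)) ∎
        where
        p = lookup π
        w₀ = weight π
        w₁ = weight (π ◂ τ)
        w₂ = weight (π ◂ σ)
        w₃ = weight (π ◂ σ ◂ τ)
        id-w : (w₁ + w₂) + 4 * P p ≡ (w₀ + w₃) + 4 * Q p
        id-w = trans (cong (_+ 4 * P p) (cong₂ _+_ (W-cong (lookup-◂ π τ)) (W-cong (lookup-◂ π σ))))
          (trans (identity-W p) (cong (λ k → (w₀ + k) + 4 * Q p)
            (sym (W-cong (λ a → trans (lookup-◂ (π ◂ σ) τ a) (lookup-◂ π σ (τ a)))))))
        difference : ∣ (w₁ + w₂) - (w₀ + w₃) ∣ ≡ ∣ 4 * Q p - 4 * P p ∣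
        difference = trans (sym (∣m+n-m+o∣≡∣n-o∣ (4 * P p) (w₁ + w₂) (w₀ + w₃)))
          (trans (cong₂ ∣_-_∣ (trans (+-comm (4 * P p) (w₁ + w₂)) id-w) (+-comm (4 * P p) (w₀ + w₃)))
                 (∣m+n-m+o∣≡∣n-o∣ (w₀ + w₃) _ _))

  E N : ℕ
  E = ∑ᶠ λ a → ∑ᶠ (t a)
  N = length (perms n)

  ∑-gain-V : ∀ g → N * variation f ≤ n * (n * (n * (n * ∑ᵖ (λ π → gain π g))))
  ∑-gain-V g = ≤-trans
    (∑ᵖ-quadruple-average (discrepancy⁺ f) (λ a b c d ¬u → cong (_* discrepancy f a b c d) (𝟙-no (distinct? a b c d) ¬u)) (Gadget.distinct g))
    (*-monoʳ-≤ n (*-monoʳ-≤ n (*-monoʳ-≤ n (*-monoʳ-≤ n (≤-trans (∑-mono (perms n) bound₁) (∑-gain g))))))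
    where
    open Gadget g
    bound₁ : ∀ π → discrepancy⁺ f (lookup π u) (lookup π x) (lookup π w) (lookup π x′) ≤
                   discrepancy f (lookup π u) (lookup π x) (lookup π w) (lookup π x′)
    bound₁ π with does (distinct? (lookup π u) (lookup π x) (lookup π w) (lookup π x′))
    ... | true  = ≤-reflexive (+-identityʳ _)
    ... | false = z≤n

  module _ (2n≤E+2 : 2 * n ≤ E + 2) where

    -- Each of the E ordered edges contributes the same `Φ`, and 2n ≤ E + 2 says that there are at
    -- least n - 1 edges. With size f = p n (n - 1), the mean weight is thus at least 2 p (n - 1).
    ∑-weight : 2 * (N * size f) ≤ n * ∑ᵖ weight
    ∑-weight with vanishes-or-pair f f-diag
    ... | inj₁ size≡0 = ≤-trans (≤-reflexive (trans (cong (λ k → 2 * (N * k)) size≡0) (cong (2 *_) (*-zeroʳ N)))) z≤n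
    ... | inj₂ (a₀ , b₀ , a₀≢b₀) = +-cancelʳ-≤ (2 * (n * Φ)) _ _ (begin
      2 * (N * size f) + 2 * (n * Φ)   ≡⟨ *-distribˡ-+ 2 (N * size f) (n * Φ) ⟨
      2 * (N * size f + n * Φ)         ≡⟨ cong (2 *_) (∑ᵖ-pair-average f f-diag a₀≢b₀) ⟩
      2 * (n * (n * Φ))           ≡⟨ *-assoc 2 n (n * Φ) ⟨
      2 * n * (n * Φ)             ≤⟨ *-monoˡ-≤ (n * Φ) 2n≤E+2 ⟩
      (E + 2) * (n * Φ)           ≡⟨ lem E n Φ ⟩
      n * (E * Φ) + 2 * (n * Φ)   ≡⟨ cong (λ k → n * k + 2 * (n * Φ)) ∑weight≡ ⟨
      n * ∑ᵖ weight + 2 * (n * Φ) ∎)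
      where
      open ≤-Reasoning
      lem : ∀ e n φ → (e + 2) * (n * φ) ≡ n * (e * φ) + 2 * (n * φ)
      lem = solve-∀
      Φ : ℕ
      Φ = ∑ᵖ (λ π → f (lookup π a₀) (lookup π b₀))
      term : ∀ a b → ∑ᵖ (λ π → t a b * f (lookup π a) (lookup π b)) ≡ t a b * Φ
      term a b with a ~? b
      ... | yes ab = trans (∑-*ˡ (perms n) 1 _) (cong (1 *_) (∑ᵖ-pair f (λ eq → ~-irrefl eq ab) a₀≢b₀))
      ... | no _   = ∑-zero (perms n)
      ∑weight≡ : ∑ᵖ weight ≡ E * Φ
      ∑weight≡ = trans (∑-swap (perms n) (allFin n) _) (trans (∑-cong (allFin n) λ a → trans (∑-swap (perms n) (allFin n) _)
        (trans (∑-cong (allFin n) (term a)) (∑-*ʳ (allFin n) Φ (t a)))) (∑-*ʳ (allFin n) Φ (λ a → ∑ᶠ (t a))))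

    -- Some π reaches the average of weight plus gains, and `collect-gains` realises these gains
    -- together. Divided by n⁴, the bound is twice the mean edge count plus one mean discrepancy for
    -- each gadget.
    good-embedding : ∀ gs → AllPairs Separated gs →
      ∃[ π ] π ∈ perms n × 2 * (n * (n * (n * size f))) + length gs * variation f ≤ n * (n * (n * (n * weight π)))
    good-embedding gs sep
      with π , π∈ , le ← ∑-pigeonhole-∈ (identity-∈-perms n) (λ π → weight π + ∑ gs (gain π))
      with π′ , π′∈ , le′ ← collect-gains gs sep π∈ = π′ , π′∈ , *-cancelˡ-≤ N {{N≢0}} (begin
        N * (2 * (n * (n * (n * size f))) + length gs * variation f)
          ≡⟨ lem₁ N n (size f) (length gs) (variation f) ⟩
        n * (n * (n * (2 * (N * size f)))) + length gs * (N * variation f)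
          ≡⟨ cong (n * (n * (n * (2 * (N * size f)))) +_) (∑-const gs (N * variation f)) ⟨
        n * (n * (n * (2 * (N * size f)))) + ∑ gs (λ _ → N * variation f)
          ≤⟨ +-mono-≤ (*-monoʳ-≤ n (*-monoʳ-≤ n (*-monoʳ-≤ n ∑-weight))) (∑-mono gs ∑-gain-V) ⟩
        n * (n * (n * (n * ∑ᵖ weight))) + ∑ gs (λ g → n * (n * (n * (n * ∑ᵖ (λ π → gain π g)))))
          ≡⟨ cong (n * (n * (n * (n * ∑ᵖ weight))) +_) pull ⟩
        n * (n * (n * (n * ∑ᵖ weight))) + n * (n * (n * (n * ∑ᵖ (λ π → ∑ gs (gain π)))))
          ≡⟨ lem₂ n (∑ᵖ weight) _ ⟨
        n * (n * (n * (n * (∑ᵖ weight + ∑ᵖ (λ π → ∑ gs (gain π))))))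
          ≡⟨ cong (λ k → n * (n * (n * (n * k)))) (∑-+ (perms n) _ _) ⟨
        n * (n * (n * (n * ∑ᵖ (λ π → weight π + ∑ gs (gain π)))))
          ≤⟨ *-monoʳ-≤ n (*-monoʳ-≤ n (*-monoʳ-≤ n (*-monoʳ-≤ n (≤-trans le (*-monoʳ-≤ N le′))))) ⟩
        n * (n * (n * (n * (N * weight π′))))
          ≡⟨ lem₃ n N (weight π′) ⟩
        N * (n * (n * (n * (n * weight π′)))) ∎)
      where
      open ≤-Reasoning
      N≢0 : NonZero N
      N≢0 = >-nonZero (≤-trans (s≤s z≤n) (∈⇒0< (identity-∈-perms n)))
        where
        ∈⇒0< : {A : Set} {x : A} {xs : List A} → x ∈ xs → 0 < length xs
        ∈⇒0< {xs = _ ∷ _} _ = z<s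
      lem₁ : ∀ N n A s V → N * (2 * (n * (n * (n * A))) + s * V) ≡ n * (n * (n * (2 * (N * A)))) + s * (N * V)
      lem₁ = solve-∀
      lem₂ : ∀ n a b → n * (n * (n * (n * (a + b)))) ≡ n * (n * (n * (n * a))) + n * (n * (n * (n * b)))
      lem₂ = solve-∀
      lem₃ : ∀ n N a → n * (n * (n * (n * (N * a)))) ≡ N * (n * (n * (n * (n * a))))
      lem₃ = solve-∀
      pull : ∑ gs (λ g → n * (n * (n * (n * ∑ᵖ (λ π → gain π g))))) ≡ n * (n * (n * (n * ∑ᵖ (λ π → ∑ gs (gain π)))))
      pull = trans (∑-*ˡ gs n _) (cong (n *_) (trans (∑-*ˡ gs n _) (cong (n *_) (trans (∑-*ˡ gs n _) (cong (n *_)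
        (trans (∑-*ˡ gs n _) (cong (n *_) (∑-swap gs (perms n) (λ g π → gain π g)))))))))

-- Unbalanced 4-cycles

IsBit : ℕ → Set
IsBit k = k ≡ 0 ⊎ k ≡ 1

bit-*-≤ : ∀ {i j k} → IsBit i → (i ≡ 1 → j ≤ k) → i * j ≤ k
bit-*-≤         (inj₁ refl) _  = z≤n
bit-*-≤ {j = j} (inj₂ refl) le = ≤-trans (≤-reflexive (+-identityʳ j)) (le refl)

𝟙-bit : {P : Set} (P? : Dec P) → IsBit (𝟙 P?)
𝟙-bit (yes _) = inj₂ refl
𝟙-bit (no _)  = inj₁ refl

record IsAdjacency {n} (f : Fin n → Fin n → ℕ) : Set where
  field
    bit  : ∀ x y → IsBit (f x y)
    symm : ∀ x y → f x y ≡ f y x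
    diag : ∀ x → f x x ≡ 0

  ≡1⇒≢ : ∀ {x y} → f x y ≡ 1 → x ≢ y
  ≡1⇒≢ {x} fxy refl = contradiction (trans (sym (diag x)) fxy) λ ()

complement : ∀ {n} → (Fin n → Fin n → ℕ) → Fin n → Fin n → ℕ
complement f x y = 1 ∸ (f x y + 𝟙 (x ≟ y))

module Complement {n} {f : Fin n → Fin n → ℕ} (F : IsAdjacency f) where
  open IsAdjacency F

  private
    g = complement f

  f+g+𝟙 : ∀ x y → (f x y + g x y) + 𝟙 (x ≟ y) ≡ 1
  f+g+𝟙 x y with x ≟ y
  ... | yes refl rewrite diag x = refl
  ... | no _ with bit x y
  ...   | inj₁ eq rewrite eq = refl
  ...   | inj₂ eq rewrite eq = refl

  f+g : ∀ {x y} → x ≢ y → f x y + g x y ≡ 1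
  f+g {x} {y} x≢y = trans (sym (trans (cong (f x y + g x y +_) (𝟙-no (x ≟ y) x≢y)) (+-identityʳ _))) (f+g+𝟙 x y)

  isAdjacency : IsAdjacency g
  isAdjacency = record { bit = gbit ; symm = gsymm ; diag = gdiag }
    where
    gbit : ∀ x y → IsBit (g x y)
    gbit x y with x ≟ y
    ... | yes refl rewrite diag x = inj₁ refl
    ... | no _ with bit x y
    ...   | inj₁ eq rewrite eq = inj₂ refl
    ...   | inj₂ eq rewrite eq = inj₁ refl
    gdiag : ∀ x → g x x ≡ 0
    gdiag x rewrite diag x | 𝟙-yes (x ≟ x) refl = refl
    gsymm : ∀ x y → g x y ≡ g y x
    gsymm x y with x ≟ y | y ≟ x
    ... | yes _   | yes _   = cong (λ k → 1 ∸ (k + 1)) (symm x y)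
    ... | no _    | no _    = cong (λ k → 1 ∸ (k + 0)) (symm x y)
    ... | yes x≡y | no y≢x  = contradiction (sym x≡y) y≢x
    ... | no x≢y  | yes y≡x = contradiction (sym y≡x) x≢y

  g≡1⇒f≡0 : ∀ {x y} → g x y ≡ 1 → f x y ≡ 0
  g≡1⇒f≡0 {x} {y} gxy with bit x y
  ... | inj₁ eq = eq
  ... | inj₂ eq rewrite eq | 0∸n≡0 (𝟙 (x ≟ y)) = contradiction gxy λ ()

  f≡0⇒g≡1 : ∀ {x y} → x ≢ y → f x y ≡ 0 → g x y ≡ 1
  f≡0⇒g≡1 {x} {y} x≢y eq rewrite eq | 𝟙-no (x ≟ y) x≢y = refl

  f≡1⇒g≡0 : ∀ {x y} → f x y ≡ 1 → g x y ≡ 0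
  f≡1⇒g≡0 {x} {y} eq rewrite eq = 0∸n≡0 (𝟙 (x ≟ y))

  degrees : ∀ x → (∑ᶠ (f x) + ∑ᶠ (g x)) + 1 ≡ n
  degrees x = begin
    (∑ᶠ (f x) + ∑ᶠ (g x)) + 1
      ≡⟨ cong (∑ᶠ (f x) + ∑ᶠ (g x) +_) (∑ᶠ-𝟙-1 x) ⟨
    (∑ᶠ (f x) + ∑ᶠ (g x)) + ∑ᶠ (λ y → 𝟙 (x ≟ y))
      ≡⟨ trans (∑-+ (allFin n) _ _) (cong (_+ ∑ᶠ (λ y → 𝟙 (x ≟ y))) (∑-+ (allFin n) _ _)) ⟨
    ∑ᶠ (λ y → (f x y + g x y) + 𝟙 (x ≟ y))
      ≡⟨ ∑-cong (allFin n) (f+g+𝟙 x) ⟩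
    ∑ᶠ {n} (λ _ → 1)
      ≡⟨ ∑ᶠ-1 n ⟩
    n ∎
    where open ≡-Reasoning

  sizes : (size f + size g) + n ≡ n * n
  sizes = begin
    (size f + size g) + n
      ≡⟨ cong (size f + size g +_) (∑ᶠ-1 n) ⟨
    (size f + size g) + ∑ᶠ {n} (λ _ → 1)
      ≡⟨ trans (∑-+ (allFin n) _ _) (cong (_+ ∑ᶠ {n} (λ _ → 1)) (∑-+ (allFin n) _ _)) ⟨
    ∑ᶠ (λ x → (∑ᶠ (f x) + ∑ᶠ (g x)) + 1)
      ≡⟨ ∑-cong (allFin n) degrees ⟩
    ∑ᶠ {n} (λ _ → n)
      ≡⟨ ∑ᶠ-const {n} n ⟩
    n * n ∎
    where open ≡-Reasoning

-- Every 4-cycle is balanced.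
Additive : ∀ {n} → (Fin n → Fin n → ℕ) → Set
Additive f = ∀ {a b c d} → Unique (a ∷ b ∷ c ∷ d ∷ []) → f a d + f c b ≡ f a b + f c d

variation≡0⇒Additive : ∀ {n} (f : Fin n → Fin n → ℕ) → variation f ≡ 0 → Additive f
variation≡0⇒Additive {n} f V≡0 {a} {b} {c} {d} u = ∣m-n∣≡0⇒m≡n (trans
  (sym (trans (cong (_* discrepancy f a b c d) (𝟙-yes (distinct? a b c d) u)) (+-identityʳ _)))
  (∑≡0⇒ _ (∑≡0⇒ _ (∑≡0⇒ _ (∑≡0⇒ _ V≡0 (∈-allFin a)) (∈-allFin b)) (∈-allFin c)) (∈-allFin d)))

-- The edges a b and b d with a d missing determine f. Additivity at (a, b, c, d) reads f c b ≡ 1 +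
-- f c d, so each further c is joined to b and not to d; using additivity once more at (b, d, x, y)
-- excludes all edges off b. Hence f is the star at b.
module StarShape {n} {f : Fin n → Fin n → ℕ} (F : IsAdjacency f) (add : Additive f)
  {a b d : Fin n} (fab : f a b ≡ 1) (fad : f a d ≡ 0) (a≢d : a ≢ d) (fbd : f b d ≡ 1) where
  open IsAdjacency F

  private
    a≢b = ≡1⇒≢ fab
    b≢d = ≡1⇒≢ fbd

    to-b,d : ∀ c → c ≢ b → c ≢ d → f c b ≡ 1 × f c d ≡ 0
    to-b,d c c≢b c≢d with c ≟ a
    ... | yes refl = fab , fad
    ... | no c≢a with bit c d | bit c b | add {a} {b} {c} {d} ((a≢b ∷ ≢-sym c≢a ∷ a≢d ∷ []) ∷ (≢-sym c≢b ∷ b≢d ∷ []) ∷ (c≢d ∷ []) ∷ [] ∷ [])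
    ...   | inj₁ fcd | inj₂ fcb | _  = fcb , fcd
    ...   | inj₁ fcd | inj₁ fcb | eq rewrite fab | fad | fcb | fcd = contradiction eq λ ()
    ...   | inj₂ fcd | inj₁ fcb | eq rewrite fab | fad | fcb | fcd = contradiction eq λ ()
    ...   | inj₂ fcd | inj₂ fcb | eq rewrite fab | fad | fcb | fcd = contradiction eq λ ()

    to-b : ∀ c → c ≢ b → f c b ≡ 1
    to-b c c≢b with c ≟ d
    ... | yes refl = trans (symm d b) fbd
    ... | no c≢d   = proj₁ (to-b,d c c≢b c≢d)

    rest : ∀ x y → x ≢ b → y ≢ b → f x y ≡ 0
    rest x y x≢b y≢b with x ≟ y | x ≟ d | y ≟ d
    ... | yes refl | _        | _        = diag x
    ... | no x≢y   | yes refl | _        = trans (symm d y) (proj₂ (to-b,d y y≢b (≢-sym x≢y)))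
    ... | no x≢y   | no x≢d   | yes refl = proj₂ (to-b,d x x≢b x≢d)
    ... | no x≢y   | no x≢d   | no y≢d
      with eq ← add {b} {d} {x} {y} ((b≢d ∷ ≢-sym x≢b ∷ ≢-sym y≢b ∷ []) ∷ (≢-sym x≢d ∷ ≢-sym y≢d ∷ []) ∷ (x≢y ∷ []) ∷ [] ∷ [])
      rewrite trans (symm b y) (to-b y y≢b) | proj₂ (to-b,d x x≢b x≢d) | fbd = suc-injective (sym eq)

    -- The star at b as [x = b] + [y = b], corrected at the loop (b, b); summation gives 2n - 2.
    formula : ∀ x y → f x y + 2 * (𝟙 (b ≟ x) * 𝟙 (b ≟ y)) ≡ 𝟙 (b ≟ x) + 𝟙 (b ≟ y)
    formula x y with b ≟ x | b ≟ y
    ... | yes refl | yes refl = cong (_+ 2) (diag b)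
    ... | yes refl | no b≢y   = cong (_+ 0) (trans (symm b y) (to-b y (≢-sym b≢y)))
    ... | no b≢x   | yes refl = cong (_+ 0) (to-b x (≢-sym b≢x))
    ... | no b≢x   | no b≢y   = cong (_+ 0) (rest x y (≢-sym b≢x) (≢-sym b≢y))

    ∑𝟙 : ∑ᶠ (λ x → 𝟙 (b ≟ x)) ≡ 1
    ∑𝟙 = ∑ᶠ-𝟙-1 b

  size-star : size f + 2 ≡ n + n
  size-star = begin
    size f + 2
      ≡⟨ cong (size f +_) (trans (∑-*ˡ (allFin n) 2 _) (cong (2 *_) (trans (∑-cong (allFin n) λ x → trans (∑-*ˡ (allFin n) (𝟙 (b ≟ x)) _)
           (trans (cong (𝟙 (b ≟ x) *_) ∑𝟙) (*-identityʳ _))) ∑𝟙))) ⟨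
    size f + ∑ᶠ (λ x → 2 * ∑ᶠ (λ y → 𝟙 (b ≟ x) * 𝟙 (b ≟ y)))
      ≡⟨ ∑-+ (allFin n) _ _ ⟨
    ∑ᶠ (λ x → ∑ᶠ (f x) + 2 * ∑ᶠ (λ y → 𝟙 (b ≟ x) * 𝟙 (b ≟ y)))
      ≡⟨ ∑-cong (allFin n) (λ x → trans (cong (∑ᶠ (f x) +_) (sym (∑-*ˡ (allFin n) 2 _))) (trans (sym (∑-+ (allFin n) _ _))
           (trans (∑-cong (allFin n) (formula x)) (trans (∑-+ (allFin n) _ _)
             (cong₂ _+_ (∑ᶠ-const {n} (𝟙 (b ≟ x))) ∑𝟙))))) ⟩
    ∑ᶠ (λ x → n * 𝟙 (b ≟ x) + 1)
      ≡⟨ ∑-+ (allFin n) _ _ ⟩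
    ∑ᶠ (λ x → n * 𝟙 (b ≟ x)) + ∑ᶠ {n} (λ _ → 1)
      ≡⟨ cong₂ _+_ (trans (∑-*ˡ (allFin n) n _) (trans (cong (n *_) ∑𝟙) (*-identityʳ n))) (∑ᶠ-1 n) ⟩
    n + n ∎
    where open ≡-Reasoning

-- If all 4-cycles were balanced, an edge and a non-edge at a common vertex would make f or its
-- complement a star, with 2n - 2 ordered edges. As n divides both sizes, it would divide 2.
variation≢0 : ∀ {n} {f : Fin n → Fin n → ℕ} → IsAdjacency f → 3 ≤ n → n ∣ size f →
              0 < size f → 0 < size (complement f) → variation f ≢ 0
variation≢0 {n} {f} F 3≤n n∣f f>0 g>0 V≡0 = mixed
  where
  open IsAdjacency F
  open Complement F
  g = complement f
  module G = IsAdjacency isAdjacency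
  f-add : Additive f
  f-add = variation≡0⇒Additive f V≡0
  g-add : Additive g
  g-add {a} {b} {c} {d} u@((a≢b ∷ a≢c ∷ a≢d ∷ []) ∷ (b≢c ∷ b≢d ∷ []) ∷ (c≢d ∷ []) ∷ [] ∷ []) =
    +-cancelˡ-≡ (f a d + f c b) _ _ (begin
      (f a d + f c b) + (g a d + g c b)  ≡⟨ lem (f a d) (f c b) _ _ ⟩
      (f a d + g a d) + (f c b + g c b)  ≡⟨ cong₂ _+_ (f+g a≢d) (f+g (≢-sym b≢c)) ⟩
      2                                  ≡⟨ cong₂ _+_ (f+g a≢b) (f+g c≢d) ⟨
      (f a b + g a b) + (f c d + g c d)  ≡⟨ lem (f a b) (g a b) _ _ ⟩
      (f a b + f c d) + (g a b + g c d)  ≡⟨ cong (_+ (g a b + g c d)) (f-add u) ⟨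
      (f a d + f c b) + (g a b + g c d)  ∎)
    where
    open ≡-Reasoning
    lem : ∀ i j k l → (i + j) + (k + l) ≡ (i + k) + (j + l)
    lem = solve-∀
  n∤2 : ¬ n ∣ 2
  n∤2 n∣2 = <⇒≱ 3≤n (∣⇒≤ n∣2)
  n∣n+n : n ∣ n + n
  n∣n+n = divides 2 (cong (n +_) (sym (+-identityʳ n)))
  n∣g : n ∣ size g
  n∣g = ∣m+n∣m⇒∣n (subst (n ∣_) (trans (sym sizes) (lem (size f) (size g) n)) (m∣m*n n))
    (∣m+n∣m⇒∣n-sym n∣f)
    where
    lem : ∀ a b c → (a + b) + c ≡ (a + c) + b
    lem = solve-∀
    open import Data.Nat.Divisibility using (∣m∣n⇒∣m+n; ∣-refl)
    ∣m+n∣m⇒∣n-sym : n ∣ size f → n ∣ size f + n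
    ∣m+n∣m⇒∣n-sym n∣f = ∣m∣n⇒∣m+n n∣f ∣-refl
  -- The third side decides: with b d present f is the star at b, with b d missing the complement is
  -- the star at d.
  corner : ∀ {a b d} → f a b ≡ 1 → g a d ≡ 1 → ⊥
  corner {a} {b} {d} fab gad with bit b d
  ... | inj₂ fbd = n∤2 (∣m+n∣m⇒∣n (subst (n ∣_) (sym (StarShape.size-star F f-add fab (g≡1⇒f≡0 gad) (G.≡1⇒≢ gad) fbd)) n∣n+n) n∣f)
  ... | inj₁ fbd = n∤2 (∣m+n∣m⇒∣n (subst (n ∣_) (sym (StarShape.size-star isAdjacency g-add gad (f≡1⇒g≡0 fab) (≡1⇒≢ fab)
                     (f≡0⇒g≡1 (λ d≡b → contradiction (trans (sym fab) (trans (cong (f a) (sym d≡b)) (g≡1⇒f≡0 gad))) λ ()) (trans (symm d b) fbd)))) n∣n+n) n∣g)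
  pos : ∀ {h : Fin n → Fin n → ℕ} → IsAdjacency h → 0 < size h → ∃₂ λ x y → h x y ≡ 1
  pos H h>0 with x , hx>0 ← ∑>0⇒∃ (allFin n) _ h>0 with y , hxy>0 ← ∑>0⇒∃ (allFin n) _ hx>0
    with IsAdjacency.bit H x y
  ... | inj₁ eq = contradiction (subst (0 <_) eq hxy>0) λ ()
  ... | inj₂ eq = x , y , eq
  -- An edge a b and a non-edge c d give an edge and a non-edge at a common vertex, at a or at c
  -- depending on a c.
  mixed : ⊥
  mixed with a , b , fab ← pos F f>0 | c , d , gcd ← pos isAdjacency g>0 with a ≟ c
  ... | yes refl = corner fab gcd
  ... | no a≢c with bit a c
  ...   | inj₁ fac = corner fab (f≡0⇒g≡1 a≢c fac)
  ...   | inj₂ fac = corner (trans (symm c a) fac) gcd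

-- Since A ≥ n (n - 1)/r ≥ n²/(2r), V has order n⁴/r, with constant 2 · 2 · 400. The second factor r
-- is added to agree with `hub-estimate`.
sparse-estimate : ∀ n r A A′ V → n * n ≤ r * A + n → A ≤ 2 * A′ → n * n * A′ ≤ 400 * V → 2 ≤ n → 1 ≤ r →
                  n * (n * (n * n)) ≤ 1600 * (r * (r * V))
sparse-estimate n r A A′ V nn≤ A≤ A′≤ 2≤n 1≤r = ≤-trans
  (+-cancelʳ-≤ (n * (n * (n * n))) _ _ (begin
    n * (n * (n * n)) + n * (n * (n * n))                 ≡⟨ lem₁ n ⟩
    2 * (n * n * (n * n))                                 ≤⟨ *-monoʳ-≤ 2 (*-monoʳ-≤ (n * n) nn≤) ⟩
    2 * (n * n * (r * A + n))                             ≤⟨ *-monoʳ-≤ 2 (*-monoʳ-≤ (n * n) (+-monoˡ-≤ n (*-monoʳ-≤ r A≤))) ⟩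
    2 * (n * n * (r * (2 * A′) + n))                      ≡⟨ lem₂ n r A′ ⟩
    4 * (r * (n * n * A′)) + 2 * (n * (n * n))            ≤⟨ +-mono-≤ (*-monoʳ-≤ 4 (*-monoʳ-≤ r A′≤)) (*-monoˡ-≤ (n * (n * n)) 2≤n) ⟩
    4 * (r * (400 * V)) + n * (n * (n * n))               ≡⟨ cong (_+ n * (n * (n * n))) (lem₃ r V) ⟩
    1600 * (r * V) + n * (n * (n * n))                    ∎))
  (*-monoʳ-≤ 1600 (≤-trans (≤-reflexive (sym (*-identityˡ (r * V)))) (*-monoˡ-≤ (r * V) 1≤r)))
  where
  open ≤-Reasoning
  lem₁ : ∀ n → n * (n * (n * n)) + n * (n * (n * n)) ≡ 2 * (n * n * (n * n))
  lem₁ = solve-∀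
  lem₂ : ∀ n r A → 2 * (n * n * (r * (2 * A) + n)) ≡ 4 * (r * (n * n * A)) + 2 * (n * (n * n))
  lem₂ = solve-∀
  lem₃ : ∀ r V → 4 * (r * (400 * V)) ≡ 1600 * (r * V)
  lem₃ = solve-∀

-- From A ≤ 4nh follows h ≥ (n - 1)/(4r), and V of order n²h² turns this into the factor r². The
-- assumption 20r ≤ n forces h ≥ 2, so the diagonal term n²h is at most half of n²h².
hub-estimate : ∀ n r A h V → n * n ≤ r * A + n → A ≤ 4 * (n * h) → n * n * (h * h) ≤ 10 * V + n * n * h → 20 * r ≤ n → 1 ≤ r →
               n * (n * (n * n)) ≤ 1600 * (r * (r * V))
hub-estimate n r A h V nn≤ A≤ hh≤ 20r≤n 1≤r = begin
  n * (n * (n * n))                       ≡⟨ lem₁ n ⟩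
  (n * n) * (n * n)                       ≤⟨ *-monoʳ-≤ (n * n) (*-mono-≤ n≤8rh n≤8rh) ⟩
  (n * n) * (8 * (r * h) * (8 * (r * h))) ≡⟨ lem₂ n r h ⟩
  64 * (r * (r * (n * n * (h * h))))      ≤⟨ *-monoʳ-≤ 64 (*-monoʳ-≤ r (*-monoʳ-≤ r nnhh≤)) ⟩
  64 * (r * (r * (20 * V)))               ≡⟨ lem₃ r V ⟩
  1280 * (r * (r * V))                    ≤⟨ *-monoˡ-≤ (r * (r * V)) (m≤m+n 1280 320) ⟩
  1600 * (r * (r * V))                    ∎
  where
  open ≤-Reasoning
  lem₁ : ∀ n → n * (n * (n * n)) ≡ n * n * (n * n)
  lem₁ = solve-∀
  lem₂ : ∀ n r h → (n * n) * (8 * (r * h) * (8 * (r * h))) ≡ 64 * (r * (r * (n * n * (h * h))))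
  lem₂ = solve-∀
  lem₃ : ∀ r V → 64 * (r * (r * (20 * V))) ≡ 1280 * (r * (r * V))
  lem₃ = solve-∀
  instance
    n≢0 : NonZero n
    n≢0 = >-nonZero (≤-trans (*-mono-≤ {1} {20} (s≤s z≤n) 1≤r) 20r≤n)
  n≤4rh+1 : n ≤ 4 * (r * h) + 1
  n≤4rh+1 = *-cancelˡ-≤ n (begin
    n * n                     ≤⟨ nn≤ ⟩
    r * A + n                 ≤⟨ +-monoˡ-≤ n (*-monoʳ-≤ r A≤) ⟩
    r * (4 * (n * h)) + n     ≡⟨ lem n r h ⟩
    n * (4 * (r * h) + 1)     ∎)
    where
    lem : ∀ n r h → r * (4 * (n * h)) + n ≡ n * (4 * (r * h) + 1)
    lem = solve-∀
  2≤h : 2 ≤ h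
  2≤h with 2 ≤? h
  ... | yes le = le
  ... | no ¬le = contradiction (begin-strict
    20 * r              ≤⟨ 20r≤n ⟩
    n                   ≤⟨ n≤4rh+1 ⟩
    4 * (r * h) + 1     ≤⟨ +-monoˡ-≤ 1 (*-monoʳ-≤ 4 (*-monoʳ-≤ r (≤-pred (≰⇒> ¬le)))) ⟩
    4 * (r * 1) + 1     ≤⟨ +-monoʳ-≤ (4 * (r * 1)) 1≤r ⟩
    4 * (r * 1) + r     ≡⟨ lem r ⟩
    5 * r               <⟨ *-monoˡ-< r {{>-nonZero 1≤r}} (s≤s (m≤m+n 5 14)) ⟩
    20 * r              ∎) (<-irrefl refl)
    where
    lem : ∀ r → 4 * (r * 1) + r ≡ 5 * r
    lem = solve-∀
  n≤8rh : n ≤ 8 * (r * h)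
  n≤8rh = begin
    n                           ≤⟨ n≤4rh+1 ⟩
    4 * (r * h) + 1             ≤⟨ +-monoʳ-≤ (4 * (r * h)) (*-mono-≤ {1} {4} (s≤s z≤n) (*-mono-≤ {1} {r} {1} 1≤r (≤-trans (s≤s z≤n) 2≤h))) ⟩
    4 * (r * h) + 4 * (r * h)   ≡⟨ lem (r * h) ⟩
    8 * (r * h)                 ∎
    where
    lem : ∀ k → 4 * k + 4 * k ≡ 8 * k
    lem = solve-∀
  nnhh≤ : n * n * (h * h) ≤ 20 * V
  nnhh≤ = +-cancelʳ-≤ (n * n * (h * h)) _ _ (begin
    n * n * (h * h) + n * n * (h * h)   ≤⟨ +-mono-≤ hh≤ hh≤ ⟩
    (10 * V + n * n * h) + (10 * V + n * n * h)  ≡⟨ lem n h V ⟩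
    20 * V + n * n * (2 * h)            ≤⟨ +-monoʳ-≤ (20 * V) (*-monoʳ-≤ (n * n) (*-monoˡ-≤ h 2≤h)) ⟩
    20 * V + n * n * (h * h)            ∎)
    where
    lem : ∀ n h V → (10 * V + n * n * h) + (10 * V + n * n * h) ≡ 20 * V + n * n * (2 * h)
    lem = solve-∀

-- Losing two units from e + 1 > n/10 costs at most half, precisely because n ≥ 40.
half-codegree : ∀ n e → 40 ≤ n → n < 10 * (e + 1) → n ≤ 20 * (e ∸ 1)
half-codegree n zero    40≤n n<  = contradiction (≤-trans 40≤n (<⇒≤ n<)) (<⇒≱ (s≤s (m≤m+n 10 29)))
half-codegree n (suc k) 40≤n n< = +-cancelʳ-≤ n _ _ (begin
  n + n                          ≤⟨ +-mono-≤ (<⇒≤ n<) (<⇒≤ n<) ⟩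
  10 * (suc k + 1) + 10 * (suc k + 1) ≡⟨ lem k ⟩
  20 * k + 40                    ≤⟨ +-monoʳ-≤ (20 * k) 40≤n ⟩
  20 * k + n                     ∎)
  where
  open ≤-Reasoning
  lem : ∀ k → 10 * (1 + k + 1) + 10 * (1 + k + 1) ≡ 20 * k + 40
  lem = solve-∀

1∸𝟙-≤ : {P : Set} (P? : Dec P) {k : ℕ} → (¬ P → 1 ≤ k) → 1 ∸ 𝟙 P? ≤ k
1∸𝟙-≤ (yes _) _  = z≤n
1∸𝟙-≤ (no ¬p) le = le ¬p

module Lower {n} {f : Fin n → Fin n → ℕ} (F : IsAdjacency f) where
  open IsAdjacency F
  open Complement F
  private
    module G = IsAdjacency isAdjacency
    g = complement f

  S : Fin n → Fin n → ℕ
  S a b = ∑ᶠ λ c → ∑ᶠ λ d → discrepancy⁺ f a b c d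

  -- The codegree of a.
  e : Fin n → ℕ
  e a = ∑ᶠ (g a)

  unbalanced : ∀ {a b c d} → Unique (a ∷ b ∷ c ∷ d ∷ []) → f a d + f c b ≢ f a b + f c d → 1 ≤ discrepancy⁺ f a b c d
  unbalanced {a} {b} {c} {d} u neq rewrite 𝟙-yes (distinct? a b c d) u | +-identityʳ (discrepancy f a b c d) =
    n≢0⇒n>0 (neq ∘ ∣m-n∣≡0⇒m≡n)

  -- With a d and b c missing, the alternating sum is f a b + f c d ≥ 1.
  isolated-pair : ∀ {a b} → f a b ≡ 1 → ∀ c d → g b c * (g a d * (1 ∸ 𝟙 (c ≟ d))) ≤ discrepancy⁺ f a b c d
  isolated-pair {a} {b} fab c d = bit-*-≤ (G.bit b c) λ gbc → bit-*-≤ (G.bit a d) λ gad → last gbc gad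
    where
    last : g b c ≡ 1 → g a d ≡ 1 → 1 ∸ 𝟙 (c ≟ d) ≤ discrepancy⁺ f a b c d
    last gbc gad = 1∸𝟙-≤ (c ≟ d) λ c≢d → unbalanced
      ((≡1⇒≢ fab ∷ (λ { refl → contradiction (trans (sym fab) (trans (symm a b) (g≡1⇒f≡0 gbc))) λ () }) ∷ G.≡1⇒≢ gad ∷ []) ∷
       (G.≡1⇒≢ gbc ∷ (λ { refl → contradiction (trans (sym fab) (g≡1⇒f≡0 gad)) λ () }) ∷ []) ∷ (c≢d ∷ []) ∷ [] ∷ [])
      (λ eq → contradiction (trans (sym (cong₂ _+_ (g≡1⇒f≡0 gad) (trans (symm c b) (g≡1⇒f≡0 gbc)))) (trans eq (cong (_+ f c d) fab))) λ ())

  -- With a d and b c present and c d missing, 2 stands against f a b ≤ 1.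
  crossed-pair : ∀ {a b} → a ≢ b → ∀ c d → f a d * (f b c * g c d) ≤ discrepancy⁺ f a b c d
  crossed-pair {a} {b} a≢b c d = bit-*-≤ (bit a d) λ fad → bit-*-≤ (bit b c) λ fbc → last fad fbc
    where
    last : f a d ≡ 1 → f b c ≡ 1 → g c d ≤ discrepancy⁺ f a b c d
    last fad fbc with G.bit c d
    ... | inj₁ gcd≡0 = ≤-trans (≤-reflexive gcd≡0) z≤n
    ... | inj₂ gcd = ≤-trans (≤-reflexive gcd) (unbalanced
      ((a≢b ∷ (λ { refl → contradiction (trans (sym fad) (g≡1⇒f≡0 gcd)) λ () }) ∷ ≡1⇒≢ fad ∷ []) ∷
       (≡1⇒≢ fbc ∷ (λ { refl → contradiction (trans (sym fbc) (trans (symm b c) (g≡1⇒f≡0 gcd))) λ () }) ∷ []) ∷ (G.≡1⇒≢ gcd ∷ []) ∷ [] ∷ [])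
      (λ eq → two (trans (sym (cong₂ _+_ fad (trans (symm c b) fbc))) (trans eq (trans (cong (f a b +_) (g≡1⇒f≡0 gcd)) (+-identityʳ _))))))
      where
      two : 2 ≢ f a b
      two eq with f a b | bit a b
      two () | _ | inj₁ refl
      two () | _ | inj₂ refl

  S-sparse : ∀ {a b} → f a b ≡ 1 → e b * (e a ∸ 1) ≤ S a b
  S-sparse {a} {b} fab = begin
    e b * (e a ∸ 1)                                                 ≡⟨ ∑-*ʳ (allFin n) (e a ∸ 1) (g b) ⟨
    ∑ᶠ (λ c → g b c * (e a ∸ 1))                                    ≤⟨ ∑-mono (allFin n) (λ c → *-monoʳ-≤ (g b c) (row c)) ⟩
    ∑ᶠ (λ c → g b c * ∑ᶠ (λ d → g a d * (1 ∸ 𝟙 (c ≟ d))))           ≡⟨ ∑-cong (allFin n) (λ c → ∑-*ˡ (allFin n) (g b c) _) ⟨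
    ∑ᶠ (λ c → ∑ᶠ (λ d → g b c * (g a d * (1 ∸ 𝟙 (c ≟ d)))))         ≤⟨ ∑-mono (allFin n) (λ c → ∑-mono (allFin n) (isolated-pair fab c)) ⟩
    S a b ∎
    where
    open ≤-Reasoning
    row : ∀ c → e a ∸ 1 ≤ ∑ᶠ (λ d → g a d * (1 ∸ 𝟙 (c ≟ d)))
    row c = m≤n+o⇒m∸n≤o (e a) 1 (begin
      e a                                                          ≤⟨ ∑-mono (allFin n) term ⟩
      ∑ᶠ (λ d → 𝟙 (c ≟ d) * 1 + g a d * (1 ∸ 𝟙 (c ≟ d)))           ≡⟨ ∑-+ (allFin n) _ _ ⟩
      ∑ᶠ (λ d → 𝟙 (c ≟ d) * 1) + ∑ᶠ (λ d → g a d * (1 ∸ 𝟙 (c ≟ d))) ≡⟨ cong (_+ ∑ᶠ (λ d → g a d * (1 ∸ 𝟙 (c ≟ d)))) (∑ᶠ-𝟙 c (λ _ → 1)) ⟩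
      1 + ∑ᶠ (λ d → g a d * (1 ∸ 𝟙 (c ≟ d)))                       ∎)
      where
      term : ∀ d → g a d ≤ 𝟙 (c ≟ d) * 1 + g a d * (1 ∸ 𝟙 (c ≟ d))
      term d with c ≟ d | G.bit a d
      ... | yes _ | inj₁ eq rewrite eq = z≤n
      ... | yes _ | inj₂ eq rewrite eq = s≤s z≤n
      ... | no _  | _ = ≤-reflexive (sym (*-identityʳ _))

  1∸f : ∀ a d → 1 ∸ f a d ≡ g a d + 𝟙 (a ≟ d) * 1
  1∸f a d with a ≟ d
  ... | yes refl rewrite diag a = refl
  ... | no _ rewrite +-identityʳ (f a d) | +-identityʳ (1 ∸ f a d) = refl

  ∑1∸f : ∀ a → ∑ᶠ (λ d → 1 ∸ f a d) ≡ e a + 1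
  ∑1∸f a = trans (∑-cong (allFin n) (1∸f a)) (trans (∑-+ (allFin n) _ _) (cong (e a +_) (∑ᶠ-𝟙 a (λ _ → 1))))

  -- Non-edges c d with c adjacent to b and d adjacent to a are all counted by `crossed-pair`. The
  -- subtracted terms bound the pairs that fail either condition; the + 1 accounts for a and b
  -- themselves.
  S-dense : ∀ {a b} → a ≢ b → size g ≤ S a b + (n * (e a + 1) + n * (e b + 1))
  S-dense {a} {b} a≢b = begin
    size g
      ≤⟨ ∑-mono (allFin n) (λ c → ∑-mono (allFin n) (term c)) ⟩
    ∑ᶠ (λ c → ∑ᶠ (λ d → f a d * (f b c * g c d) + ((1 ∸ f a d) + (1 ∸ f b c))))
      ≡⟨ ∑-cong (allFin n) (λ c → trans (∑-+ (allFin n) _ _) (cong (∑ᶠ (λ d → f a d * (f b c * g c d)) +_)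
           (trans (∑-+ (allFin n) _ _) (cong₂ _+_ (∑1∸f a) (∑ᶠ-const {n} (1 ∸ f b c)))))) ⟩
    ∑ᶠ (λ c → ∑ᶠ (λ d → f a d * (f b c * g c d)) + ((e a + 1) + n * (1 ∸ f b c)))
      ≡⟨ trans (∑-+ (allFin n) _ _) (cong (∑ᶠ (λ c → ∑ᶠ (λ d → f a d * (f b c * g c d))) +_)
           (trans (∑-+ (allFin n) _ _) (cong₂ _+_ (∑ᶠ-const {n} (e a + 1)) (trans (∑-*ˡ (allFin n) n _) (cong (n *_) (∑1∸f b)))))) ⟩
    ∑ᶠ (λ c → ∑ᶠ (λ d → f a d * (f b c * g c d))) + (n * (e a + 1) + n * (e b + 1))
      ≤⟨ +-monoˡ-≤ _ (∑-mono (allFin n) (λ c → ∑-mono (allFin n) (crossed-pair a≢b c))) ⟩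
    S a b + (n * (e a + 1) + n * (e b + 1)) ∎
    where
    open ≤-Reasoning
    term : ∀ c d → g c d ≤ f a d * (f b c * g c d) + ((1 ∸ f a d) + (1 ∸ f b c))
    term c d with bit a d | bit b c | G.bit c d
    ... | _ | _ | inj₁ eq rewrite eq = z≤n
    ... | inj₁ eq | _ | inj₂ eq′ rewrite eq | eq′ = s≤s z≤n
    ... | inj₂ eq | inj₁ eq″ | inj₂ eq′ rewrite eq | eq′ | eq″ = s≤s z≤n
    ... | inj₂ eq | inj₂ eq″ | inj₂ eq′ rewrite eq | eq′ | eq″ = s≤s z≤n

  -- Degree at least 9n/10: a is its own non-neighbour, whence the + 1.
  Hub : Fin n → Set
  Hub a = 10 * (e a + 1) ≤ n

  abstract
    hub? : ∀ a → Dec (Hub a)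
    hub? a = 10 * (e a + 1) ≤? n

  η : Fin n → ℕ
  η a = 𝟙 (hub? a)

  h : ℕ
  h = ∑ᶠ η

  module _ (40≤n : 40 ≤ n) (sparse : 5 * size f + 3 * n ≤ 3 * (n * n)) where

    -- Density at most 3/5 leaves about 2n²/5 ordered non-edges. Two hubs spoil at most n²/5 of
    -- them, and half of what remains absorbs the linear terms.
    nn≤10S : ∀ {a b} → Hub a → Hub b → a ≢ b → n * n ≤ 10 * S a b
    nn≤10S {a} {b} ha hb a≢b = +-cancelʳ-≤ (9 * (n * n) + 6 * n) _ _ (begin
      n * n + (9 * (n * n) + 6 * n)
        ≡⟨ lem₁ n (n * n) ⟩
      10 * (n * n) + 6 * n
        ≡⟨ cong (λ k → 10 * k + 6 * n) sizes ⟨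
      10 * ((size f + size g) + n) + 6 * n
        ≡⟨ lem₂ (size f) (size g) n ⟩
      2 * (5 * size f + 3 * n) + (10 * size g + 10 * n)
        ≤⟨ +-mono-≤ (*-monoʳ-≤ 2 sparse) (+-monoˡ-≤ (10 * n) (*-monoʳ-≤ 10 (S-dense a≢b))) ⟩
      2 * (3 * (n * n)) + (10 * (S a b + (n * (e a + 1) + n * (e b + 1))) + 10 * n)
        ≡⟨ lem₃ (n * n) (S a b) n (e a + 1) (e b + 1) ⟩
      10 * S a b + (6 * (n * n) + (n * (10 * (e a + 1)) + n * (10 * (e b + 1)))) + (4 * n + 6 * n)
        ≤⟨ +-mono-≤ (+-monoʳ-≤ (10 * S a b) (+-monoʳ-≤ (6 * (n * n)) (+-mono-≤ (*-monoʳ-≤ n ha) (*-monoʳ-≤ n hb))))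
                    (+-monoˡ-≤ (6 * n) (*-monoˡ-≤ n (≤-trans (m≤m+n 4 36) 40≤n))) ⟩
      10 * S a b + (6 * (n * n) + (n * n + n * n)) + (n * n + 6 * n)
        ≡⟨ lem₄ (S a b) (n * n) n ⟩
      10 * S a b + (9 * (n * n) + 6 * n) ∎)
      where
      open ≤-Reasoning
      lem₁ : ∀ n nn → nn + (9 * nn + 6 * n) ≡ 10 * nn + 6 * n
      lem₁ = solve-∀
      lem₂ : ∀ a b n → 10 * ((a + b) + n) + 6 * n ≡ 2 * (5 * a + 3 * n) + (10 * b + 10 * n)
      lem₂ = solve-∀
      lem₃ : ∀ nn s n i j → 2 * (3 * nn) + (10 * (s + (n * i + n * j)) + 10 * n) ≡ 10 * s + (6 * nn + (n * (10 * i) + n * (10 * j))) + (4 * n + 6 * n)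
      lem₃ = solve-∀
      lem₄ : ∀ s nn n → 10 * s + (6 * nn + (nn + nn)) + (nn + 6 * n) ≡ 10 * s + (9 * nn + 6 * n)
      lem₄ = solve-∀

    nn≤400S : ∀ {a b} → ¬ Hub a → ¬ Hub b → f a b ≡ 1 → n * n ≤ 400 * S a b
    nn≤400S {a} {b} ¬ha ¬hb fab = begin
      n * n                                     ≤⟨ *-mono-≤ (half-codegree n (e b) 40≤n (≰⇒> ¬hb)) (half-codegree n (e a) 40≤n (≰⇒> ¬ha)) ⟩
      20 * (e b ∸ 1) * (20 * (e a ∸ 1))         ≡⟨ lem (e b ∸ 1) (e a ∸ 1) ⟩
      400 * ((e b ∸ 1) * (e a ∸ 1))             ≤⟨ *-monoʳ-≤ 400 (*-monoˡ-≤ (e a ∸ 1) (m∸n≤m (e b) 1)) ⟩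
      400 * (e b * (e a ∸ 1))                   ≤⟨ *-monoʳ-≤ 400 (S-sparse fab) ⟩
      400 * S a b                               ∎
      where
      open ≤-Reasoning
      lem : ∀ i j → 20 * i * (20 * j) ≡ 400 * (i * j)
      lem = solve-∀

    -- The sum of `nn≤10S` over ordered pairs of distinct hubs; the last term restores the diagonal.
    hubs : n * n * (h * h) ≤ 10 * variation f + n * n * h
    hubs = begin
      n * n * (h * h)
        ≡⟨ cong (n * n *_) (∑-*ʳ (allFin n) h η) ⟨
      n * n * ∑ᶠ (λ a → η a * h)
        ≤⟨ *-monoʳ-≤ (n * n) (∑-mono (allFin n) row) ⟩
      n * n * ∑ᶠ (λ a → ∑ᶠ (λ b → η a * (η b * (1 ∸ 𝟙 (a ≟ b)))) + η a)
        ≡⟨ cong (n * n *_) (∑-+ (allFin n) _ _) ⟩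
      n * n * (∑ᶠ (λ a → ∑ᶠ (λ b → η a * (η b * (1 ∸ 𝟙 (a ≟ b))))) + h)
        ≡⟨ *-distribˡ-+ (n * n) _ h ⟩
      n * n * ∑ᶠ (λ a → ∑ᶠ (λ b → η a * (η b * (1 ∸ 𝟙 (a ≟ b))))) + n * n * h
        ≡⟨ cong (_+ n * n * h) (trans (sym (∑-*ˡ (allFin n) (n * n) _)) (∑-cong (allFin n) (λ a → sym (∑-*ˡ (allFin n) (n * n) _)))) ⟩
      ∑ᶠ (λ a → ∑ᶠ (λ b → n * n * (η a * (η b * (1 ∸ 𝟙 (a ≟ b)))))) + n * n * h
        ≤⟨ +-monoˡ-≤ (n * n * h) (∑-mono (allFin n) (λ a → ∑-mono (allFin n) (term a))) ⟩
      ∑ᶠ (λ a → ∑ᶠ (λ b → 10 * S a b)) + n * n * h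
        ≡⟨ cong (_+ n * n * h) (trans (∑-cong (allFin n) (λ a → ∑-*ˡ (allFin n) 10 _)) (∑-*ˡ (allFin n) 10 _)) ⟩
      10 * variation f + n * n * h ∎
      where
      open ≤-Reasoning
      term : ∀ a b → n * n * (η a * (η b * (1 ∸ 𝟙 (a ≟ b)))) ≤ 10 * S a b
      term a b with hub? a | hub? b | a ≟ b
      ... | no _   | _      | _      = ≤-trans (≤-reflexive (*-zeroʳ (n * n))) z≤n
      ... | yes _  | no _   | _      = ≤-trans (≤-reflexive (*-zeroʳ (n * n))) z≤n
      ... | yes _  | yes _  | yes _  = ≤-trans (≤-reflexive (*-zeroʳ (n * n))) z≤n
      ... | yes ha | yes hb | no a≢b = ≤-trans (≤-reflexive (*-identityʳ (n * n))) (nn≤10S ha hb a≢b)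
      row : ∀ a → η a * h ≤ ∑ᶠ (λ b → η a * (η b * (1 ∸ 𝟙 (a ≟ b)))) + η a
      row a = begin
        η a * h
          ≤⟨ *-monoʳ-≤ (η a) (∑-mono (allFin n) split) ⟩
        η a * ∑ᶠ (λ b → η b * (1 ∸ 𝟙 (a ≟ b)) + 𝟙 (a ≟ b) * 1)
          ≡⟨ cong (η a *_) (trans (∑-+ (allFin n) _ _) (cong (∑ᶠ (λ b → η b * (1 ∸ 𝟙 (a ≟ b))) +_) (∑ᶠ-𝟙 a (λ _ → 1)))) ⟩
        η a * (∑ᶠ (λ b → η b * (1 ∸ 𝟙 (a ≟ b))) + 1)
          ≡⟨ trans (*-distribˡ-+ (η a) _ 1) (cong₂ _+_ (sym (∑-*ˡ (allFin n) (η a) _)) (*-identityʳ (η a))) ⟩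
        ∑ᶠ (λ b → η a * (η b * (1 ∸ 𝟙 (a ≟ b)))) + η a ∎
        where
        split : ∀ b → η b ≤ η b * (1 ∸ 𝟙 (a ≟ b)) + 𝟙 (a ≟ b) * 1
        split b with a ≟ b | hub? b
        ... | no _  | yes _ = s≤s z≤n
        ... | no _  | no _  = z≤n
        ... | yes _ | yes _ = s≤s z≤n
        ... | yes _ | no _  = z≤n

    -- Ordered edges with no hub among their ends.
    A′ : ℕ
    A′ = ∑ᶠ λ a → ∑ᶠ λ b → (1 ∸ η a) * ((1 ∸ η b) * f a b)

    nonhubs : n * n * A′ ≤ 400 * variation f
    nonhubs = begin
      n * n * A′
        ≡⟨ trans (sym (∑-*ˡ (allFin n) (n * n) _)) (∑-cong (allFin n) (λ a → sym (∑-*ˡ (allFin n) (n * n) _))) ⟩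
      ∑ᶠ (λ a → ∑ᶠ (λ b → n * n * ((1 ∸ η a) * ((1 ∸ η b) * f a b))))
        ≤⟨ ∑-mono (allFin n) (λ a → ∑-mono (allFin n) (term a)) ⟩
      ∑ᶠ (λ a → ∑ᶠ (λ b → 400 * S a b))
        ≡⟨ trans (∑-cong (allFin n) (λ a → ∑-*ˡ (allFin n) 400 _)) (∑-*ˡ (allFin n) 400 _) ⟩
      400 * variation f ∎
      where
      open ≤-Reasoning
      term : ∀ a b → n * n * ((1 ∸ η a) * ((1 ∸ η b) * f a b)) ≤ 400 * S a b
      term a b with hub? a | hub? b | bit a b
      ... | yes _  | _      | _       = ≤-trans (≤-reflexive (*-zeroʳ (n * n))) z≤n
      ... | no _   | yes _  | _       = ≤-trans (≤-reflexive (*-zeroʳ (n * n))) z≤n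
      ... | no _   | no _   | inj₁ eq = ≤-trans (≤-reflexive (trans (cong (λ k → n * n * (1 * (1 * k))) eq) (*-zeroʳ (n * n)))) z≤n
      ... | no ¬ha | no ¬hb | inj₂ eq = ≤-trans (≤-reflexive (trans (cong (λ k → n * n * (1 * (1 * k))) eq) (*-identityʳ (n * n)))) (nn≤400S ¬ha ¬hb eq)

    size≤ : size f ≤ A′ + 2 * (n * h)
    size≤ = begin
      size f
        ≤⟨ ∑-mono (allFin n) (λ a → ∑-mono (allFin n) (term a)) ⟩
      ∑ᶠ (λ a → ∑ᶠ (λ b → (1 ∸ η a) * ((1 ∸ η b) * f a b) + (η a + η b)))
        ≡⟨ ∑-cong (allFin n) (λ a → trans (∑-+ (allFin n) _ _) (cong (∑ᶠ (λ b → (1 ∸ η a) * ((1 ∸ η b) * f a b)) +_)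
             (trans (∑-+ (allFin n) _ _) (cong (_+ h) (∑ᶠ-const {n} (η a)))))) ⟩
      ∑ᶠ (λ a → ∑ᶠ (λ b → (1 ∸ η a) * ((1 ∸ η b) * f a b)) + (n * η a + h))
        ≡⟨ trans (∑-+ (allFin n) _ _) (cong (A′ +_) (trans (∑-+ (allFin n) _ _)
             (trans (cong₂ _+_ (∑-*ˡ (allFin n) n η) (∑ᶠ-const {n} h)) (cong (n * h +_) (sym (+-identityʳ _)))))) ⟩
      A′ + 2 * (n * h) ∎
      where
      open ≤-Reasoning
      term : ∀ a b → f a b ≤ (1 ∸ η a) * ((1 ∸ η b) * f a b) + (η a + η b)
      term a b with hub? a | hub? b | bit a b
      ... | _     | _     | inj₁ eq rewrite eq = z≤n
      ... | yes _ | _     | inj₂ eq rewrite eq = s≤s z≤n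
      ... | no _  | yes _ | inj₂ eq rewrite eq = s≤s z≤n
      ... | no _  | no _  | inj₂ eq rewrite eq = s≤s z≤n

    -- Either at least half of the edges avoid the hubs, or the hubs meet more than half of them and
    -- A ≤ 4nh.
    variation-large : ∀ r → 2 ≤ r → 20 * r ≤ n → n * n ≤ r * size f + n →
                      n * (n * (n * n)) ≤ 1600 * (r * (r * variation f))
    variation-large r 2≤r 20r≤n nn≤ with size f ≤? 2 * A′
    ... | yes le = sparse-estimate n r (size f) A′ (variation f) nn≤ le nonhubs (≤-trans (m≤m+n 2 38) 40≤n) (≤-trans (s≤s z≤n) 2≤r)
    ... | no ¬le = hub-estimate n r (size f) h (variation f) nn≤ (+-cancelˡ-≤ (size f) _ _ (begin
        size f + size f                          ≤⟨ +-mono-≤ size≤ size≤ ⟩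
        (A′ + 2 * (n * h)) + (A′ + 2 * (n * h))  ≡⟨ lem A′ (n * h) ⟩
        2 * A′ + 4 * (n * h)                     ≤⟨ +-monoˡ-≤ (4 * (n * h)) (<⇒≤ (≰⇒> ¬le)) ⟩
        size f + 4 * (n * h)                     ∎)) hubs 20r≤n (≤-trans (s≤s z≤n) 2≤r)
      where
      open ≤-Reasoning
      lem : ∀ a k → (a + 2 * k) + (a + 2 * k) ≡ 2 * a + 4 * k
      lem = solve-∀

-- Trees

opposite-inject₁ : ∀ {n} (i : Fin n) → opposite (inject₁ i) ≡ suc (opposite i)
opposite-inject₁ zero    = refl
opposite-inject₁ (suc i) = cong inject₁ (opposite-inject₁ i)

opposite-fromℕ : ∀ n → opposite (fromℕ n) ≡ zero
opposite-fromℕ zero    = refl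
opposite-fromℕ (suc n) = cong inject₁ (opposite-fromℕ n)

module Acyclic {n} (T : Graph n) (acyclic : ¬ Cycle T) where
  open Graph T

  -- Confinement to S allows a vertex outside S to prolong the path or to close it to a cycle
  -- without repetition.
  record Path (S : List (Fin n)) (a b : Fin n) : Set where
    field
      len      : ℕ
      vertex   : Fin (suc len) → Fin n
      distinct : ∀ {i j} → vertex i ≡ vertex j → i ≡ j
      step     : ∀ i → vertex (inject₁ i) ~ vertex (suc i)
      start    : vertex zero ≡ a
      end      : vertex (fromℕ len) ≡ b
      inside   : ∀ i → vertex i ∈ S

  trivial : ∀ {S a} → a ∈ S → Path S a a
  trivial {a = a} a∈ = record
    { len = 0 ; vertex = λ _ → a ; distinct = λ { {zero} {zero} _ → refl } ; step = λ ()
    ; start = refl ; end = refl ; inside = λ _ → a∈ }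

  weaken : ∀ {S a b v} → Path S a b → Path (v ∷ S) a b
  weaken p = record
    { len = len ; vertex = vertex ; distinct = distinct ; step = step
    ; start = start ; end = end ; inside = there ∘ inside }
    where open Path p

  cons : ∀ {S a b v} → v ∉ S → v ~ a → Path S a b → Path (v ∷ S) v b
  cons {S} {a} {b} {v} v∉ v~a p = record
    { len = suc len ; vertex = vertex′ ; distinct = distinct′ ; step = step′
    ; start = refl ; end = end ; inside = inside′ }
    where
    open Path p
    vertex′ : Fin (suc (suc len)) → Fin n
    vertex′ zero    = v
    vertex′ (suc i) = vertex i
    distinct′ : ∀ {i j} → vertex′ i ≡ vertex′ j → i ≡ j
    distinct′ {zero}  {zero}  eq = refl
    distinct′ {zero}  {suc j} eq = contradiction (subst (_∈ S) (sym eq) (inside j)) v∉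
    distinct′ {suc i} {zero}  eq = contradiction (subst (_∈ S) eq (inside i)) v∉
    distinct′ {suc i} {suc j} eq = cong suc (distinct eq)
    step′ : ∀ i → vertex′ (inject₁ i) ~ vertex′ (suc i)
    step′ zero    = subst (v ~_) (sym start) v~a
    step′ (suc i) = step i
    inside′ : ∀ i → vertex′ i ∈ v ∷ S
    inside′ zero    = here refl
    inside′ (suc i) = there (inside i)

  reverse : ∀ {S a b} → Path S a b → Path S b a
  reverse {S} p = record
    { len = len ; vertex = vertex ∘ opposite
    ; distinct = λ {i} {j} eq → trans (sym (opposite-involutive i)) (trans (cong opposite (distinct eq)) (opposite-involutive j))
    ; step = λ i → ~-sym (subst (vertex (inject₁ (opposite i)) ~_) (cong vertex (sym (opposite-inject₁ i))) (step (opposite i)))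
    ; start = end ; end = trans (cong vertex (opposite-fromℕ len)) start ; inside = inside ∘ opposite }
    where open Path p

  -- As a ≢ b, the path has at least one step, so together with v there are at least the three
  -- vertices that a cycle needs.
  no-closing-vertex : ∀ {S a b v} → v ∉ S → Path S a b → a ≢ b → v ~ a → ¬ v ~ b
  no-closing-vertex {S} {a} {b} {v} v∉ p a≢b v~a v~b with Path.len p in eq
  ... | zero  = a≢b (trans (sym (Path.start p)) (trans (cong (Path.vertex p) (zero≡ (Path.len p) eq)) (Path.end p)))
    where
    zero≡ : ∀ m → m ≡ 0 → zero ≡ fromℕ m
    zero≡ zero _ = refl
  ... | suc k = acyclic (close k (cons v∉ v~a p) (cong suc eq))
    where
    close : ∀ k (q : Path (v ∷ S) v b) → Path.len q ≡ 2 + k → Cycle T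
    close k q refl = record
      { k = k ; vertex = Path.vertex q ; distinct = Path.distinct q ; step = Path.step q
      ; close = subst₂ _~_ (sym (Path.end q)) (sym (Path.start q)) (~-sym v~b) }

  ~⇒≢ : ∀ {a b} → a ~ b → a ≢ b
  ~⇒≢ ab eq = ~-irrefl eq ab

  ∉[] : ∀ {a : Fin n} → a ∉ []
  ∉[] ()

  ∉-∷ : ∀ {a b : Fin n} {S} → a ≢ b → a ∉ S → a ∉ b ∷ S
  ∉-∷ a≢b a∉ (here eq)  = a≢b eq
  ∉-∷ a≢b a∉ (there a∈) = a∉ a∈

  no-triangle : ∀ {a b c} → a ~ b → b ~ c → ¬ a ~ c
  no-triangle ab bc ac = no-closing-vertex
    (∉-∷ (~⇒≢ ab) (∉-∷ (~⇒≢ ac) ∉[]))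
    (cons (∉-∷ (~⇒≢ bc) ∉[]) bc (trivial (here refl))) (~⇒≢ bc) ab ac

  no-square : ∀ {a b c d} → a ≢ c → b ≢ d → a ~ b → b ~ c → c ~ d → ¬ a ~ d
  no-square a≢c b≢d ab bc cd ad = no-closing-vertex
    (∉-∷ (~⇒≢ ab) (∉-∷ a≢c (∉-∷ (~⇒≢ ad) ∉[])))
    (cons (∉-∷ (~⇒≢ bc) (∉-∷ b≢d ∉[])) bc
      (cons (∉-∷ (~⇒≢ cd) ∉[]) cd (trivial (here refl)))) b≢d ab ad

  private
    t : Fin n → Fin n → ℕ
    t a b = 𝟙 (a ~? b)

  -- S induces a subtree. Its bipartition and its edge count (at least 2 |S| - 2 ordered pairs) are
  -- built along with it, one vertex at a time.
  record Grown (S : List (Fin n)) : Set where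
    field
      unique : Unique S
      path   : ∀ {a b} → a ∈ S → b ∈ S → Path S a b
      colour : Fin n → Bool
      proper : ∀ {a b} → a ∈ S → b ∈ S → a ~ b → colour a ≢ colour b
      manyEdges : 2 * length S ≤ ∑ S (λ a → ∑ S (t a)) + 2

  singleton : ∀ r → Grown (r ∷ [])
  singleton r = record
    { unique = [] ∷ [] ; path = λ { (here refl) (here refl) → trivial (here refl) } ; colour = λ _ → true
    ; proper = λ { (here refl) (here refl) rr → contradiction rr (~-irrefl refl) } ; manyEdges = m≤n+m 2 _ }

  -- A second neighbour of v in S would close a cycle, so u is the only one: giving v the colour
  -- opposite to u is proper. The edge u v adds the two ordered pairs.
  extend : ∀ {S u v} → Grown S → u ∈ S → v ∉ S → u ~ v → Grown (v ∷ S)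
  extend {S} {u} {v} G u∈ v∉ u~v = record
    { unique = All.tabulate (λ z∈ eq → v∉ (subst (_∈ S) (sym eq) z∈)) ∷ unique
    ; path = path′ ; colour = colour′ ; proper = proper′ ; manyEdges = edges′ }
    where
    open Grown G
    path′ : ∀ {a b} → a ∈ v ∷ S → b ∈ v ∷ S → Path (v ∷ S) a b
    path′ (here refl) (here refl) = trivial (here refl)
    path′ (here refl) (there b∈)  = cons v∉ (~-sym u~v) (path u∈ b∈)
    path′ (there a∈)  (here refl) = reverse (cons v∉ (~-sym u~v) (path u∈ a∈))
    path′ (there a∈)  (there b∈)  = weaken (path a∈ b∈)
    parent : ∀ {a} → a ∈ S → a ~ v → a ≡ u
    parent {a} a∈ a~v with a ≟ u
    ... | yes eq = eq
    ... | no a≢u = contradiction (~-sym u~v) (no-closing-vertex v∉ (path a∈ u∈) a≢u (~-sym a~v))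
    colour′ : Fin n → Bool
    colour′ w = if does (w ≟ v) then not (colour u) else colour w
    colour′-v : colour′ v ≡ not (colour u)
    colour′-v with v ≟ v
    ... | yes _ = refl
    ... | no ¬p = contradiction refl ¬p
    colour′-S : ∀ {w} → w ∈ S → colour′ w ≡ colour w
    colour′-S {w} w∈ with w ≟ v
    ... | yes refl = contradiction w∈ v∉
    ... | no _     = refl
    proper′ : ∀ {a b} → a ∈ v ∷ S → b ∈ v ∷ S → a ~ b → colour′ a ≢ colour′ b
    proper′ (here refl) (here refl) ab eq = ~-irrefl refl ab
    proper′ (here refl) (there b∈) ab eq with refl ← parent b∈ (~-sym ab) =
      not-¬ refl (sym (trans (sym colour′-v) (trans eq (colour′-S b∈))))
    proper′ (there a∈) (here refl) ab eq with refl ← parent a∈ ab =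
      not-¬ refl (sym (trans (sym colour′-v) (trans (sym eq) (colour′-S a∈))))
    proper′ (there a∈) (there b∈) ab eq = proper a∈ b∈ ab (trans (sym (colour′-S a∈)) (trans eq (colour′-S b∈)))
    edges′ : 2 * length (v ∷ S) ≤ ∑ (v ∷ S) (λ a → ∑ (v ∷ S) (t a)) + 2
    edges′ = begin
      2 * suc (length S)
        ≡⟨ *-suc 2 (length S) ⟩
      2 + 2 * length S
        ≤⟨ +-monoʳ-≤ 2 manyEdges ⟩
      2 + (∑ S (λ a → ∑ S (t a)) + 2)
        ≡⟨ cong₂ (λ i j → (i + j) + (∑ S (λ a → ∑ S (t a)) + 2)) (𝟙-yes (v ~? u) (~-sym u~v)) (𝟙-yes (u ~? v) u~v) ⟨
      (t v u + t u v) + (∑ S (λ a → ∑ S (t a)) + 2)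
        ≤⟨ +-monoˡ-≤ _ (+-mono-≤ (≤-trans (∑-≥ (t v) u∈) (m≤n+m _ (t v v))) (∑-≥ (λ a → t a v) u∈)) ⟩
      ((t v v + ∑ S (t v)) + ∑ S (λ a → t a v)) + (∑ S (λ a → ∑ S (t a)) + 2)
        ≡⟨ lem (t v v + ∑ S (t v)) (∑ S (λ a → t a v)) _ ⟩
      (t v v + ∑ S (t v)) + (∑ S (λ a → t a v) + ∑ S (λ a → ∑ S (t a))) + 2
        ≡⟨ cong (λ k → (t v v + ∑ S (t v)) + k + 2) (∑-+ S (λ a → t a v) (λ a → ∑ S (t a))) ⟨
      ∑ (v ∷ S) (λ a → ∑ (v ∷ S) (t a)) + 2 ∎
      where
      open ≤-Reasoning
      lem : ∀ i j k → (i + j) + (k + 2) ≡ i + (j + k) + 2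
      lem = solve-∀

  open import Data.List.Membership.DecPropositional (_≟_ {n}) using (_∈?_)

  grow-along : ∀ {S a b} → Grown S → a ∈ S → Star _~_ a b → ∃[ S′ ] Grown S′ × (∀ {x} → x ∈ S → x ∈ S′) × b ∈ S′
  grow-along {S} G a∈ ε = S , G , id , a∈
  grow-along {S} G a∈ (_◅_ {j = c} a~c walk) with c ∈? S
  ... | yes c∈ = grow-along G c∈ walk
  ... | no c∉ with S′ , G′ , sub , b∈ ← grow-along (extend G a∈ c∉ a~c) (here refl) walk =
    S′ , G′ , sub ∘ there , b∈

  record BipartiteTree : Set where
    field
      colour : Fin n → Bool
      proper : ∀ {a b} → a ~ b → colour a ≢ colour b
      manyEdges : 2 * n ≤ ∑ᶠ (λ a → ∑ᶠ (t a)) + 2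

  module _ (connected : ∀ u v → Star _~_ u v) (root : Fin n) where

    grow-over : ∀ vs → ∃[ S ] Grown S × root ∈ S × (∀ {x} → x ∈ vs → x ∈ S)
    grow-over [] = root ∷ [] , singleton root , here refl , λ ()
    grow-over (v ∷ vs) with S , G , r∈ , sub ← grow-over vs
      with S′ , G′ , sub′ , v∈ ← grow-along G r∈ (connected root v) =
      S′ , G′ , sub′ r∈ , λ { (here refl) → v∈ ; (there x∈) → sub′ (sub x∈) }

    bipartiteTree : BipartiteTree
    bipartiteTree with S , G , _ , sub ← grow-over (allFin n) = record
      { colour = colour ; proper = proper (sub (∈-allFin _)) (sub (∈-allFin _))
      ; manyEdges = subst₂ (λ i j → 2 * i ≤ j + 2) (trans (↭-length S↭) (length-tabulate {n = n} id))
          (trans (∑-↭ _ S↭) (∑-cong (allFin n) (λ a → ∑-↭ (t a) S↭))) manyEdges }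
      where
      open Grown G
      S↭ : S ↭ allFin n
      S↭ = Unique-full⇒↭ unique (λ y → sub (∈-allFin y))

-- Families of gadgets in a tree

AllPairs-resp-↭ : ∀ {A : Set} {R : A → A → Set} → Symmetric R → ∀ {xs ys} → xs ↭ ys → AllPairs R xs → AllPairs R ys
AllPairs-resp-↭ {A} {R} R-sym p = Permutationₛ.AllPairs-resp-↭ (setoid A) R-sym (subst (R _) , subst (λ x → R x _)) (↭⇒↭ₛ p)

module Families {n} (T : Graph n) where
  open Graph T
  open Gadgets T

  -- What x and y lack of being the swapped pair of a gadget, apart from non-adjacency.
  Compatible : Fin n → Fin n → Set
  Compatible x y = ∃[ u ] ∃[ w ] u ~ x × w ~ y × ¬ u ~ y × ¬ w ~ x

  compatible? : ∀ x y → Dec (Compatible x y)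
  compatible? x y = any? λ u → any? λ w → (u ~? x) ×-dec (w ~? y) ×-dec ¬? (u ~? y) ×-dec ¬? (w ~? x)

  Compatible-sym : Symmetric Compatible
  Compatible-sym (u , w , ux , wy , u≁y , w≁x) = w , u , wy , ux , w≁x , u≁y

  Far-sym : Symmetric Far
  Far-sym (p≢q , p≁q) = ≢-sym p≢q , λ q~p → p≁q (~-sym q~p)

  ends : List Gadget → List (Fin n)
  ends []       = []
  ends (g ∷ gs) = Gadget.x g ∷ Gadget.x′ g ∷ ends gs

  length-ends : ∀ gs → length (ends gs) ≡ 2 * length gs
  length-ends []       = refl
  length-ends (g ∷ gs) = trans (cong (2 +_) (length-ends gs)) (sym (*-suc 2 (length gs)))

  ends⇒Separated : ∀ gs {rest} → AllPairs Far (ends gs ++ rest) → AllPairs Separated gs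
  ends⇒Separated []       _ = []
  ends⇒Separated (g ∷ gs) ((_ ∷ far-x) ∷ far-x′ ∷ fars) = separated gs far-x far-x′ ∷ ends⇒Separated gs fars
    where
    separated : ∀ gs {rest} → All (Far (Gadget.x g)) (ends gs ++ rest) → All (Far (Gadget.x′ g)) (ends gs ++ rest) →
                All (Separated g) gs
    separated []       _ _ = []
    separated (h ∷ gs) (a ∷ b ∷ as) (c ∷ d ∷ cs) = (a , b , c , d) ∷ separated gs as cs

  record Pairing (xs : List (Fin n)) : Set where
    field
      gadgets      : List Gadget
      rest         : List (Fin n)
      cover        : ends gadgets ++ rest ↭ xs
      incompatible : AllPairs (λ x y → ¬ Compatible x y) rest

  -- A greedy matching: a new vertex is paired with a compatible leftover if there is one. The
  -- leftovers stay pairwise incompatible, so bounding such sets bounds the loss.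
  pairing : ∀ xs → AllPairs Far xs → Pairing xs
  pairing []       _ = record { gadgets = [] ; rest = [] ; cover = ↭-refl ; incompatible = [] }
  pairing (x ∷ xs) (far ∷ fars) with pairing xs fars
  ... | record { gadgets = gs ; rest = rest ; cover = cover ; incompatible = inc }
    with Any.any? (compatible? x) rest
  ... | no none = record
    { gadgets = gs ; rest = x ∷ rest ; cover = ↭-trans (shift x (ends gs) rest) (prep x cover)
    ; incompatible = ¬Any⇒All¬ rest none ∷ inc }
  ... | yes some with y , y∈ , (u , w , ux , wy , u≁y , w≁x) ← find some with as , bs , refl ← ∈-∃++ y∈ = record
    { gadgets = record { u~x = ux ; w~x′ = wy ; u≁x′ = u≁y ; w≁x = w≁x
                       ; x≁x′ = proj₂ (All.lookup far (∈-resp-↭ cover (∈-++⁺ʳ (ends gs) y∈))) } ∷ gs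
    ; rest = as ++ bs
    ; cover = prep x (↭-trans (↭-sym (shift y (ends gs) (as ++ bs))) (↭-trans (++⁺ˡ (ends gs) (↭-sym (shift y as bs))) cover))
    ; incompatible = AllPairs.tail (AllPairs-resp-↭ (λ ¬c c → ¬c (Compatible-sym c)) (shift y as bs) inc) }

  module _ {xs} (far : AllPairs Far xs) where
    open Pairing (pairing xs far)

    family : List Gadget
    family = gadgets

    family-far : AllPairs Far (ends family ++ rest)
    family-far = AllPairs-resp-↭ Far-sym (↭-sym cover) far

    family-separated : AllPairs Separated family
    family-separated = ends⇒Separated family family-far

    leftover-far : ∀ gs → AllPairs Far (ends gs ++ rest) → AllPairs Far rest
    leftover-far []       far = far
    leftover-far (g ∷ gs) (_ ∷ _ ∷ far) = leftover-far gs far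

    family-length : ∀ k →
      (∀ {ys} → AllPairs Far ys → AllPairs (λ x y → ¬ Compatible x y) ys → (∀ {y} → y ∈ ys → y ∈ xs) → length ys ≤ k) →
      length xs ≤ 2 * length family + k
    family-length k leftover≤ = begin
      length xs                          ≡⟨ ↭-length cover ⟨
      length (ends family ++ rest)       ≡⟨ length-++ (ends family) ⟩
      length (ends family) + length rest ≡⟨ cong (_+ length rest) (length-ends family) ⟩
      2 * length family + length rest    ≤⟨ +-monoʳ-≤ (2 * length family)
        (leftover≤ (leftover-far family family-far) incompatible (λ y∈ → ∈-resp-↭ cover (∈-++⁺ʳ (ends family) y∈))) ⟩
      2 * length family + k              ∎
      where open ≤-Reasoning

  filter-far : {P : Fin n → Set} (P? : Decidable P) → (∀ {x y} → P x → P y → ¬ x ~ y) → AllPairs Far (filter P? (allFin n))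
  filter-far {P} P? indep = far (filter⁺ P? (allFin⁺ n)) (All.tabulate (λ x∈ → proj₂ (∈-filter⁻ P? {xs = allFin n} x∈)))
    where
    far : ∀ {xs} → Unique xs → All P xs → AllPairs Far xs
    far []       []       = []
    far (x∉ ∷ u) (p ∷ ps) = All.zipWith (λ (x≢y , q) → x≢y , indep p q) (x∉ , ps) ∷ far u ps

  exit : {P : Fin n → Set} → Decidable P → ∀ {a b} → Star _~_ a b → P a → ¬ P b → ∃₂ λ c d → c ~ d × P c × ¬ P d
  exit P? ε pa ¬pb = contradiction pa ¬pb
  exit P? {a} (_◅_ {j = c} ac walk) pa ¬pb with P? c
  ... | yes pc = exit P? walk pc ¬pb
  ... | no ¬pc = a , c , ac , pa , ¬pc

  module _ (Δ : ℕ) (degree≤ : ∀ z → degree T z ≤ Δ) (Δ<n-1 : Δ + 2 ≤ n)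
           (connected : ∀ u v → Star _~_ u v) (acyclic : ¬ Cycle T) (root : Fin n) where
    open Acyclic T acyclic

    non-neighbour : ∀ z → ∃[ w ] w ≢ z × ¬ z ~ w
    non-neighbour z with any? (λ w → ¬? (w ≟ z) ×-dec ¬? (z ~? w))
    ... | yes found = found
    ... | no none = contradiction Δ<n-1 (<⇒≱ (begin-strict
      n
        ≡⟨ ∑ᶠ-1 n ⟨
      ∑ᶠ {n} (λ _ → 1)
        ≤⟨ ∑-mono (allFin n) term ⟩
      ∑ᶠ (λ w → 𝟙 (z ≟ w) * 1 + 𝟙 (z ~? w))
        ≡⟨ trans (∑-+ (allFin n) _ _) (cong₂ _+_ (∑ᶠ-𝟙 z (λ _ → 1)) (sym (length-filter-∑ (z ~?_) (allFin n)))) ⟩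
      1 + degree T z
        ≤⟨ s≤s (degree≤ z) ⟩
      1 + Δ
        <⟨ ≤-reflexive (+-comm 2 Δ) ⟩
      Δ + 2 ∎))
      where
      open ≤-Reasoning
      term : ∀ w → 1 ≤ 𝟙 (z ≟ w) * 1 + 𝟙 (z ~? w)
      term w with z ≟ w | z ~? w
      ... | yes _  | _      = s≤s z≤n
      ... | no _   | yes _  = s≤s z≤n
      ... | no z≢w | no z≁w = contradiction (w , ≢-sym z≢w , z≁w) none

    neighbour : ∀ x → ∃[ u ] u ~ x
    neighbour x with w , w≢x , _ ← non-neighbour x with connected x w
    ... | ε      = contradiction refl w≢x
    ... | xc ◅ _ = _ , ~-sym xc

    -- A walk from z to a non-neighbour leaves the closed neighbourhood of z, and the edge on which
    -- it does so starts at a neighbour of z.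
    at-distance-2 : ∀ z → ∃₂ λ y v → z ~ y × y ~ v × v ≢ z × ¬ z ~ v
    at-distance-2 z with w , w≢z , z≁w ← non-neighbour z
      with exit (λ v → (v ≟ z) ⊎-dec (z ~? v)) (connected z w) (inj₁ refl) (λ { (inj₁ eq) → w≢z eq ; (inj₂ zw) → z≁w zw })
    ... | c , d , c~d , inj₁ refl , ¬pd = contradiction (inj₂ c~d) ¬pd
    ... | c , d , c~d , inj₂ z~c , ¬pd  = c , d , z~c , c~d , ¬pd ∘ inj₁ , ¬pd ∘ inj₂

    -- The two ends of an induced path on four vertices.
    some-gadget : Gadget
    some-gadget with y , v , z~y , y~v , v≢z , z≁v ← at-distance-2 root
      with z′ , v′ , y~z′ , z′~v′ , v′≢y , y≁v′ ← at-distance-2 y with z′ ≟ root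
    ... | yes refl = record { x = v ; x′ = v′ ; u = y ; w = root ; u~x = y~v ; w~x′ = z′~v′ ; u≁x′ = y≁v′ ; w≁x = z≁v
      ; x≁x′ = no-square v≢z (≢-sym v′≢y) (~-sym y~v) (~-sym z~y) z′~v′ }
    ... | no z′≢z = record { x = root ; x′ = v′ ; u = y ; w = z′ ; u~x = ~-sym z~y ; w~x′ = z′~v′ ; u≁x′ = y≁v′
      ; w≁x = λ z′~z → no-triangle z~y y~z′ (~-sym z′~z)
      ; x≁x′ = no-square (≢-sym z′≢z) (≢-sym v′≢y) z~y y~z′ z′~v′ }

    -- At most one neighbour; that there is one is `neighbour`.
    Leaf : Fin n → Set
    Leaf x = ∀ u v → u ~ x → v ~ x → u ≡ v

    abstract
      leaf? : Decidable Leaf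
      leaf? x = all? λ u → all? λ v → (u ~? x) →-dec ((v ~? x) →-dec (u ≟ v))

    two-neighbours : ∀ {x} → ¬ Leaf x → ∃₂ λ u v → u ~ x × v ~ x × u ≢ v
    two-neighbours {x} ¬leaf with any? (λ u → any? λ v → (u ~? x) ×-dec ((v ~? x) ×-dec ¬? (u ≟ v)))
    ... | yes found = found
    ... | no none = contradiction (λ u v ux vx → decidable-stable (u ≟ v) (λ u≢v → none (u , v , ux , vx , u≢v))) ¬leaf

    -- Two adjacent leaves would form a whole component, but a non-neighbour of x lies outside it.
    leaves-independent : ∀ {x y} → Leaf x → Leaf y → ¬ x ~ y
    leaves-independent {x} {y} lx ly x~y with w , w≢x , x≁w ← non-neighbour x
      with exit (λ v → (v ≟ x) ⊎-dec (v ≟ y)) (connected x w) (inj₁ refl)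
        (λ { (inj₁ eq) → w≢x eq ; (inj₂ eq) → x≁w (subst (x ~_) (sym eq) x~y) })
    ... | c , d , c~d , inj₁ refl , ¬pd = ¬pd (inj₂ (lx d y (~-sym c~d) (~-sym x~y)))
    ... | c , d , c~d , inj₂ refl , ¬pd = ¬pd (inj₁ (ly d x (~-sym c~d) x~y))

    -- Leaves with different neighbours are compatible, so incompatible leaves all hang on one
    -- vertex, of degree at most Δ.
    leaf-leftover : ∀ {ys} → AllPairs Far ys → AllPairs (λ x y → ¬ Compatible x y) ys →
                    (∀ {y} → y ∈ ys → y ∈ filter leaf? (allFin n)) → length ys ≤ Δ
    leaf-leftover {[]} _ _ _ = z≤n
    leaf-leftover {x ∷ ys} far (inc ∷ _) sub with u , u~x ← neighbour x = ≤-trans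
      (Unique-⊆-length (AllPairs.map proj₁ far) (λ y∈ → ∈-filter⁺ (u ~?_) (∈-allFin _) (adjacent y∈)))
      (degree≤ u)
      where
      isLeaf : ∀ {y} → y ∈ x ∷ ys → Leaf y
      isLeaf y∈ = proj₂ (∈-filter⁻ leaf? {xs = allFin n} (sub y∈))
      adjacent : ∀ {y} → y ∈ x ∷ ys → u ~ y
      adjacent (here refl) = u~x
      adjacent {y} y∈′@(there y∈) with w , w~y ← neighbour y with u ≟ w
      ... | yes refl = w~y
      ... | no u≢w = contradiction
        (u , w , u~x , w~y , (λ u~y → u≢w (isLeaf y∈′ u w u~y w~y)) , (λ w~x → u≢w (isLeaf (here refl) u w u~x w~x)))
        (All.lookup inc y∈)

    -- Two common neighbours of x and y would close a 4-cycle, so one of two neighbours of x misses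
    -- y.
    private-neighbour : ∀ {x y} → ¬ Leaf x → x ≢ y → ∃[ u ] u ~ x × ¬ u ~ y
    private-neighbour {x} {y} ¬lx x≢y with u , v , u~x , v~x , u≢v ← two-neighbours ¬lx with u ~? y
    ... | no u≁y  = u , u~x , u≁y
    ... | yes u~y = v , v~x , λ v~y → no-square x≢y u≢v (~-sym u~x) u~y (~-sym v~y) (~-sym v~x)

    nonleaf-leftover : ∀ {ys} → AllPairs Far ys → AllPairs (λ x y → ¬ Compatible x y) ys →
                       (∀ {y} → y ∈ ys → ¬ Leaf y) → length ys ≤ 1
    nonleaf-leftover {[]}        _ _ _ = z≤n
    nonleaf-leftover {_ ∷ []}    _ _ _ = s≤s z≤n
    nonleaf-leftover {x ∷ y ∷ _} (((x≢y , _) ∷ _) ∷ _) ((¬c ∷ _) ∷ _) sub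
      with u , u~x , u≁y ← private-neighbour (sub (here refl)) x≢y
         | w , w~y , w≁x ← private-neighbour (sub (there (here refl))) (≢-sym x≢y) =
      contradiction (u , w , u~x , w~y , u≁y , w≁x) ¬c

    -- Leaves and inner vertices of either colour may be adjacent to each other, so only the largest
    -- of the three families, of size s, is kept: n ≤ 6s + Δ + 2. Having s ≥ 1 moves one unit into
    -- 7s, and it makes the variation count when n is small.
    large-family : ∃[ gs ] AllPairs Separated gs × 1 ≤ length gs × n ≤ 7 * length gs + (Δ + 1)
    large-family = choose (∑-pigeonhole (fam leaf-far) (fam (class-far true) ∷ fam (class-far false) ∷ []) (length ∘ proj₁))
      where
      open BipartiteTree (bipartiteTree connected root)
      Class : Bool → Fin n → Set
      Class c x = ¬ Leaf x × colour x ≡ c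
      class? : ∀ c → Decidable (Class c)
      class? c x = ¬? (leaf? x) ×-dec (colour x Bool.≟ c)
      leaf-far : AllPairs Far (filter leaf? (allFin n))
      leaf-far = filter-far leaf? leaves-independent
      class-far : ∀ c → AllPairs Far (filter (class? c) (allFin n))
      class-far c = filter-far (class? c) (λ { (_ , cx) (_ , cy) x~y → proper x~y (trans cx (sym cy)) })
      fam : ∀ {xs} → AllPairs Far xs → Σ[ gs ∈ List Gadget ] AllPairs Separated gs
      fam far = family far , family-separated far
      sL = length (family leaf-far)
      s : Bool → ℕ
      s c = length (family (class-far c))
      count : n ≡ length (filter leaf? (allFin n)) + (length (filter (class? true) (allFin n)) + length (filter (class? false) (allFin n)))
      count = begin
        n
          ≡⟨ ∑ᶠ-1 n ⟨
        ∑ᶠ {n} (λ _ → 1)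
          ≡⟨ ∑-cong (allFin n) term ⟩
        ∑ᶠ (λ x → 𝟙 (leaf? x) + (𝟙 (class? true x) + 𝟙 (class? false x)))
          ≡⟨ trans (∑-+ (allFin n) _ _) (cong (∑ᶠ (𝟙 ∘ leaf?) +_) (∑-+ (allFin n) _ _)) ⟩
        ∑ᶠ (𝟙 ∘ leaf?) + (∑ᶠ (𝟙 ∘ class? true) + ∑ᶠ (𝟙 ∘ class? false))
          ≡⟨ cong₂ _+_ (length-filter-∑ leaf? (allFin n)) (cong₂ _+_ (length-filter-∑ (class? true) (allFin n)) (length-filter-∑ (class? false) (allFin n))) ⟨
        _ ∎
        where
        open ≡-Reasoning
        term : ∀ x → 1 ≡ 𝟙 (leaf? x) + (𝟙 (class? true x) + 𝟙 (class? false x))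
        term x with leaf? x | colour x
        ... | yes _ | _     = refl
        ... | no _  | true  = refl
        ... | no _  | false = refl
      class-bound : ∀ c → length (filter (class? c) (allFin n)) ≤ 2 * s c + 1
      class-bound c = family-length (class-far c) 1 (λ far inc sub → nonleaf-leftover far inc
        (λ y∈ → proj₁ (proj₂ (∈-filter⁻ (class? c) {xs = allFin n} (sub y∈)))))
      total : n ≤ 2 * (sL + (s true + (s false + 0))) + (Δ + 2)
      total = begin
        n
          ≡⟨ count ⟩
        length (filter leaf? (allFin n)) + (length (filter (class? true) (allFin n)) + length (filter (class? false) (allFin n)))
          ≤⟨ +-mono-≤ (family-length leaf-far Δ leaf-leftover) (+-mono-≤ (class-bound true) (class-bound false)) ⟩
        (2 * sL + Δ) + ((2 * s true + 1) + (2 * s false + 1))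
          ≡⟨ lem sL (s true) (s false) Δ ⟩
        2 * (sL + (s true + (s false + 0))) + (Δ + 2) ∎
        where
        open ≤-Reasoning
        lem : ∀ a b c d → (2 * a + d) + ((2 * b + 1) + (2 * c + 1)) ≡ 2 * (a + (b + (c + 0))) + (d + 2)
        lem = solve-∀
      choose : ∃[ y ] y ∈ fam leaf-far ∷ fam (class-far true) ∷ fam (class-far false) ∷ [] ×
                 sL + (s true + (s false + 0)) ≤ 3 * length (proj₁ y) →
               ∃[ gs ] AllPairs Separated gs × 1 ≤ length gs × n ≤ 7 * length gs + (Δ + 1)
      -- If even the largest family is empty, then n ≤ Δ + 2 and a single gadget suffices.
      choose (([] , _) , _ , le) = some-gadget ∷ [] , [] ∷ [] , s≤s z≤n , (begin
        n                                              ≤⟨ total ⟩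
        2 * (sL + (s true + (s false + 0))) + (Δ + 2)  ≤⟨ +-monoˡ-≤ (Δ + 2) (*-monoʳ-≤ 2 le) ⟩
        0 + (Δ + 2)                                    ≡⟨ lem Δ ⟩
        1 + (Δ + 1)                                    ≤⟨ +-monoˡ-≤ (Δ + 1) (m≤m+n 1 6) ⟩
        7 + (Δ + 1)                                    ∎)
        where
        open ≤-Reasoning
        lem : ∀ d → d + 2 ≡ 1 + (d + 1)
        lem = solve-∀
      choose ((gs@(_ ∷ gs′) , sep) , _ , le) = gs , sep , s≤s z≤n , (begin
        n                                              ≤⟨ total ⟩
        2 * (sL + (s true + (s false + 0))) + (Δ + 2)  ≤⟨ +-monoˡ-≤ (Δ + 2) (*-monoʳ-≤ 2 le) ⟩
        2 * (3 * length gs) + (Δ + 2)                  ≡⟨ lem (length gs) Δ ⟩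
        6 * length gs + (1 + (Δ + 1))                  ≤⟨ +-monoʳ-≤ (6 * length gs) (+-monoˡ-≤ (Δ + 1) (m≤m+n 1 (length gs′))) ⟩
        6 * length gs + (length gs + (Δ + 1))          ≡⟨ lem₂ (length gs) (Δ + 1) ⟩
        7 * length gs + (Δ + 1)                        ∎)
        where
        open ≤-Reasoning
        lem : ∀ l d → 2 * (3 * l) + (d + 2) ≡ 6 * l + (1 + (d + 1))
        lem = solve-∀
        lem₂ : ∀ l d → 6 * l + (l + d) ≡ 7 * l + d
        lem₂ = solve-∀

-- Colour classes and copies

∑-cartesianProduct : {A B : Set} (xs : List A) (ys : List B) (h : A × B → ℕ) →
                     ∑ (cartesianProduct xs ys) h ≡ ∑ xs (λ x → ∑ ys (λ y → h (x , y)))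
∑-cartesianProduct []       ys h = refl
∑-cartesianProduct (x ∷ xs) ys h = trans (∑-++ (map (x ,_) ys) _ h)
  (cong₂ _+_ (∑-map ys (x ,_) h) (∑-cartesianProduct xs ys h))

length-filter-mapMaybe : {A B : Set} {P : B → Set} (P? : Decidable P) (h : A → Maybe B) (xs : List A) →
  length (filter P? (mapMaybe h xs)) ≡ ∑ xs (λ x → maybe′ (𝟙 ∘ P?) 0 (h x))
length-filter-mapMaybe P? h []       = refl
length-filter-mapMaybe P? h (x ∷ xs) with h x
... | nothing = length-filter-mapMaybe P? h xs
... | just y with P? y
...   | yes _ = cong suc (length-filter-mapMaybe P? h xs)
...   | no _  = length-filter-mapMaybe P? h xs

module _ {n} (G : Graph n) (h : Edge G → ℕ) {y z : Fin n} where
  open Graph G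

  edge?-adjacent : (y<z : y Fin.< z) (y~z : y ~ z) → maybe′ h 0 (edge? G (y , z)) ≡ h (edge y z y<z y~z)
  edge?-adjacent y<z y~z with y Fin.<? z | y ~? z
  ... | yes _  | yes _  = refl
  ... | yes _  | no y≁z = contradiction y~z y≁z
  ... | no y≮z | _      = contradiction y<z y≮z

  edge?-nonadjacent : ¬ y ~ z → maybe′ h 0 (edge? G (y , z)) ≡ 0
  edge?-nonadjacent y≁z with y Fin.<? z | y ~? z
  ... | yes _ | yes y~z = contradiction y~z y≁z
  ... | yes _ | no _    = refl
  ... | no _  | _       = refl

  edge?-unordered : ¬ y Fin.< z → maybe′ h 0 (edge? G (y , z)) ≡ 0
  edge?-unordered y≮z with y Fin.<? z | y ~? z
  ... | yes y<z | _ = contradiction y<z y≮z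
  ... | no _    | _ = refl

perm-inverse : ∀ {n} {π : Vec (Fin n) n} → π ∈ perms n → ∀ y → ∃[ x ] lookup π x ≡ y
perm-inverse {n} {π} π∈ y
  with x , _ , eq ← ∈-map⁻ (lookup π) (Unique-full⇒∈ (Unique.map⁺ (λ {a} {b} → ∈-perms⁻ π∈ a b) (allFin⁺ n))
    (≤-reflexive (sym (trans (length-map (lookup π) (allFin n)) (length-tabulate {n = n} id)))) y) = x , sym eq

module ColourClass {n r} (χ : Colouring (K n) r) where

  colourOf : ∀ x y → x Fin.< y → Fin r
  colourOf x y x<y = χ (edge x y x<y (Fin.<⇒≢ x<y))

  class : Fin r → Fin n → Fin n → ℕ
  class i x y with Fin.<-cmp x y
  ... | tri< x<y _ _ = 𝟙 (colourOf x y x<y ≟ i)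
  ... | tri≈ _ _ _   = 0
  ... | tri> _ _ y<x = 𝟙 (colourOf y x y<x ≟ i)

  class-< : ∀ i {x y} (x<y : x Fin.< y) → class i x y ≡ 𝟙 (colourOf x y x<y ≟ i)
  class-< i {x} {y} x<y with Fin.<-cmp x y
  ... | tri< _ _ _   = refl
  ... | tri≈ x≮y _ _ = contradiction x<y x≮y
  ... | tri> x≮y _ _ = contradiction x<y x≮y

  class-> : ∀ i {x y} (y<x : y Fin.< x) → class i x y ≡ 𝟙 (colourOf y x y<x ≟ i)
  class-> i {x} {y} y<x with Fin.<-cmp x y
  ... | tri< _ _ y≮x = contradiction y<x y≮x
  ... | tri≈ _ _ y≮x = contradiction y<x y≮x
  ... | tri> _ _ _   = refl

  class-isAdjacency : ∀ i → IsAdjacency (class i)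
  class-isAdjacency i = record { bit = bit ; symm = symm ; diag = diag }
    where
    bit : ∀ x y → IsBit (class i x y)
    bit x y with Fin.<-cmp x y
    ... | tri< x<y _ _ = 𝟙-bit (colourOf x y x<y ≟ i)
    ... | tri≈ _ _ _   = inj₁ refl
    ... | tri> _ _ y<x = 𝟙-bit (colourOf y x y<x ≟ i)
    diag : ∀ x → class i x x ≡ 0
    diag x with Fin.<-cmp x x
    ... | tri< _ x≢x _ = contradiction refl x≢x
    ... | tri≈ _ _ _   = refl
    ... | tri> _ x≢x _ = contradiction refl x≢x
    symm : ∀ x y → class i x y ≡ class i y x
    symm x y with Fin.<-cmp x y
    ... | tri< x<y _ _  = sym (class-> i x<y)
    ... | tri≈ _ refl _ = sym (diag x)
    ... | tri> _ _ y<x  = sym (class-< i y<x)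

  ∑-class : ∀ x y → ∑ᶠ (λ i → class i x y) + 𝟙 (x ≟ y) ≡ 1
  ∑-class x y with Fin.<-cmp x y
  ... | tri< x<y x≢y _ = cong₂ _+_ (∑ᶠ-𝟙-1 (colourOf x y x<y)) (𝟙-no (x ≟ y) x≢y)
  ... | tri≈ _ x≡y _   = cong₂ _+_ (∑-zero (allFin r)) (𝟙-yes (x ≟ y) x≡y)
  ... | tri> _ x≢y y<x = cong₂ _+_ (∑ᶠ-𝟙-1 (colourOf y x y<x)) (𝟙-no (x ≟ y) x≢y)

  ∑-size : ∑ᶠ (λ i → size (class i)) + n ≡ n * n
  ∑-size = begin
    ∑ᶠ (λ i → size (class i)) + n
      ≡⟨ cong₂ _+_ (trans (∑-swap (allFin r) (allFin n) _) (∑-cong (allFin n) (λ x → ∑-swap (allFin r) (allFin n) (λ i y → class i x y))))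
           (sym (∑ᶠ-1 n)) ⟩
    ∑ᶠ (λ x → ∑ᶠ (λ y → ∑ᶠ (λ i → class i x y))) + ∑ᶠ {n} (λ _ → 1)
      ≡⟨ ∑-+ (allFin n) _ _ ⟨
    ∑ᶠ (λ x → ∑ᶠ (λ y → ∑ᶠ (λ i → class i x y)) + 1)
      ≡⟨ ∑-cong (allFin n) row ⟩
    ∑ᶠ {n} (λ _ → n)
      ≡⟨ ∑ᶠ-const {n} n ⟩
    n * n ∎
    where
    open ≡-Reasoning
    row : ∀ x → ∑ᶠ (λ y → ∑ᶠ (λ i → class i x y)) + 1 ≡ n
    row x = begin
      ∑ᶠ (λ y → ∑ᶠ (λ i → class i x y)) + 1
        ≡⟨ cong (∑ᶠ (λ y → ∑ᶠ (λ i → class i x y)) +_) (∑ᶠ-𝟙-1 x) ⟨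
      ∑ᶠ (λ y → ∑ᶠ (λ i → class i x y)) + ∑ᶠ (λ y → 𝟙 (x ≟ y))
        ≡⟨ ∑-+ (allFin n) _ _ ⟨
      ∑ᶠ (λ y → ∑ᶠ (λ i → class i x y) + 𝟙 (x ≟ y))
        ≡⟨ ∑-cong (allFin n) (∑-class x) ⟩
      ∑ᶠ {n} (λ _ → 1)
        ≡⟨ ∑ᶠ-1 n ⟩
      n ∎

  module Copy (T : Graph n) {π : Vec (Fin n) n} (π∈ : π ∈ perms n) where
    private module T = Graph T

    ρ : Fin n → Fin n
    ρ y = proj₁ (perm-inverse π∈ y)

    π∘ρ : ∀ y → lookup π (ρ y) ≡ y
    π∘ρ y = proj₂ (perm-inverse π∈ y)

    ρ∘π : ∀ x → ρ (lookup π x) ≡ x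
    ρ∘π x = ∈-perms⁻ π∈ _ _ (π∘ρ (lookup π x))

    copy : Subgraph (K n)
    copy = record
      { vertices = ⊤
      ; graph = record
        { _~_ = λ y z → ρ y T.~ ρ z ; _~?_ = λ y z → ρ y T.~? ρ z
        ; ~-sym = T.~-sym ; ~-irrefl = λ y≡z → T.~-irrefl (cong ρ y≡z) }
      ; ~⇒∈ = λ _ → ∈⊤
      ; ~⇒~ = λ ρy~ρz y≡z → T.~-irrefl (cong ρ y≡z) ρy~ρz }

    T≅copy : T ≅ copy
    T≅copy = record
      { bijection = mk↔ₛ′ (λ x → lookup π x , ∈⊤) (ρ ∘ proj₁) (λ { (y , _) → pair-≡ (π∘ρ y) }) ρ∘π
      ; ~⇔~ = λ u v → mk⇔ (subst₂ T._~_ (sym (ρ∘π u)) (sym (ρ∘π v))) (subst₂ T._~_ (ρ∘π u) (ρ∘π v)) }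
      where
      pair-≡ : ∀ {x y} {p : x Data.Fin.Subset.∈ ⊤} {q : y Data.Fin.Subset.∈ ⊤} → x ≡ y →
               _≡_ {A = ∃[ z ] z Data.Fin.Subset.∈ ⊤} (x , p) (y , q)
      pair-≡ refl = cong (_ ,_) ([]=-irrelevant _ _)

    module _ (i : Fin r) where

      listed : Fin n → Fin n → ℕ
      listed y z = maybe′ (λ e → 𝟙 (χ (include copy e) ≟ i)) 0 (edge? (Subgraph.graph copy) (y , z))

      listed-< : ∀ {y z} (y<z : y Fin.< z) → listed y z ≡ 𝟙 (ρ y T.~? ρ z) * 𝟙 (colourOf y z y<z ≟ i)
      listed-< {y} {z} y<z = lem (ρ y T.~? ρ z)
        where
        lem : (d : Dec (ρ y T.~ ρ z)) → listed y z ≡ 𝟙 d * 𝟙 (colourOf y z y<z ≟ i)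
        lem (yes y~z) = trans (edge?-adjacent (Subgraph.graph copy) _ y<z y~z) (sym (+-identityʳ _))
        lem (no y≁z)  = edge?-nonadjacent (Subgraph.graph copy) _ y≁z

      listed-≮ : ∀ {y z} → ¬ y Fin.< z → listed y z ≡ 0
      listed-≮ = edge?-unordered (Subgraph.graph copy) _

      module Sw = Switching T (class i) (IsAdjacency.symm (class-isAdjacency i)) (IsAdjacency.diag (class-isAdjacency i))

      -- An edge is listed at its increasing pair only; adding the transposed pair recovers the
      -- symmetric matrix.
      both-orders : ∀ y z → listed y z + listed z y ≡ Sw.t (ρ y) (ρ z) * class i y z
      both-orders y z = by (Fin.<-cmp y z)
        where
        by : Tri (y Fin.< z) (y ≡ z) (z Fin.< y) → listed y z + listed z y ≡ Sw.t (ρ y) (ρ z) * class i y z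
        by (tri< y<z _ z≮y)  = trans (cong₂ _+_ (listed-< y<z) (listed-≮ z≮y))
          (trans (+-identityʳ _) (cong (Sw.t (ρ y) (ρ z) *_) (sym (class-< i y<z))))
        by (tri≈ y≮z refl _) = trans (cong₂ _+_ (listed-≮ y≮z) (listed-≮ y≮z))
          (sym (trans (cong (Sw.t (ρ y) (ρ y) *_) (IsAdjacency.diag (class-isAdjacency i) y)) (*-zeroʳ (Sw.t (ρ y) (ρ y)))))
        by (tri> y≮z _ z<y)  = trans (cong₂ _+_ (listed-≮ y≮z) (listed-< z<y))
          (cong₂ _*_ (Sw.t-sym (ρ z) (ρ y)) (sym (class-> i z<y)))

      2*colourCount : 2 * colourCount χ i copy ≡ Sw.weight π
      2*colourCount = begin
        2 * colourCount χ i copy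
          ≡⟨ cong (2 *_) (trans (length-filter-mapMaybe (λ e → χ (include copy e) ≟ i) (edge? (Subgraph.graph copy)) (cartesianProduct (allFin n) (allFin n)))
               (∑-cartesianProduct (allFin n) (allFin n) _)) ⟩
        2 * L
          ≡⟨ cong (L +_) (+-identityʳ L) ⟩
        L + L
          ≡⟨ cong (L +_) (∑-swap (allFin n) (allFin n) listed) ⟩
        L + ∑ᶠ (λ y → ∑ᶠ (λ z → listed z y))
          ≡⟨ trans (∑-cong (allFin n) (λ y → ∑-+ (allFin n) _ _)) (∑-+ (allFin n) _ _) ⟨
        ∑ᶠ (λ y → ∑ᶠ (λ z → listed y z + listed z y))
          ≡⟨ ∑-cong (allFin n) (λ y → ∑-cong (allFin n) (both-orders y)) ⟩
        ∑ᶠ (λ y → ∑ᶠ (λ z → Sw.t (ρ y) (ρ z) * class i y z))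
          ≡⟨ ∑²-reindex π∈ (λ y z → Sw.t (ρ y) (ρ z) * class i y z) ⟨
        ∑ᶠ (λ a → ∑ᶠ (λ b → Sw.t (ρ (lookup π a)) (ρ (lookup π b)) * class i (lookup π a) (lookup π b)))
          ≡⟨ ∑-cong (allFin n) (λ a → ∑-cong (allFin n) (λ b → cong₂ (λ u v → Sw.t u v * class i (lookup π a) (lookup π b)) (ρ∘π a) (ρ∘π b))) ⟩
        Sw.weight π ∎
        where
        open ≡-Reasoning
        L : ℕ
        L = ∑ᶠ (λ y → ∑ᶠ (listed y))

-- The theorem

-- Imported only here because +_ would make the sections (x +_) ambiguous.
open import Data.Integer.Base as ℤ using (+_; 1ℤ)
import Data.Integer.Properties as ℤ
import Data.Integer.Tactic.RingSolver as ℤ-Solver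
open import Data.Rational.Base as ℚ using (ℚ; 0ℚ; _/_)
import Data.Rational.Properties as ℚ
open import Data.Rational.Unnormalised.Base as ℚᵘ using (mkℚᵘ; *≤*)
import Data.Rational.Unnormalised.Properties as ℚᵘ

∈⇒≤foldr-⊔ : ∀ {x xs} → x ∈ xs → x ≤ foldr _⊔_ 0 xs
∈⇒≤foldr-⊔ {xs = y ∷ xs} (here refl) = m≤m⊔n y (foldr _⊔_ 0 xs)
∈⇒≤foldr-⊔ {xs = y ∷ xs} (there x∈)  = ≤-trans (∈⇒≤foldr-⊔ x∈) (m≤n⊔m y (foldr _⊔_ 0 xs))

degree≤maxDegree : ∀ {n} (T : Graph n) z → degree T z ≤ maxDegree T
degree≤maxDegree T z = ∈⇒≤foldr-⊔ (∈-map⁺ (degree T) (∈-allFin z))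

-- C = 7 · 2 · 1600, with 7 from large-family and 1600 from variation-large; the 2 is
-- there because weight counts every edge twice.  Abstract, so that the numeral is
-- never unfolded.
abstract
  C : ℕ
  C = 22400

  C≡7*3200 : C ≡ 7 * 3200
  C≡7*3200 = refl

  20≤C : 20 ≤ C
  20≤C = m≤m+n 20 22380

  instance
    C≢0 : NonZero C
    C≢0 = _

-- The target inequality multiplied by c r², with n − 1 − Δ moved so that no subtraction occurs.
Target : (c r n Δ M : ℕ) → Set
Target c r n Δ M = c * (r * n) + n ≤ c * (r * (r * M)) + c * r + (Δ + 1)

-- From the counts to the target inequality

module Numbers {n r A V M s : ℕ} (1≤n : 1 ≤ n) (2≤r : 2 ≤ r) (nn≤ : n * n ≤ r * A + n)
  (main : 2 * (n * (n * (n * A))) + s * V ≤ n * (n * (n * (n * (2 * M))))) where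
  open ≤-Reasoning

  private
    instance
      n≢0 : NonZero n
      n≢0 = >-nonZero 1≤n
      r≢0 : NonZero r
      r≢0 = >-nonZero (≤-trans (s≤s z≤n) 2≤r)

  -- Without the gain, `main` is the plain average M ≥ A/n.
  A≤nM : A ≤ n * M
  A≤nM = *-cancelˡ-≤ 2 (*-cancelˡ-≤ n (*-cancelˡ-≤ n (*-cancelˡ-≤ n (begin
    n * (n * (n * (2 * A)))          ≡⟨ lem₁ n A ⟩
    2 * (n * (n * (n * A)))          ≤⟨ m≤m+n _ (s * V) ⟩
    2 * (n * (n * (n * A))) + s * V  ≤⟨ main ⟩
    n * (n * (n * (n * (2 * M))))    ≡⟨ lem₂ n M ⟩
    n * (n * (n * (2 * (n * M))))    ∎))))
    where
    lem₁ : ∀ n A → n * (n * (n * (2 * A))) ≡ 2 * (n * (n * (n * A)))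
    lem₁ = solve-∀
    lem₂ : ∀ n M → n * (n * (n * (n * (2 * M)))) ≡ n * (n * (n * (2 * (n * M))))
    lem₂ = solve-∀

  n≤rM+1 : n ≤ r * M + 1
  n≤rM+1 = *-cancelˡ-≤ n (begin
    n * n             ≤⟨ nn≤ ⟩
    r * A + n         ≤⟨ +-monoˡ-≤ n (*-monoʳ-≤ r A≤nM) ⟩
    r * (n * M) + n   ≡⟨ lem n r M ⟩
    n * (r * M + 1)   ∎)
    where
    lem : ∀ n r M → r * (n * M) + n ≡ n * (r * M + 1)
    lem = solve-∀

  near-star : ∀ {Δ} → n ≤ Δ + 1 → Target C r n Δ M
  near-star {Δ} n≤Δ+1 = +-mono-≤ (begin
    C * (r * n)                    ≤⟨ *-monoʳ-≤ C (*-monoʳ-≤ r n≤rM+1) ⟩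
    C * (r * (r * M + 1))          ≡⟨ lem C r (r * M) ⟩
    C * (r * (r * M)) + C * r      ∎) n≤Δ+1
    where
    lem : ∀ c r k → c * (r * (k + 1)) ≡ c * (r * k) + c * r
    lem = solve-∀

  -- Here 5M ≥ 3 (n - 1), so rM ≥ 6 (n - 1)/5 for r ≥ 2. The surplus of one fifth pays for the gain
  -- because 5 ≤ C r.
  dense : ∀ {Δ} → 3 * (n * n) ≤ 5 * A + 3 * n → Target C r n Δ M
  dense {Δ} 3nn≤ = begin
    C * (r * n) + n                            ≡⟨ cong (λ m → C * (r * m) + m) n≡1+k ⟩
    C * (r * (1 + k)) + (1 + k)                ≡⟨ lem₁ C r k ⟩
    (C * r + 1) * k + C * r + 1                ≤⟨ +-mono-≤ (+-monoˡ-≤ (C * r) scaled) (m≤n+m 1 Δ) ⟩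
    C * (r * (r * M)) + C * r + (Δ + 1)        ∎
    where
    lem₁ : ∀ c r k → c * (r * (1 + k)) + (1 + k) ≡ (c * r + 1) * k + c * r + 1
    lem₁ = solve-∀
    k = n ∸ 1
    n≡1+k : n ≡ 1 + k
    n≡1+k = sym (m+[n∸m]≡n 1≤n)
    3k≤5M : 3 * k ≤ 5 * M
    3k≤5M = +-cancelʳ-≤ 3 _ _ (*-cancelˡ-≤ n (begin
      n * (3 * k + 3)     ≡⟨ cong (n *_) (trans (lem k) (cong (3 *_) (sym n≡1+k))) ⟩
      n * (3 * n)         ≡⟨ lem′ n ⟩
      3 * (n * n)         ≤⟨ 3nn≤ ⟩
      5 * A + 3 * n       ≤⟨ +-monoˡ-≤ (3 * n) (*-monoʳ-≤ 5 A≤nM) ⟩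
      5 * (n * M) + 3 * n ≡⟨ lem″ n M ⟩
      n * (5 * M + 3)     ∎))
      where
      lem : ∀ k → 3 * k + 3 ≡ 3 * (1 + k)
      lem = solve-∀
      lem′ : ∀ n → n * (3 * n) ≡ 3 * (n * n)
      lem′ = solve-∀
      lem″ : ∀ n M → 5 * (n * M) + 3 * n ≡ n * (5 * M + 3)
      lem″ = solve-∀
    scaled : (C * r + 1) * k ≤ C * (r * (r * M))
    scaled = *-cancelˡ-≤ 5 (begin
      5 * ((C * r + 1) * k)          ≡⟨ lem₂ (C * r) k ⟩
      (5 * (C * r) + 5 * 1) * k      ≤⟨ *-monoˡ-≤ k (+-monoʳ-≤ (5 * (C * r)) (*-mono-≤ {5} {C} (≤-trans (m≤m+n 5 15) 20≤C) (≤-trans (s≤s z≤n) 2≤r))) ⟩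
      (5 * (C * r) + C * r) * k      ≡⟨ lem₃ (C * r) k ⟩
      C * r * (2 * (3 * k))          ≤⟨ *-monoʳ-≤ (C * r) (*-mono-≤ 2≤r 3k≤5M) ⟩
      C * r * (r * (5 * M))          ≡⟨ lem₄ C r M ⟩
      5 * (C * (r * (r * M)))        ∎)
      where
      lem₂ : ∀ c k → 5 * ((c + 1) * k) ≡ (5 * c + 5 * 1) * k
      lem₂ = solve-∀
      lem₃ : ∀ c k → (5 * c + c) * k ≡ c * (2 * (3 * k))
      lem₃ = solve-∀
      lem₄ : ∀ c r M → c * r * (r * (5 * M)) ≡ 5 * (c * (r * (r * M)))
      lem₄ = solve-∀

  -- In edges, each gadget is worth V/(2n⁴) ≥ 1/(3200 r²), and there are at least (n - 1 - Δ)/7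
  -- gadgets.
  large : ∀ {Δ} → n * (n * (n * n)) ≤ 1600 * (r * (r * V)) → n ≤ 7 * s + (Δ + 1) → Target C r n Δ M
  large {Δ} n⁴≤ n≤ = subst (λ c → Target c r n Δ M) (sym C≡7*3200) (begin
    7 * 3200 * (r * n) + n                       ≤⟨ +-monoʳ-≤ (7 * 3200 * (r * n)) n≤ ⟩
    7 * 3200 * (r * n) + (7 * s + (Δ + 1))              ≡⟨ lem₁ 3200 (r * n) s (Δ + 1) ⟩
    7 * (3200 * (r * n) + s) + (Δ + 1)           ≤⟨ +-monoˡ-≤ (Δ + 1) (*-monoʳ-≤ 7 per-gadget) ⟩
    7 * (3200 * (r * (r * M)) + 3200 * r) + (Δ + 1) ≡⟨ lem₂ 3200 (r * (r * M)) r (Δ + 1) ⟩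
    7 * 3200 * (r * (r * M)) + 7 * 3200 * r + (Δ + 1) ∎)
    where
    lem₁ : ∀ c k s d → 7 * c * k + (7 * s + d) ≡ 7 * (c * k + s) + d
    lem₁ = solve-∀
    lem₂ : ∀ c k r d → 7 * (c * k + c * r) + d ≡ 7 * c * k + 7 * c * r + d
    lem₂ = solve-∀
    per-gadget : 3200 * (r * n) + s ≤ 3200 * (r * (r * M)) + 3200 * r
    per-gadget = *-cancelˡ-≤ n (*-cancelˡ-≤ n (*-cancelˡ-≤ n (*-cancelˡ-≤ n (begin
      n * (n * (n * (n * (3200 * (r * n) + s))))
        ≡⟨ lem₃ 3200 r n s ⟩
      3200 * (r * (n * (n * (n * (n * n))))) + s * (n * (n * (n * n)))
        ≤⟨ +-mono-≤ (*-monoʳ-≤ 3200 (*-monoʳ-≤ r (*-monoʳ-≤ n (*-monoʳ-≤ n (*-monoʳ-≤ n nn≤))))) (*-monoʳ-≤ s n⁴≤) ⟩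
      3200 * (r * (n * (n * (n * (r * A + n))))) + s * (1600 * (r * (r * V)))
        ≡⟨ lem₄ 1600 r n A s V ⟩
      1600 * (r * (r * (2 * (n * (n * (n * A))) + s * V))) + n * (n * (n * (n * (3200 * r))))
        ≤⟨ +-monoˡ-≤ _ (*-monoʳ-≤ 1600 (*-monoʳ-≤ r (*-monoʳ-≤ r main))) ⟩
      1600 * (r * (r * (n * (n * (n * (n * (2 * M))))))) + n * (n * (n * (n * (3200 * r))))
        ≡⟨ lem₅ 1600 r n M ⟩
      n * (n * (n * (n * (3200 * (r * (r * M)) + 3200 * r)))) ∎))))
      where
      lem₃ : ∀ c r n s → n * (n * (n * (n * (c * (r * n) + s)))) ≡ c * (r * (n * (n * (n * (n * n))))) + s * (n * (n * (n * n)))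
      lem₃ = solve-∀
      lem₄ : ∀ c r n A s V → 2 * c * (r * (n * (n * (n * (r * A + n))))) + s * (c * (r * (r * V))) ≡
             c * (r * (r * (2 * (n * (n * (n * A))) + s * V))) + n * (n * (n * (n * (2 * c * r))))
      lem₄ = solve-∀
      lem₅ : ∀ c r n M → c * (r * (r * (n * (n * (n * (n * (2 * M))))))) + n * (n * (n * (n * (2 * c * r)))) ≡
             n * (n * (n * (n * (2 * c * (r * (r * M)) + 2 * c * r))))
      lem₅ = solve-∀

  -- One unit of rM above n - 1 is worth 1/r in M, while the required gain is at most n/(C r²) ≤
  -- 20/(C r).
  small : ∀ {Δ} → n ≤ 20 * r → n ≤ r * M → Target C r n Δ M
  small {Δ} n≤20r n≤rM = ≤-trans
    (+-mono-≤ (*-monoʳ-≤ C (*-monoʳ-≤ r n≤rM)) (≤-trans n≤20r (*-monoˡ-≤ r 20≤C)))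
    (m≤m+n _ (Δ + 1))

  module Tight (1≤s : 1 ≤ s) (2≤n : 2 ≤ n) (rM<n : r * M < n) where

    -- M attains the average (n - 1)/r exactly. This leaves no room in either inequality: A = nM
    -- follows, and with s ≥ 1 also V = 0.
    n≡rM+1 : n ≡ r * M + 1
    n≡rM+1 = ≤-antisym n≤rM+1 (≤-trans (≤-reflexive (+-comm (r * M) 1)) rM<n)

    A≡nM : A ≡ n * M
    A≡nM = ≤-antisym A≤nM (*-cancelˡ-≤ r (+-cancelʳ-≤ n _ _ (begin
      r * (n * M) + n  ≡⟨ lem r n M ⟩
      n * (r * M + 1)  ≡⟨ cong (n *_) n≡rM+1 ⟨
      n * n            ≤⟨ nn≤ ⟩
      r * A + n        ∎)))
      where
      lem : ∀ r n M → r * (n * M) + n ≡ n * (r * M + 1)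
      lem = solve-∀

    V≡0 : V ≡ 0
    V≡0 = n≤0⇒n≡0 (*-cancelˡ-≤ s {{>-nonZero 1≤s}} (≤-trans (+-cancelˡ-≤ (2 * (n * (n * (n * A)))) (s * V) 0 (begin
      2 * (n * (n * (n * A))) + s * V   ≤⟨ main ⟩
      n * (n * (n * (n * (2 * M))))     ≡⟨ lem n M ⟩
      2 * (n * (n * (n * (n * M))))     ≡⟨ cong (λ a → 2 * (n * (n * (n * a)))) A≡nM ⟨
      2 * (n * (n * (n * A)))           ≡⟨ +-identityʳ _ ⟨
      2 * (n * (n * (n * A))) + 0       ∎)) z≤n))
      where
      lem : ∀ n M → n * (n * (n * (n * (2 * M)))) ≡ 2 * (n * (n * (n * (n * M))))
      lem = solve-∀

    1≤M : 1 ≤ M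
    1≤M = n≢0⇒n>0 λ M≡0 → <⇒≱ 2≤n (≤-reflexive (trans n≡rM+1 (cong (_+ 1) (trans (cong (r *_) M≡0) (*-zeroʳ r)))))

    2M≤rM : 2 * M ≤ r * M
    2M≤rM = *-monoˡ-≤ M 2≤r

    3≤n : 3 ≤ n
    3≤n = begin
      2 * 1 + 1   ≤⟨ +-monoˡ-≤ 1 (*-mono-≤ 2≤r 1≤M) ⟩
      r * M + 1   ≡⟨ n≡rM+1 ⟨
      n           ∎

    0<A : 0 < A
    0<A = subst (0 <_) (sym A≡nM) (*-mono-≤ 1≤n 1≤M)

    -- An empty complement would mean M = n - 1, contradicting rM = n - 1 with r ≥ 2 and M ≥ 1.
    0<complement : ∀ B → (A + B) + n ≡ n * n → 0 < B
    0<complement zero    eq = contradiction (*-cancelˡ-≡ (M + 1) n n (begin-equality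
      n * (M + 1)   ≡⟨ lem n M ⟩
      n * M + 0 + n ≡⟨ cong (λ a → a + 0 + n) A≡nM ⟨
      A + 0 + n     ≡⟨ eq ⟩
      n * n         ∎)) (<⇒≢ (begin-strict
      M + 1         <⟨ +-monoˡ-< 1 (≤-trans (+-monoˡ-≤ M 1≤M) (≤-reflexive (cong (λ k → M + k) (sym (+-identityʳ M))))) ⟩
      2 * M + 1     ≤⟨ +-monoˡ-≤ 1 2M≤rM ⟩
      r * M + 1     ≡⟨ n≡rM+1 ⟨
      n             ∎))
      where
      lem : ∀ n M → n * (M + 1) ≡ n * M + 0 + n
      lem = solve-∀
    0<complement (suc B) eq = z<s

-- Passage to the rational bound

toℚᵘ-/ : ∀ i d → ℚ.toℚᵘ (i / suc d) ℚᵘ.≃ mkℚᵘ i d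
toℚᵘ-/ i d = ℚ.toℚᵘ-fromℚᵘ (mkℚᵘ i d)

-- Unnormalised fractions keep their denominators, so the claim is an integer inequality by
-- cross-multiplication: `Target` with the subtractions restored, times r.
bound≤ : ∀ c .{{_ : NonZero c}} r .{{_ : NonZero r}} n Δ M → Target c r n Δ M → bound (1ℤ / c) r n Δ ℚ.≤ + M / 1
bound≤ c@(suc c′) r@(suc r′) n Δ M target = ℚ.toℚᵘ-cancel-≤ (ℚᵘ.≤-respˡ-≃ (ℚᵘ.≃-sym unnormalised) (ℚᵘ.≤-respʳ-≃ (ℚᵘ.≃-sym (toℚᵘ-/ (+ M) 0)) (*≤* main)))
  where
  instance _ = m^n≢0 r 2
  R′ = pred (r ^ 2)
  X = + n ℤ.- 1ℤ
  Y = + n ℤ.- 1ℤ ℤ.- + Δ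
  unnormalised : ℚ.toℚᵘ (bound (1ℤ / c) r n Δ) ℚᵘ.≃ mkℚᵘ X r′ ℚᵘ.+ mkℚᵘ 1ℤ c′ ℚᵘ.* mkℚᵘ 1ℤ R′ ℚᵘ.* mkℚᵘ Y 0
  unnormalised = ℚᵘ.≃-trans (ℚ.toℚᵘ-homo-+ (X / r) (1ℤ / c ℚ.* (1ℤ / (r ^ 2)) ℚ.* (Y / 1))) (ℚᵘ.+-cong (toℚᵘ-/ X r′)
    (ℚᵘ.≃-trans (ℚ.toℚᵘ-homo-* (1ℤ / c ℚ.* (1ℤ / (r ^ 2))) (Y / 1)) (ℚᵘ.*-cong
      (ℚᵘ.≃-trans (ℚ.toℚᵘ-homo-* (1ℤ / c) (1ℤ / (r ^ 2))) (ℚᵘ.*-cong (toℚᵘ-/ 1ℤ c′) (toℚᵘ-/ 1ℤ R′)))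
      (toℚᵘ-/ Y 0))))
  scaled : + c ℤ.* (+ r ℤ.* X) ℤ.+ Y ℤ.≤ + c ℤ.* (+ r ℤ.* (+ r ℤ.* + M)) →
           (X ℤ.* + (c * (r ^ 2) * 1) ℤ.+ (1ℤ ℤ.* 1ℤ ℤ.* Y) ℤ.* + r) ℤ.* 1ℤ ℤ.≤ + M ℤ.* + (r * (c * (r ^ 2) * 1))
  scaled le = begin
    (X ℤ.* + (c * (r ^ 2) * 1) ℤ.+ (1ℤ ℤ.* 1ℤ ℤ.* Y) ℤ.* + r) ℤ.* 1ℤ   ≡⟨ cong (λ q → (X ℤ.* q ℤ.+ (1ℤ ℤ.* 1ℤ ℤ.* Y) ℤ.* + r) ℤ.* 1ℤ) crr ⟩
    (X ℤ.* q ℤ.+ (1ℤ ℤ.* 1ℤ ℤ.* Y) ℤ.* + r) ℤ.* 1ℤ                     ≡⟨ lem₁ (+ c) (+ r) X Y ⟩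
    + r ℤ.* (+ c ℤ.* (+ r ℤ.* X) ℤ.+ Y)                                ≤⟨ ℤ.*-monoˡ-≤-nonNeg (+ r) le ⟩
    + r ℤ.* (+ c ℤ.* (+ r ℤ.* (+ r ℤ.* + M)))                          ≡⟨ lem₂ (+ c) (+ r) (+ M) ⟩
    + M ℤ.* (+ r ℤ.* q)                                                ≡⟨ cong (λ q → + M ℤ.* (+ r ℤ.* q)) crr ⟨
    + M ℤ.* (+ r ℤ.* + (c * (r ^ 2) * 1))                              ≡⟨ cong (+ M ℤ.*_) (ℤ.pos-* r _) ⟨
    + M ℤ.* + (r * (c * (r ^ 2) * 1))                                  ∎
    where
    open ℤ.≤-Reasoning
    q = + c ℤ.* (+ r ℤ.* + r)
    crr : + (c * (r ^ 2) * 1) ≡ q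
    crr = trans (cong +_ (lem c r)) (trans (ℤ.pos-* c (r * r)) (cong (+ c ℤ.*_) (ℤ.pos-* r r)))
      where
      lem : ∀ c r → c * (r * (r * 1)) * 1 ≡ c * (r * r)
      lem = solve-∀
    lem₁ : ∀ c r X Y → (X ℤ.* (c ℤ.* (r ℤ.* r)) ℤ.+ (1ℤ ℤ.* 1ℤ ℤ.* Y) ℤ.* r) ℤ.* 1ℤ ≡ r ℤ.* (c ℤ.* (r ℤ.* X) ℤ.+ Y)
    lem₁ = ℤ-Solver.solve-∀
    lem₂ : ∀ c r M → r ℤ.* (c ℤ.* (r ℤ.* (r ℤ.* M))) ≡ M ℤ.* (r ℤ.* (c ℤ.* (r ℤ.* r)))
    lem₂ = ℤ-Solver.solve-∀
  shifted : c * (r * n) + n ≤ c * (r * (r * M)) + c * r + (Δ + 1) →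
            + c ℤ.* (+ r ℤ.* X) ℤ.+ Y ℤ.≤ + c ℤ.* (+ r ℤ.* (+ r ℤ.* + M))
  shifted le = begin
    + c ℤ.* (+ r ℤ.* X) ℤ.+ Y
      ≡⟨ lem₁ (+ c) (+ r) (+ n) (+ Δ) ⟩
    (+ c ℤ.* (+ r ℤ.* + n) ℤ.+ + n) ℤ.+ ℤ.- (+ c ℤ.* + r ℤ.+ (+ Δ ℤ.+ 1ℤ))
      ≤⟨ ℤ.+-monoˡ-≤ (ℤ.- (+ c ℤ.* + r ℤ.+ (+ Δ ℤ.+ 1ℤ))) (subst₂ ℤ._≤_ lhs rhs (ℤ.+≤+ le)) ⟩
    (+ c ℤ.* (+ r ℤ.* (+ r ℤ.* + M)) ℤ.+ + c ℤ.* + r ℤ.+ (+ Δ ℤ.+ 1ℤ)) ℤ.+ ℤ.- (+ c ℤ.* + r ℤ.+ (+ Δ ℤ.+ 1ℤ))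
      ≡⟨ lem₂ (+ c ℤ.* (+ r ℤ.* (+ r ℤ.* + M))) (+ c ℤ.* + r) (+ Δ) ⟩
    + c ℤ.* (+ r ℤ.* (+ r ℤ.* + M)) ∎
    where
    open ℤ.≤-Reasoning
    lem₁ : ∀ c r n Δ → c ℤ.* (r ℤ.* (n ℤ.- 1ℤ)) ℤ.+ (n ℤ.- 1ℤ ℤ.- Δ) ≡ (c ℤ.* (r ℤ.* n) ℤ.+ n) ℤ.+ ℤ.- (c ℤ.* r ℤ.+ (Δ ℤ.+ 1ℤ))
    lem₁ = ℤ-Solver.solve-∀
    lem₂ : ∀ a b d → (a ℤ.+ b ℤ.+ (d ℤ.+ 1ℤ)) ℤ.+ ℤ.- (b ℤ.+ (d ℤ.+ 1ℤ)) ≡ a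
    lem₂ = ℤ-Solver.solve-∀
    lhs : + (c * (r * n) + n) ≡ + c ℤ.* (+ r ℤ.* + n) ℤ.+ + n
    lhs = trans (ℤ.pos-+ (c * (r * n)) n) (cong (ℤ._+ + n) (trans (ℤ.pos-* c _) (cong (+ c ℤ.*_) (ℤ.pos-* r n))))
    rhs : + (c * (r * (r * M)) + c * r + (Δ + 1)) ≡ + c ℤ.* (+ r ℤ.* (+ r ℤ.* + M)) ℤ.+ + c ℤ.* + r ℤ.+ (+ Δ ℤ.+ 1ℤ)
    rhs = trans (ℤ.pos-+ (c * (r * (r * M)) + c * r) (Δ + 1)) (cong₂ ℤ._+_
      (trans (ℤ.pos-+ (c * (r * (r * M))) (c * r)) (cong₂ ℤ._+_
        (trans (ℤ.pos-* c _) (cong (+ c ℤ.*_) (trans (ℤ.pos-* r _) (cong (+ r ℤ.*_) (ℤ.pos-* r M)))))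
        (ℤ.pos-* c r)))
      (ℤ.pos-+ Δ 1))
  main : (X ℤ.* + (c * (r ^ 2) * 1) ℤ.+ (1ℤ ℤ.* 1ℤ ℤ.* Y) ℤ.* + r) ℤ.* 1ℤ ℤ.≤ + M ℤ.* + (r * (c * (r ^ 2) * 1))
  main = scaled (shifted target)

abstract
  c₀ : ℚ
  c₀ = 1ℤ / C

  0<c₀ : 0ℚ ℚ.< c₀
  0<c₀ = ℚ.positive⁻¹ c₀

  bound-c₀≤ : ∀ r .{{_ : NonZero r}} n Δ M → Target C r n Δ M → bound c₀ r n Δ ℚ.≤ + M / 1
  bound-c₀≤ = bound≤ C

-- Choice of the colour and of the embedding

module Embedding {r n} (2≤r : 2 ≤ r) (χ : Colouring (K n) r) (T : Graph n) (tree : IsTree T)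
  (Δ : ℕ) (degree≤ : ∀ z → degree T z ≤ Δ) where
  open ColourClass χ
  open IsTree tree
  open Gadgets T
  open Families T

  Σ-edges : ℕ → Set₁
  Σ-edges M = Σ[ i ∈ Fin r ] Σ[ H ∈ Subgraph (K n) ] (T ≅ H) × colourCount χ i H ≡ M

  1≤n : 1 ≤ n
  1≤n = >-nonZero⁻¹ n {{nonEmpty}}

  root : Fin n
  root = Fin.fromℕ< 1≤n

  manyEdges : 2 * n ≤ ∑ᶠ (λ a → ∑ᶠ (λ b → 𝟙 (Graph._~?_ T a b))) + 2
  manyEdges = Acyclic.BipartiteTree.manyEdges (Acyclic.bipartiteTree T acyclic connected root)

  frequent-colour : ∃[ i ] n * n ≤ r * size (class i) + n
  frequent-colour with i , _ , pigeonhole ← ∑-pigeonhole-∈ (∈-allFin {n = r} (Fin.fromℕ< 2≤r)) (size ∘ class) =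
    i , subst (_≤ r * size (class i) + n) ∑-size (+-monoˡ-≤ n
      (≤-trans pigeonhole (≤-reflexive (cong (_* size (class i)) (length-tabulate {n = r} id)))))

  module _ (i : Fin r) (nn≤ : n * n ≤ r * size (class i) + n) where
    private
      F : IsAdjacency (class i)
      F = class-isAdjacency i
    open Switching T (class i) (IsAdjacency.symm F) (IsAdjacency.diag F)

    Rich : ℕ → ℕ → Set
    Rich s M = 2 * (n * (n * (n * size (class i)))) + s * variation (class i) ≤ n * (n * (n * (n * (2 * M))))

    from-gadgets : ∀ gs → AllPairs Separated gs → ∃[ M ] Rich (length gs) M × Σ-edges M
    from-gadgets gs sep = build (good-embedding manyEdges gs sep)
      where
      build : (∃[ π ] π ∈ perms n × 2 * (n * (n * (n * size (class i)))) + length gs * variation (class i) ≤ n * (n * (n * (n * weight π)))) →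
              ∃[ M ] Rich (length gs) M × Σ-edges M
      build (π , π∈ , le) =
        colourCount χ i copy , subst (λ w → _ ≤ n * (n * (n * (n * w)))) (sym (2*colourCount i)) le , i , copy , T≅copy , refl
        where open Copy T π∈

    rich⇒target : ∀ {s M} → 1 ≤ s → Δ + 2 ≤ n → n ≤ 7 * s + (Δ + 1) → Rich s M → Target C r n Δ M
    rich⇒target {s} {M} 1≤s Δ+2≤n n≤ le =
      cases (3 * (n * n) ≤? 5 * size (class i) + 3 * n) (20 * r ≤? n) (n ≤? r * M)
      where
      open Numbers {A = size (class i)} {variation (class i)} {M} {s} 1≤n 2≤r nn≤ le
      cases : Dec (3 * (n * n) ≤ 5 * size (class i) + 3 * n) → Dec (20 * r ≤ n) → Dec (n ≤ r * M) → Target C r n Δ M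
      cases (yes isDense) _ _ = dense isDense
      cases (no sparse) (yes 20r≤n) _ = large
        -- The required 40 ≤ n is 20 r ≤ n with r ≥ 2.
        (Lower.variation-large F (≤-trans (*-monoʳ-≤ 20 2≤r) 20r≤n) (<⇒≤ (≰⇒> sparse)) r 2≤r 20r≤n nn≤) n≤
      cases (no _) (no 20r≰n) (yes n≤rM) = small (<⇒≤ (≰⇒> 20r≰n)) n≤rM
      cases (no _) (no 20r≰n) (no n≰rM) = contradiction V≡0
        (variation≢0 F 3≤n (divides M (trans A≡nM (*-comm n M))) 0<A (0<complement _ (Complement.sizes F)))
        where open Tight 1≤s (≤-trans (m≤n+m 2 Δ) Δ+2≤n) (≰⇒> n≰rM)

    embedding : ∃[ M ] Target C r n Δ M × Σ-edges M
    embedding = cases (Δ + 2 ≤? n)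
      where
      embed : ∀ gs → AllPairs Separated gs → (∀ {M} → Rich (length gs) M → Target C r n Δ M) → ∃[ M ] Target C r n Δ M × Σ-edges M
      embed gs sep target = let M , le , found = from-gadgets gs sep in M , target le , found
      cases : Dec (Δ + 2 ≤ n) → ∃[ M ] Target C r n Δ M × Σ-edges M
      -- With n - 1 - Δ ≤ 0 no gain is asked for, so the empty family will do.
      cases (no Δ+2≰n)  = embed [] [] λ {M} le → Numbers.near-star {A = size (class i)} {variation (class i)} {M} {0} 1≤n 2≤r nn≤ le
        (≤-pred (≤-trans (≰⇒> Δ+2≰n) (≤-reflexive (+-suc Δ 1))))
      cases (yes Δ+2≤n) =
        let gs , sep , 1≤s , n≤ = large-family Δ degree≤ Δ+2≤n connected acyclic root
        in embed gs sep (rich⇒target 1≤s Δ+2≤n n≤)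

theorem1p1 :
    Σ[ c ∈ ℚ ] (0ℚ ℚ.< c) ×
      ((r : ℕ) .{{_ : NonZero r}} → 2 ≤ r →
       (n : ℕ) (χ : Colouring (K n) r) →
       (T : Graph n) → IsTree T →
       (Δ : ℕ) → maxDegree T ≡ Δ →
       Σ[ i ∈ Fin r ] Σ[ H ∈ Subgraph (K n) ]
         (T ≅ H) × (bound c r n Δ ℚ.≤ + colourCount χ i H / 1))
theorem1p1 = c₀ , 0<c₀ , λ r 2≤r n χ T tree Δ maxDegree≡Δ →
  let open Embedding 2≤r χ T tree Δ (λ z → subst (degree T z ≤_) maxDegree≡Δ (degree≤maxDegree T z))
      i₀ , nn≤ = frequent-colour
      M , target , i , H , T≅H , count≡M = embedding i₀ nn≤
  in i , H , T≅H , subst (λ m → bound c₀ r n Δ ℚ.≤ + m / 1) (sym count≡M) (bound-c₀≤ r n Δ M target)
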